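{- Let $p>5$ be a prime, and let $\varepsilon_p=1,-1,0$ according as $p\equiv\pm1$, $\pm2$ or $\pm4\pmod 9$. (i) If $p\equiv1,4\pmod{15}$, so that $p=x^2+15y^2$ with $x,y\in\mathbb Z$, then $$2\sum_{k=0}^{[p/6]}\frac{\binom{6k}{2k}}{27^{2k}}-\varepsilon_p\equiv\sum_{k=0}^{[p/3]}\frac{\binom{3k}k}{(-27)^k}\equiv\begin{cases}1\pmod p&\text{if }3\mid y,\\ (x-5y)/(10y)\pmod p&\text{if }3\mid y-x.\end{cases}$$ (ii) If $p\equiv2,8\pmod{15}$, so that $p=5x^2+3y^2$ with $x,y\in\mathbb Z$, then $$2\sum_{k=0}^{[p/6]}\frac{\binom{6k}{2k}}{27^{2k}}-\varepsilon_p\equiv\sum_{k=0}^{[p/3]}\frac{\binom{3k}k}{(-27)^k}\equiv\begin{cases}1\pmod p&\text{if }3\mid y,\\ -(x+y)/(2y)\pmod p&\text{if }3\mid y-x.\end{cases}$$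
   Context: $[x]$ is the greatest integer not exceeding $x$. Quotients are interpreted modulo $p$. -}

module Defs where

open import Data.Nat as ℕ using (ℕ; zero; suc)
open import Data.Nat.DivMod using (_%_)
open import Data.Nat.Combinatorics using (_C_)
open import Data.Integer as ℤ using (ℤ; +_; -[1+_])
open import Data.Integer.Divisibility using () renaming (_∣_ to _∣ℤ_)
open import Data.Rational as ℚ using (ℚ; 0ℚ; 1ℚ; ↥_)
open import Data.List using (List; foldr; map; upTo)

-- Total division of integers into ℚ, with the convention a / 0 = 0
-- (the divisor is always nonzero where it is used in the statement).
divℤ : ℤ → ℤ → ℚ
divℤ a (+ zero)    = 0ℚ
divℤ a (+ (suc n)) = a ℚ./ suc n
divℤ a -[1+ n ]    = (ℤ.- a) ℚ./ suc n

sumTo : ℕ → (ℕ → ℚ) → ℚ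
sumTo N f = foldr ℚ._+_ 0ℚ (map f (upTo (suc N)))

-- Congruence of rationals modulo p: p divides the numerator of r - s
-- (in lowest terms).  For p-integral r, s this is congruence in Z_(p)/pZ_(p),
-- i.e. quotients are interpreted modulo p.
_≡_[modℚ_] : ℚ → ℚ → ℕ → Set
r ≡ s [modℚ p ] = (+ p) ∣ℤ (↥ (r ℚ.- s))

ε : ℕ → ℚ
ε p with p % 9
... | 1 = 1ℚ
... | 8 = 1ℚ
... | 2 = ℚ.- 1ℚ
... | 7 = ℚ.- 1ℚ
... | _ = 0ℚ

S₁ : ℕ → ℚ
S₁ p = sumTo (p ℕ./ 6) (λ k → divℤ (+ ((6 ℕ.* k) C (2 ℕ.* k))) (+ (27 ℕ.^ (2 ℕ.* k))))

S₂ : ℕ → ℚ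
S₂ p = sumTo (p ℕ./ 3) (λ k → divℤ (+ ((3 ℕ.* k) C k)) ((ℤ.- (+ 27)) ℤ.^ k))

A : ℕ → ℚ
A p = (+ 2 ℚ./ 1) ℚ.* S₁ p ℚ.- ε p

{-# OPTIONS --safe #-}
module Submission where

-- Put n = [p/3].  Modulo p one has C(3k,k) ≡ (−27)ᵏ C(n+k,2k), and Σ C(n+k,2k) is the
-- Fibonacci number F = F₂ₙ₊₁ while Σ (−1)ᵏ C(n+k,2k) has period 6 in n; hence the second
-- sum is F and twice the first one is F + ε.
--
-- Write u = √−3 and α = x + y u in ℤ[ω].  Modulo p the golden ratio is α/(2yu) in case (i)
-- and α/(2x) in case (ii), so F is known as soon as the cubic residue symbol of α modulo p
-- is.  By cubic reciprocity that symbol is, up to a unit, the symbol of p modulo α; as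
-- p ≡ ±(2x)² modulo x² + 3y², it reduces to the symbols of the primes ℓ dividing 2x.  For
-- those α ≡ −ᾱ modulo ℓ, so reciprocity makes them trivial except for the unit υ ≡ α
-- (mod 3), whose contribution depends only on x, y modulo 3.
--
-- Reciprocity between α and a rational prime ℓ is multiplicative in α, which reduces it to
-- Jacobi sums J modulo primes q ≡ 1 (mod 3).  There one computes g^ℓ, for g the cubic Gauss
-- sum in the group ring of ℤ/q, both from g⁴ = J² J̄ g and from the Frobenius map modulo ℓ.

open import Defs
open import Algebra.Bundles using (CommutativeSemiring; CommutativeRing)
import Algebra.Properties.CommutativeSemigroup as CSemigroup
import Algebra.Properties.CommutativeSemiring.Exp as Exp
import Algebra.Properties.Ring as RingProperties
import Algebra.Properties.Semiring.Mult as Mult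
import Algebra.Properties.Semiring.Sum as Sum
import Algebra.Solver.Ring.NaturalCoefficients.Default as SemiringSolver
open import Data.Empty using (⊥; ⊥-elim)
open import Data.Fin as Fin using (Fin; toℕ; fromℕ; fromℕ<; inject₁)
open import Data.Fin.Permutation using (permutation)
import Data.Fin.Properties as Fin
open import Data.Integer as ℤ using (ℤ; +_; -[1+_])
open import Data.Integer.DivMod using (_%ℕ_; _/ℕ_; a≡a%ℕn+[a/ℕn]*n; n%ℕd<d)
open import Data.Integer.Divisibility using () renaming (_∣_ to _∣ℤ_)
open import Data.Integer.Divisibility.Signed as ∣ using (_∣_; divides; ∣ᵤ⇒∣; ∣⇒∣ᵤ)
import Data.Integer.Properties as ℤ
import Data.Integer.Solver
open Data.Integer.Solver.+-*-Solver using (Polynomial; _:+_; _:*_; _:-_; :-_; _:=_; con; solve)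
open import Data.List using (List; []; _∷_; length; replicate; foldr; applyUpTo)
import Data.List.Properties as List
open import Data.List.Relation.Unary.All using (All; []; _∷_)
open import Data.Nat as ℕ using (ℕ; zero; suc; z≤n; s≤s; _<_; _%_)
open import Data.Nat.Combinatorics using (_C_; nCk≡n!/k![n-k]!; k![n∸k]!∣n!; nCn≡1; k>n⇒nCk≡0; nCk+nC[k+1]≡[n+1]C[k+1])
import Data.Nat.Divisibility as ℕ
open import Data.Nat.DivMod using (m/n*n≡m; m%n<n; m≡m%n+[m/n]*n; [m+n]%n≡m%n; %-distribˡ-*; m∣n⇒o%n%m≡o%m; m/n/o≡m/[n*o]; m/n*n≤m; +-distrib-/-∣ʳ; m*n/n≡m)
open import Data.Nat.Induction using (<-rec)
open import Data.Nat.ListAction using (product)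
open import Data.Nat.Primality using (Prime; euclidsLemma; prime⇒nonZero; prime⇒nonTrivial; prime⇒irreducible; prime[2]; prime?)
open import Data.Nat.Primality.Factorisation using (PrimeFactorisation; factorise)
import Data.Nat.Properties as ℕ
open import Data.Nat.Tactic.RingSolver using () renaming (solve-∀ to solveℕ-∀)
open import Data.Product using (∃; _×_; _,_; proj₁; proj₂)
open import Data.Rational as ℚ using (ℚ; 0ℚ; 1ℚ; ↥_; ↧_)
import Data.Rational.Properties as ℚ
open import Data.Rational.Unnormalised using (mkℚᵘ; *≡*)
open import Data.Sum using (_⊎_; inj₁; inj₂; [_,_]′)
open import Function using (_∘_)
open import Level using (0ℓ)
open import Relation.Binary using (Setoid)
open import Relation.Binary.PropositionalEquality as ≡ using (_≡_; _≢_; refl; sym; trans; cong; cong₂; subst)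
import Relation.Binary.Reasoning.Setoid as SetoidReasoning
open import Relation.Nullary using (¬_; Dec; yes; no)
open import Relation.Nullary.Decidable using (from-yes; map′)

-- No cyclotomic ring is constructed: in the group ring, congruences modulo ℓ are read off
-- coefficient by coefficient. The price is zero divisors. The classical g³ = q J fails there by a
-- multiple of the sum of all group elements, and one more factor g, which kills that sum, makes it
-- exact. No prime of ℤ[ω] above ℓ is chosen either. Reciprocity is a congruence modulo ℓ itself for
-- (α² ᾱ)^k with k = (ℓ ∓ 1)/3, a quantity multiplicative in α and compatible with conjugation.
-- Since α need not be primary, the laws carry υ^k, and k modulo 3 depends on ℓ modulo 9. Over the
-- primes dividing 2x these powers assemble into the value at 2x of a cubic character modulo 9. When
-- 3 divides y - x, one has p ≡ e (2x)² modulo 9 with e = 4 in case (i) and e = 2 in case (ii), so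
-- the character at p differs from the symbol of p modulo α only by its value at e, and everything
-- else cancels.

-- Binomial coefficients and the Frobenius map

nCk*k![n∸k]!≡n! : ∀ {n k} → k ℕ.≤ n → (n C k) ℕ.* ((k ℕ.!) ℕ.* ((n ℕ.∸ k) ℕ.!)) ≡ n ℕ.!
nCk*k![n∸k]!≡n! {n} {k} k≤n = trans
  (cong (ℕ._* ((k ℕ.!) ℕ.* ((n ℕ.∸ k) ℕ.!))) (nCk≡n!/k![n-k]! k≤n))
  (m/n*n≡m {{ k ℕ.!* (n ℕ.∸ k) !≢0 }} (k![n∸k]!∣n! k≤n))

prime∤! : ∀ {p} → Prime p → ∀ k → k ℕ.< p → ¬ (p ℕ.∣ k ℕ.!)
prime∤! {p} pr zero    k<p d = ℕ.<⇒≱ (ℕ.nonTrivial⇒n>1 p {{prime⇒nonTrivial pr}}) (ℕ.∣⇒≤ d)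
prime∤! {p} pr (suc k) k<p d with euclidsLemma (suc k) (k ℕ.!) pr d
... | inj₁ e = ℕ.<⇒≱ k<p (ℕ.∣⇒≤ e)
... | inj₂ e = prime∤! pr k (ℕ.<-trans (ℕ.n<1+n k) k<p) e

n∣n! : ∀ n .{{_ : ℕ.NonZero n}} → n ℕ.∣ n ℕ.!
n∣n! (suc n) = ℕ.m∣m*n (n ℕ.!)

prime∣C : ∀ {p k} → Prime p → 0 ℕ.< k → k ℕ.< p → p ℕ.∣ (p C k)
prime∣C {p} {k} pr 0<k k<p
  with euclidsLemma (p C k) ((k ℕ.!) ℕ.* ((p ℕ.∸ k) ℕ.!)) pr
         (subst (p ℕ.∣_) (sym (nCk*k![n∸k]!≡n! (ℕ.<⇒≤ k<p))) (n∣n! p {{prime⇒nonZero pr}}))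
... | inj₁ d = d
... | inj₂ d with euclidsLemma (k ℕ.!) ((p ℕ.∸ k) ℕ.!) pr d
...   | inj₁ e = ⊥-elim (prime∤! pr k k<p e)
...   | inj₂ e = ⊥-elim (prime∤! pr (p ℕ.∸ k) (ℕ.∸-monoʳ-< 0<k (ℕ.<⇒≤ k<p)) e)

abstract
  prime[3] : Prime 3
  prime[3] = from-yes (prime? 3)

module Frobenius {c e} (S : CommutativeSemiring c e) {p : ℕ} (pr : Prime p) where
  open CommutativeSemiring S renaming (refl to ≈-refl; sym to ≈-sym; trans to ≈-trans)
  open import Algebra.Properties.CommutativeSemiring.Exp S
  open import Algebra.Properties.Semiring.Mult semiring renaming (_×_ to _·_)
  open import Algebra.Properties.Semiring.Sum semiring using (sum; sum-init-last)
  open import Algebra.Properties.CommutativeMonoid.Mult +-commutativeMonoid using (×-distrib-+)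
  import Algebra.Properties.CommutativeSemiring.Binomial S as B
  open SetoidReasoning setoid

  infix 4 _≋_
  _≋_ : Carrier → Carrier → Set _
  x ≋ y = ∃ λ z → x ≈ y + p · z

  private
    ≋-+ : ∀ {x y x′ y′} → x ≋ y → x′ ≋ y′ → x + x′ ≋ y + y′
    ≋-+ {x} {y} {x′} {y′} (z , e) (z′ , e′) = z + z′ , (begin
      x + x′  ≈⟨ +-cong e e′ ⟩
      (y + p · z) + (y′ + p · z′)  ≈⟨ +-assoc y (p · z) _ ⟩
      y + (p · z + (y′ + p · z′))  ≈⟨ +-congˡ (+-assoc (p · z) y′ _) ⟨
      y + ((p · z + y′) + p · z′)  ≈⟨ +-congˡ (+-congʳ (+-comm (p · z) y′)) ⟩
      y + ((y′ + p · z) + p · z′)  ≈⟨ +-congˡ (+-assoc y′ (p · z) _) ⟩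
      y + (y′ + (p · z + p · z′))  ≈⟨ +-assoc y y′ _ ⟨
      (y + y′) + (p · z + p · z′)  ≈⟨ +-congˡ (×-distrib-+ z z′ p) ⟨
      (y + y′) + p · (z + z′)  ∎)

    p·0 : p · 0# ≈ 0#
    p·0 = ≈-trans (×-congʳ p (≈-sym (zeroˡ 0#))) (≈-trans (≈-sym (×-comm-* p 0# 0#)) (zeroˡ _))

    ≈⇒≋ : ∀ {x y} → x ≈ y → x ≋ y
    ≈⇒≋ {x} {y} e = 0# , ≈-trans e (≈-sym (≈-trans (+-congˡ p·0) (+-identityʳ y)))

    sum≋0 : ∀ {n} (f : Fin n → Carrier) → (∀ i → f i ≋ 0#) → sum f ≋ 0#
    sum≋0 {zero}  f h = ≈⇒≋ ≈-refl
    sum≋0 {suc n} f h with ≋-+ (h Fin.zero) (sum≋0 (f ∘ Fin.suc) (h ∘ Fin.suc))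
    ... | z , e = z , ≈-trans e (+-congʳ (+-identityˡ 0#))

    ∣⇒≋0 : ∀ {n} x → p ℕ.∣ n → n · x ≋ 0#
    ∣⇒≋0 {n} x (ℕ.divides q refl) = q · x , (begin
      (q ℕ.* p) · x  ≡⟨ cong (_· x) (ℕ.*-comm q p) ⟩
      (p ℕ.* q) · x  ≈⟨ ×-assocˡ x p q ⟨
      p · (q · x)  ≈⟨ +-identityˡ _ ⟨
      0# + p · (q · x) ∎)

  -- Semirings suffice, so one proof serves ℤ, ℤ[ω] and the group ring of ℤ/q. The inner binomial
  -- terms are collected into the explicit multiple `p · z`, which needs no subtraction.
  freshman : ∀ x y → (x + y) ^ p ≋ x ^ p + y ^ p
  freshman x y = expand p refl
    where
    expand : ∀ n → n ≡ p → (x + y) ^ n ≋ x ^ n + y ^ n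
    expand zero n≡p = ⊥-elim (ℕ.≢-nonZero⁻¹ p {{prime⇒nonZero pr}} (sym n≡p))
    expand (suc m) refl =
      z , (begin
        (x + y) ^ suc m  ≈⟨ B.theorem (suc m) x y ⟩
        T Fin.zero + sum (T ∘ Fin.suc)  ≈⟨ +-congˡ (sum-init-last (T ∘ Fin.suc)) ⟩
        T Fin.zero + (sum mid + T (fromℕ (suc m)))  ≈⟨ +-cong first (+-cong (proj₂ mid≋0) last) ⟩
        y ^ suc m + ((0# + suc m · z) + x ^ suc m)  ≈⟨ +-congˡ (+-congʳ (+-identityˡ _)) ⟩
        y ^ suc m + (suc m · z + x ^ suc m)  ≈⟨ +-comm _ _ ⟩
        (suc m · z + x ^ suc m) + y ^ suc m  ≈⟨ +-assoc _ _ _ ⟩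
        suc m · z + (x ^ suc m + y ^ suc m)  ≈⟨ +-comm _ _ ⟩
        (x ^ suc m + y ^ suc m) + suc m · z  ∎)
      where
      T : Fin (suc (suc m)) → Carrier
      T = B.binomialTerm x y (suc m)
      mid : Fin m → Carrier
      mid i = T (Fin.suc (inject₁ i))
      mid≋0 : sum mid ≋ 0#
      mid≋0 = sum≋0 mid λ i → ∣⇒≋0 _ (prime∣C pr (s≤s z≤n)
        (s≤s (subst (ℕ._< m) (sym (Fin.toℕ-inject₁ i)) (Fin.toℕ<n i))))
      z : Carrier
      z = proj₁ mid≋0
      first : T Fin.zero ≈ y ^ suc m
      first = ≈-trans (+-identityʳ _) (*-identityˡ _)
      last : T (fromℕ (suc m)) ≈ x ^ suc m
      last = begin
        (suc m C toℕ (fromℕ (suc m))) · (x ^ toℕ (fromℕ (suc m)) * y ^ (suc m ℕ.∸ toℕ (fromℕ (suc m))))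
          ≡⟨ cong (λ k → (suc m C k) · (x ^ k * y ^ (suc m ℕ.∸ k))) (Fin.toℕ-fromℕ (suc m)) ⟩
        (suc m C suc m) · (x ^ suc m * y ^ (suc m ℕ.∸ suc m))
          ≡⟨ cong₂ (λ a b → a · (x ^ suc m * y ^ b)) (nCn≡1 (suc m)) (ℕ.n∸n≡0 m) ⟩
        1 · (x ^ suc m * 1#)  ≈⟨ +-identityʳ _ ⟩
        x ^ suc m * 1#  ≈⟨ *-identityʳ _ ⟩
        x ^ suc m  ∎

  freshman-sum : ∀ {n} (f : Fin n → Carrier) → sum f ^ p ≋ sum (λ i → f i ^ p)
  freshman-sum {zero} f = ≈⇒≋ (zero^ p {{prime⇒nonZero pr}})
    where
    zero^ : ∀ n .{{_ : ℕ.NonZero n}} → 0# ^ n ≈ 0#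
    zero^ (suc n) = zeroˡ _
  freshman-sum {suc n} f with freshman (f Fin.zero) (sum (f ∘ Fin.suc)) | freshman-sum (f ∘ Fin.suc)
  ... | z , e | z′ , e′ = z′ + z , (begin
    (f Fin.zero + sum (f ∘ Fin.suc)) ^ p  ≈⟨ e ⟩
    f Fin.zero ^ p + sum (f ∘ Fin.suc) ^ p + p · z  ≈⟨ +-congʳ (+-congˡ e′) ⟩
    f Fin.zero ^ p + (_ + p · z′) + p · z  ≈⟨ +-congʳ (+-assoc _ _ _) ⟨
    (f Fin.zero ^ p + _) + p · z′ + p · z  ≈⟨ +-assoc _ _ _ ⟩
    (f Fin.zero ^ p + _) + (p · z′ + p · z)  ≈⟨ +-congˡ (×-distrib-+ z′ z p) ⟨
    (f Fin.zero ^ p + _) + p · (z′ + z)  ∎)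

-- Congruences in a commutative ring

module Congruence {c e} (K : CommutativeRing c e) (m : CommutativeRing.Carrier K) where
  open CommutativeRing K renaming (refl to ≈-refl; sym to ≈-sym; trans to ≈-trans)
  open import Algebra.Properties.CommutativeSemiring.Exp commutativeSemiring using (_^_)
  open import Algebra.Properties.Ring ring using (-‿distribˡ-*; -‿distribʳ-*; -‿+-comm)
  open import Algebra.Properties.CommutativeSemigroup +-commutativeSemigroup using (interchange)
  open SetoidReasoning setoid

  infix 4 _≋_
  record _≋_ (x y : Carrier) : Set (c Level.⊔ e) where
    constructor by
    field
      quot   : Carrier
      equal  : x ≈ y + m * quot

  ≈⇒≋ : ∀ {x y} → x ≈ y → x ≋ y
  ≈⇒≋ {x} {y} h = by 0# (≈-trans h (≈-sym (≈-trans (+-congˡ (zeroʳ m)) (+-identityʳ y))))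

  ≋-refl : ∀ {x} → x ≋ x
  ≋-refl = ≈⇒≋ ≈-refl

  ≋-sym : ∀ {x y} → x ≋ y → y ≋ x
  ≋-sym {x} {y} (by z h) = by (- z) (begin
    y  ≈⟨ +-identityʳ y ⟨
    y + 0#  ≈⟨ +-congˡ (-‿inverseʳ (m * z)) ⟨
    y + (m * z + - (m * z))  ≈⟨ +-assoc _ _ _ ⟨
    y + m * z + - (m * z)  ≈⟨ +-cong (≈-sym h) (-‿distribʳ-* m z) ⟩
    x + m * - z  ∎)

  ≋-trans : ∀ {x y z} → x ≋ y → y ≋ z → x ≋ z
  ≋-trans {x} {y} {z} (by s h) (by t k) = by (t + s) (begin
    x  ≈⟨ h ⟩
    y + m * s  ≈⟨ +-congʳ k ⟩
    z + m * t + m * s  ≈⟨ +-assoc _ _ _ ⟩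
    z + (m * t + m * s)  ≈⟨ +-congˡ (distribˡ m t s) ⟨
    z + m * (t + s)  ∎)

  ≋-setoid : Setoid c (c Level.⊔ e)
  ≋-setoid = record { Carrier = Carrier ; _≈_ = _≋_
    ; isEquivalence = record { refl = ≋-refl ; sym = ≋-sym ; trans = ≋-trans } }

  ≋-+ : ∀ {x y x′ y′} → x ≋ y → x′ ≋ y′ → x + x′ ≋ y + y′
  ≋-+ {x} {y} {x′} {y′} (by s h) (by t k) = by (s + t) (begin
    x + x′  ≈⟨ +-cong h k ⟩
    (y + m * s) + (y′ + m * t)  ≈⟨ interchange _ _ _ _ ⟩
    (y + y′) + (m * s + m * t)  ≈⟨ +-congˡ (distribˡ m s t) ⟨
    y + y′ + m * (s + t)  ∎)

  ≋-neg : ∀ {x y} → x ≋ y → - x ≋ - y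
  ≋-neg {x} {y} (by s h) = by (- s) (begin
    - x  ≈⟨ -‿cong h ⟩
    - (y + m * s)  ≈⟨ -‿+-comm y (m * s) ⟨
    - y + - (m * s)  ≈⟨ +-congˡ (-‿distribʳ-* m s) ⟩
    - y + m * - s  ∎)

  ≋-*ˡ : ∀ {x y} z → x ≋ y → z * x ≋ z * y
  ≋-*ˡ {x} {y} z (by s h) = by (z * s) (begin
    z * x  ≈⟨ *-congˡ h ⟩
    z * (y + m * s)  ≈⟨ distribˡ z y _ ⟩
    z * y + z * (m * s) ≈⟨ +-congˡ (*-assoc z m s) ⟨
    z * y + z * m * s  ≈⟨ +-congˡ (*-congʳ (*-comm z m)) ⟩
    z * y + m * z * s  ≈⟨ +-congˡ (*-assoc m z s) ⟩
    z * y + m * (z * s) ∎)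

  ≋-*ʳ : ∀ {x y} z → x ≋ y → x * z ≋ y * z
  ≋-*ʳ {x} {y} z h = ≋-trans (≈⇒≋ (*-comm x z)) (≋-trans (≋-*ˡ z h) (≈⇒≋ (*-comm z y)))

  ≋-* : ∀ {x y x′ y′} → x ≋ y → x′ ≋ y′ → x * x′ ≋ y * y′
  ≋-* {x} {y} {x′} {y′} h k = ≋-trans (≋-*ʳ x′ h) (≋-*ˡ y k)

  ≋-^ : ∀ {x y} n → x ≋ y → x ^ n ≋ y ^ n
  ≋-^ zero    h = ≋-refl
  ≋-^ (suc n) h = ≋-* h (≋-^ n h)

open import Data.Integer using (_+_; _-_; _*_; -_)

-- The ring ℤ[ω]: ⟨ a , b ⟩ is a + b ω with ω² + ω + 1 = 0.
infix 6 ⟨_,_⟩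
record 𝔼 : Set where
  no-eta-equality
  pattern
  constructor ⟨_,_⟩
  field
    re im : ℤ
open 𝔼 public

infixl 6 _⊕_
infixl 7 _⊗_
infix  8 ⊖_
_⊕_ _⊗_ : 𝔼 → 𝔼 → 𝔼
⟨ a , b ⟩ ⊕ ⟨ c , d ⟩ = ⟨ a + c , b + d ⟩
⟨ a , b ⟩ ⊗ ⟨ c , d ⟩ = ⟨ a * c - b * d , a * d + b * c - b * d ⟩

⊖_ conj : 𝔼 → 𝔼
⊖ ⟨ a , b ⟩ = ⟨ - a , - b ⟩
conj ⟨ a , b ⟩ = ⟨ a - b , - b ⟩

ι : ℤ → 𝔼
ι a = ⟨ a , + 0 ⟩

0ᴱ 1ᴱ ωᴱ : 𝔼
0ᴱ = ι (+ 0)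
1ᴱ = ι (+ 1)
ωᴱ = ⟨ + 0 , + 1 ⟩

norm : 𝔼 → ℤ
norm ⟨ a , b ⟩ = a * a - a * b + b * b

infix 9 #_
#_ : ∀ {n} → ℕ → Polynomial n
# k = con (+ k)

-- The operations of 𝔼 on pairs of solver polynomials, so that an identity in 𝔼
-- becomes two integer identities without expanding it by hand.
𝔼[_] : ℕ → Set
𝔼[ n ] = Polynomial n × Polynomial n

infixl 6 _:⊕_
infixl 7 _:⊗_
_:⊕_ _:⊗_ : ∀ {n} → 𝔼[ n ] → 𝔼[ n ] → 𝔼[ n ]
(a , b) :⊕ (c , d) = a :+ c , b :+ d
(a , b) :⊗ (c , d) = a :* c :- b :* d , a :* d :+ b :* c :- b :* d

:conj : ∀ {n} → 𝔼[ n ] → 𝔼[ n ]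
:conj (a , b) = a :- b , :- b

:ι : ∀ {n} → Polynomial n → 𝔼[ n ]
:ι a = a , # 0

:norm : ∀ {n} → 𝔼[ n ] → Polynomial n
:norm (a , b) = a :* a :- a :* b :+ b :* b

:re :im : ∀ {n} → 𝔼[ n ] → Polynomial n
:re = proj₁
:im = proj₂

𝔼-commutativeRing : CommutativeRing 0ℓ 0ℓ
𝔼-commutativeRing = record
  { Carrier = 𝔼 ; _≈_ = _≡_ ; _+_ = _⊕_ ; _*_ = _⊗_ ; -_ = ⊖_ ; 0# = 0ᴱ ; 1# = 1ᴱ
  ; isCommutativeRing = record
    { isRing = record
      { +-isAbelianGroup = record
        { isGroup = record
          { isMonoid = record
            { isSemigroup = record
              { isMagma = record { isEquivalence = ≡.isEquivalence ; ∙-cong = cong₂ _⊕_ }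
              ; assoc = λ { ⟨ a , b ⟩ ⟨ c , d ⟩ ⟨ e , f ⟩ →
                  cong₂ ⟨_,_⟩ (ℤ.+-assoc a c e) (ℤ.+-assoc b d f) } }
            ; identity = (λ { ⟨ a , b ⟩ → cong₂ ⟨_,_⟩ (ℤ.+-identityˡ a) (ℤ.+-identityˡ b) })
                       , (λ { ⟨ a , b ⟩ → cong₂ ⟨_,_⟩ (ℤ.+-identityʳ a) (ℤ.+-identityʳ b) }) }
          ; inverse = (λ { ⟨ a , b ⟩ → cong₂ ⟨_,_⟩ (ℤ.+-inverseˡ a) (ℤ.+-inverseˡ b) })
                    , (λ { ⟨ a , b ⟩ → cong₂ ⟨_,_⟩ (ℤ.+-inverseʳ a) (ℤ.+-inverseʳ b) })
          ; ⁻¹-cong = cong ⊖_ }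
        ; comm = λ { ⟨ a , b ⟩ ⟨ c , d ⟩ → cong₂ ⟨_,_⟩ (ℤ.+-comm a c) (ℤ.+-comm b d) } }
      ; *-cong = cong₂ _⊗_
      ; *-assoc = λ { ⟨ a , b ⟩ ⟨ c , d ⟩ ⟨ e , f ⟩ → cong₂ ⟨_,_⟩
          (solve 6 (λ a b c d e f → :re ((a , b) :⊗ (c , d) :⊗ (e , f)) := :re ((a , b) :⊗ ((c , d) :⊗ (e , f))))
            refl a b c d e f)
          (solve 6 (λ a b c d e f → :im ((a , b) :⊗ (c , d) :⊗ (e , f)) := :im ((a , b) :⊗ ((c , d) :⊗ (e , f))))
            refl a b c d e f) }
      ; *-identity = (λ { ⟨ a , b ⟩ → cong₂ ⟨_,_⟩
          (solve 2 (λ a b → :re (:ι (# 1) :⊗ (a , b)) := :re ((a , b))) refl a b)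
          (solve 2 (λ a b → :im (:ι (# 1) :⊗ (a , b)) := :im ((a , b))) refl a b) })
                   , (λ { ⟨ a , b ⟩ → cong₂ ⟨_,_⟩
          (solve 2 (λ a b → :re ((a , b) :⊗ :ι (# 1)) := :re ((a , b))) refl a b)
          (solve 2 (λ a b → :im ((a , b) :⊗ :ι (# 1)) := :im ((a , b))) refl a b) })
      ; distrib = (λ { ⟨ a , b ⟩ ⟨ c , d ⟩ ⟨ e , f ⟩ → cong₂ ⟨_,_⟩
          (solve 6 (λ a b c d e f → :re ((a , b) :⊗ ((c , d) :⊕ (e , f)))
            := :re (((a , b) :⊗ (c , d)) :⊕ ((a , b) :⊗ (e , f)))) refl a b c d e f)
          (solve 6 (λ a b c d e f → :im ((a , b) :⊗ ((c , d) :⊕ (e , f)))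
            := :im (((a , b) :⊗ (c , d)) :⊕ ((a , b) :⊗ (e , f)))) refl a b c d e f) })
                , (λ { ⟨ a , b ⟩ ⟨ c , d ⟩ ⟨ e , f ⟩ → cong₂ ⟨_,_⟩
          (solve 6 (λ a b c d e f → :re (((c , d) :⊕ (e , f)) :⊗ (a , b))
            := :re (((c , d) :⊗ (a , b)) :⊕ ((e , f) :⊗ (a , b)))) refl a b c d e f)
          (solve 6 (λ a b c d e f → :im (((c , d) :⊕ (e , f)) :⊗ (a , b))
            := :im (((c , d) :⊗ (a , b)) :⊕ ((e , f) :⊗ (a , b)))) refl a b c d e f) })
      }
    ; *-comm = λ { ⟨ a , b ⟩ ⟨ c , d ⟩ → cong₂ ⟨_,_⟩
          (solve 4 (λ a b c d → :re ((a , b) :⊗ (c , d)) := :re ((c , d) :⊗ (a , b))) refl a b c d)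
          (solve 4 (λ a b c d → :im ((a , b) :⊗ (c , d)) := :im ((c , d) :⊗ (a , b))) refl a b c d) }
    }
  }

conj-⊗ : ∀ x y → conj (x ⊗ y) ≡ conj x ⊗ conj y
conj-⊗ ⟨ a , b ⟩ ⟨ c , d ⟩ = cong₂ ⟨_,_⟩
          (solve 4 (λ a b c d → :re (:conj ((a , b) :⊗ (c , d))) := :re (:conj (a , b) :⊗ :conj (c , d))) refl a b c d)
          (solve 4 (λ a b c d → :im (:conj ((a , b) :⊗ (c , d))) := :im (:conj (a , b) :⊗ :conj (c , d))) refl a b c d)

conj-⊕ : ∀ x y → conj (x ⊕ y) ≡ conj x ⊕ conj y
conj-⊕ ⟨ a , b ⟩ ⟨ c , d ⟩ = cong₂ ⟨_,_⟩
          (solve 4 (λ a b c d → :re (:conj ((a , b) :⊕ (c , d))) := :re (:conj (a , b) :⊕ :conj (c , d))) refl a b c d)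
          (solve 4 (λ a b c d → :im (:conj ((a , b) :⊕ (c , d))) := :im (:conj (a , b) :⊕ :conj (c , d))) refl a b c d)

conj-conj : ∀ x → conj (conj x) ≡ x
conj-conj ⟨ a , b ⟩ = cong₂ ⟨_,_⟩
          (solve 2 (λ a b → :re (:conj (:conj (a , b))) := :re ((a , b))) refl a b)
          (solve 2 (λ a b → :im (:conj (:conj (a , b))) := :im ((a , b))) refl a b)

⊗-conj : ∀ x → x ⊗ conj x ≡ ι (norm x)
⊗-conj ⟨ a , b ⟩ = cong₂ ⟨_,_⟩
          (solve 2 (λ a b → :re ((a , b) :⊗ :conj (a , b)) := :re (:ι (:norm (a , b)))) refl a b)
          (solve 2 (λ a b → :im ((a , b) :⊗ :conj (a , b)) := :im (:ι (:norm (a , b)))) refl a b)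

norm-⊗ : ∀ x y → norm (x ⊗ y) ≡ norm x * norm y
norm-⊗ ⟨ a , b ⟩ ⟨ c , d ⟩ = solve 4 (λ a b c d → :norm ((a , b) :⊗ (c , d)) := :norm (a , b) :* :norm (c , d)) refl a b c d

norm-conj : ∀ x → norm (conj x) ≡ norm x
norm-conj ⟨ a , b ⟩ = solve 2 (λ a b → :norm (:conj (a , b)) := :norm (a , b)) refl a b

ι-⊗ : ∀ a b → ι (a * b) ≡ ι a ⊗ ι b
ι-⊗ a b = cong₂ ⟨_,_⟩
          (solve 2 (λ a b → :re (:ι (a :* b)) := :re (:ι a :⊗ :ι b)) refl a b)
          (solve 2 (λ a b → :im (:ι (a :* b)) := :im (:ι a :⊗ :ι b)) refl a b)

ι-scale : ∀ a c d → ι a ⊗ ⟨ c , d ⟩ ≡ ⟨ a * c , a * d ⟩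
ι-scale a c d = cong₂ ⟨_,_⟩
          (solve 3 (λ a c d → :re (:ι a :⊗ (c , d)) := :re (a :* c , a :* d)) refl a c d)
          (solve 3 (λ a c d → :im (:ι a :⊗ (c , d)) := :im (a :* c , a :* d)) refl a c d)

private
  module ℤ-ring = CommutativeRing ℤ.+-*-commutativeRing
  module 𝔼-ring = CommutativeRing 𝔼-commutativeRing
open CommutativeRing 𝔼-commutativeRing using () renaming
  ( *-identityˡ to ⊗-identityˡ ; *-identityʳ to ⊗-identityʳ ; *-comm to ⊗-comm
  ; *-assoc to ⊗-assoc ; zeroˡ to ⊗-zeroˡ ; zeroʳ to ⊗-zeroʳ ; distribˡ to ⊗-distribˡ
  ; distribʳ to ⊗-distribʳ ; +-identityˡ to ⊕-identityˡ ; +-identityʳ to ⊕-identityʳ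
  ; +-comm to ⊕-comm ; +-assoc to ⊕-assoc ; -‿inverseʳ to ⊕-inverseʳ ; -‿inverseˡ to ⊕-inverseˡ )
open SemiringSolver 𝔼-ring.commutativeSemiring using () renaming (solve to solveᴱ; _:+_ to _:⊹_; _:*_ to _:⋆_; _:=_ to _:≡_)
open CSemigroup 𝔼-ring.*-commutativeSemigroup using (interchange; x∙yz≈y∙xz)
open RingProperties 𝔼-ring.ring using (-‿distribˡ-*; -‿distribʳ-*)
open Sum 𝔼-ring.semiring using (sum; sum-cong-≗; ∑-comm; sum-permute; *-distribˡ-sum; *-distribʳ-sum; ∑-distrib-+; sum-replicate-zero)
open Mult ℤ-ring.semiring using () renaming (_×_ to _·ᶻ_)
open Mult 𝔼-ring.semiring using () renaming (_×_ to _·ᴱ_)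

open Exp ℤ-ring.commutativeSemiring public using () renaming
  ( _^_ to _^ᶻ_; ^-assocʳ to ^ᶻ-*; ^-distrib-* to ^ᶻ-distrib )
open Exp 𝔼-ring.commutativeSemiring public using () renaming
  ( _^_ to _^ᴱ_; ^-assocʳ to ^ᴱ-*; ^-distrib-* to ^ᴱ-distrib )

1^ᶻ : ∀ n → (+ 1) ^ᶻ n ≡ + 1
1^ᶻ zero    = refl
1^ᶻ (suc n) = trans (ℤ.*-identityˡ ((+ 1) ^ᶻ n)) (1^ᶻ n)

1^ᴱ : ∀ n → 1ᴱ ^ᴱ n ≡ 1ᴱ
1^ᴱ zero    = refl
1^ᴱ (suc n) = trans (⊗-identityˡ (1ᴱ ^ᴱ n)) (1^ᴱ n)

ω^3k : ∀ k → ωᴱ ^ᴱ (3 ℕ.* k) ≡ 1ᴱ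
ω^3k k = trans (sym (^ᴱ-* ωᴱ 3 k)) (1^ᴱ k)

module ℤ/ (m : ℤ) = Congruence ℤ.+-*-commutativeRing m
module 𝔼/ (m : ℤ) = Congruence 𝔼-commutativeRing (ι m)

infix 4 _≋_[ℤ/_] _≋_[𝔼/_]
_≋_[ℤ/_] : ℤ → ℤ → ℤ → Set
a ≋ b [ℤ/ m ] = ℤ/._≋_ m a b

_≋_[𝔼/_] : 𝔼 → 𝔼 → ℤ → Set
x ≋ y [𝔼/ m ] = 𝔼/._≋_ m x y

·ᶻ≡* : ∀ n z → n ·ᶻ z ≡ + n * z
·ᶻ≡* zero    z = refl
·ᶻ≡* (suc n) z = trans (cong (_+_ z) (·ᶻ≡* n z)) (sym (ℤ.suc-* (+ n) z))

·ᴱ≡⊗ : ∀ n z → n ·ᴱ z ≡ ι (+ n) ⊗ z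
·ᴱ≡⊗ n ⟨ c , d ⟩ = trans (go n) (sym (ι-scale (+ n) c d))
  where
  go : ∀ n → n ·ᴱ ⟨ c , d ⟩ ≡ ⟨ + n * c , + n * d ⟩
  go zero = refl
  go (suc n) = trans (cong (⟨ c , d ⟩ ⊕_) (go n))
    (cong₂ ⟨_,_⟩ (sym (ℤ.suc-* (+ n) c)) (sym (ℤ.suc-* (+ n) d)))

ι-^ : ∀ a n → ι (a ^ᶻ n) ≡ ι a ^ᴱ n
ι-^ a zero    = refl
ι-^ a (suc n) = trans (ι-⊗ a (a ^ᶻ n)) (cong (ι a ⊗_) (ι-^ a n))

conj-^ : ∀ x n → conj (x ^ᴱ n) ≡ conj x ^ᴱ n
conj-^ x zero    = refl
conj-^ x (suc n) = trans (conj-⊗ x (x ^ᴱ n)) (cong (conj x ⊗_) (conj-^ x n))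

euclidℤ : ∀ {p} → Prime p → ∀ a b → + p ∣ a * b → + p ∣ a ⊎ + p ∣ b
euclidℤ {p} pr a b d with euclidsLemma ℤ.∣ a ∣ ℤ.∣ b ∣ pr (subst (p ℕ.∣_) (ℤ.abs-* a b) (∣⇒∣ᵤ d))
... | inj₁ h = inj₁ (∣ᵤ⇒∣ h)
... | inj₂ h = inj₂ (∣ᵤ⇒∣ h)

module _ {m : ℤ} where
  open ℤ/ m

  ≋⇒∣ : ∀ {a b} → a ≋ b → m ∣ a - b
  ≋⇒∣ {a} {b} (by z e) = divides z (trans (cong (_- b) e)
    (solve 3 (λ b m z → b :+ m :* z :- b := z :* m) refl b m z))

  ∣⇒≋ : ∀ {a b} → m ∣ a - b → a ≋ b
  ∣⇒≋ {a} {b} (divides z e) = by z (trans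
    (solve 2 (λ a b → a := b :+ (a :- b)) refl a b)
    (cong (_+_ b) (trans e (ℤ.*-comm z m))))

  ≋0⇒∣ : ∀ {a} → a ≋ + 0 → m ∣ a
  ≋0⇒∣ {a} h = subst (m ∣_) (ℤ.+-identityʳ a) (≋⇒∣ h)

  ∣⇒≋0 : ∀ {a} → m ∣ a → a ≋ + 0
  ∣⇒≋0 {a} h = ∣⇒≋ (subst (m ∣_) (sym (ℤ.+-identityʳ a)) h)

  infix 4 _≋?_
  _≋?_ : ∀ a b → Dec (a ≋ b)
  a ≋? b with m ∣.∣? (a - b)
  ... | yes d = yes (∣⇒≋ d)
  ... | no ¬d = no (¬d ∘ ≋⇒∣)

  ι-≋ : ∀ {a b} → a ≋ b → ι a ≋ ι b [𝔼/ m ]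
  ι-≋ {a} {b} (by z e) = 𝔼/.by (ι z) (trans (cong ι e) (cong (ι b ⊕_) (ι-⊗ m z)))

module _ {m : ℤ} where
  open 𝔼/ m

  conj-≋ : ∀ {x y} → x ≋ y → conj x ≋ conj y
  conj-≋ {x} {y} (by z e) = by (conj z) (trans (cong conj e)
    (trans (conj-⊕ y (ι m ⊗ z)) (cong (conj y ⊕_)
      (trans (conj-⊗ (ι m) z) (cong (λ t → ⟨ t , + 0 ⟩ ⊗ conj z) (ℤ.+-identityʳ m))))))

  re-≋ : ∀ {x y} → x ≋ y → re x ≋ re y [ℤ/ m ]
  re-≋ {x} {y@(⟨ _ , _ ⟩)} (by ⟨ c , d ⟩ e) = ℤ/.by c (trans (cong re e) (cong (λ t → re (y ⊕ t)) (ι-scale m c d)))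

  im-≋ : ∀ {x y} → x ≋ y → im x ≋ im y [ℤ/ m ]
  im-≋ {x} {y@(⟨ _ , _ ⟩)} (by ⟨ c , d ⟩ e) = ℤ/.by d (trans (cong im e) (cong (λ t → im (y ⊕ t)) (ι-scale m c d)))

  ⟨⟩-≋ : ∀ {a b c d} → a ≋ c [ℤ/ m ] → b ≋ d [ℤ/ m ] → ⟨ a , b ⟩ ≋ ⟨ c , d ⟩
  ⟨⟩-≋ {a} {b} {c} {d} (ℤ/.by s e) (ℤ/.by t f) = by ⟨ s , t ⟩
    (trans (cong₂ ⟨_,_⟩ e f) (cong (⟨ c , d ⟩ ⊕_) (sym (ι-scale m s t))))

-- Arithmetic modulo a prime

module ModPrime {p : ℕ} (pr : Prime p) where
  open ℤ/ (+ p)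
  open SetoidReasoning ≋-setoid

  private
    instance
      p≢0 : ℕ.NonZero p
      p≢0 = prime⇒nonZero pr

  p∤1 : ¬ (+ p ∣ + 1)
  p∤1 d = ℕ.<⇒≱ (ℕ.nonTrivial⇒n>1 p {{prime⇒nonTrivial pr}}) (ℕ.∣⇒≤ (∣⇒∣ᵤ d))

  cancelˡ : ∀ {c a b} → ¬ (+ p ∣ c) → c * a ≋ c * b → a ≋ b
  cancelˡ {c} {a} {b} p∤c h with euclidℤ pr c (a - b)
    (subst (+ p ∣_) (solve 3 (λ c a b → c :* a :- c :* b := c :* (a :- b)) refl c a b) (≋⇒∣ h))
  ... | inj₁ d = ⊥-elim (p∤c d)
  ... | inj₂ d = ∣⇒≋ d

  fermat : ∀ a → a ^ᶻ p ≋ a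
  fermat a = begin
    a ^ᶻ p  ≈⟨ ≋-^ p a≋r ⟩
    (+ (a %ℕ p)) ^ᶻ p  ≈⟨ pos (a %ℕ p) ⟩
    + (a %ℕ p)  ≈⟨ a≋r ⟨
    a  ∎
    where
    a≋r : a ≋ + (a %ℕ p)
    a≋r = by (a /ℕ p) (trans (a≡a%ℕn+[a/ℕn]*n a p) (cong (_+_ (+ (a %ℕ p))) (ℤ.*-comm (a /ℕ p) (+ p))))
    0^ : ∀ n .{{_ : ℕ.NonZero n}} → (+ 0) ^ᶻ n ≡ + 0
    0^ (suc n) = refl
    pos : ∀ r → (+ r) ^ᶻ p ≋ + r
    pos zero    = ≈⇒≋ (0^ p)
    pos (suc r) = begin
      (+ 1 + + r) ^ᶻ p  ≈⟨ by (proj₁ F) (trans (proj₂ F) (cong (λ t → (+ 1) ^ᶻ p + (+ r) ^ᶻ p + t) (·ᶻ≡* p _))) ⟩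
      (+ 1) ^ᶻ p + (+ r) ^ᶻ p  ≈⟨ ≋-+ (≈⇒≋ (1^ᶻ p)) (pos r) ⟩
      + suc r  ∎
      where F = Frobenius.freshman ℤ-ring.commutativeSemiring pr (+ 1) (+ r)

  fermat′ : ∀ {a n} → p ≡ suc n → ¬ (+ p ∣ a) → a ^ᶻ n ≋ + 1
  fermat′ {a} {n} p≡1+n p∤a = cancelˡ p∤a (begin
    a * a ^ᶻ n  ≡⟨ cong (a ^ᶻ_) p≡1+n ⟨
    a ^ᶻ p  ≈⟨ fermat a ⟩
    a  ≡⟨ ℤ.*-identityʳ a ⟨
    a * + 1  ∎)

  inverse : ∀ {a} → ¬ (+ p ∣ a) → ∃ λ b → b * a ≋ + 1
  inverse {a} p∤a = go p refl
    where
    go : ∀ n → p ≡ n → ∃ λ b → b * a ≋ + 1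
    go zero e = ⊥-elim (ℕ.≢-nonZero⁻¹ p e)
    go (suc zero) e = ⊥-elim (p∤1 (subst (λ t → + t ∣ + 1) (sym e) ∣.∣-refl))
    go (suc (suc n)) e = a ^ᶻ n , ≋-trans (≈⇒≋ (ℤ.*-comm (a ^ᶻ n) a)) (fermat′ e p∤a)

  -- The list c₀ ∷ … ∷ cₙ₋₁ ∷ [] stands for the monic polynomial c₀ + … + cₙ₋₁ Xⁿ⁻¹ + Xⁿ.
  private
    ev : List ℤ → ℤ → ℤ
    ev []       x = + 1
    ev (c ∷ cs) x = c + x * ev cs x

    factor : ∀ c cs a → ∃ λ ds → length ds ≡ length cs
           × (∀ x → ev (c ∷ cs) x ≡ ev (c ∷ cs) a + (x - a) * ev ds x)
    factor c [] a = [] , refl , λ x →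
      solve 3 (λ c x a → c :+ x :* # 1 := (c :+ a :* # 1) :+ (x :- a) :* # 1) refl c x a
    factor c (c′ ∷ cs) a with factor c′ cs a
    ... | ds , len , h = (ev (c′ ∷ cs) a ∷ ds) , cong suc len , λ x → trans
      (cong (λ t → c + x * t) (h x))
      (solve 5 (λ c x a e d → c :+ x :* (e :+ (x :- a) :* d) := c :+ a :* e :+ (x :- a) :* (e :+ x :* d))
        refl c x a (ev (c′ ∷ cs) a) (ev ds x))

    -- The root at `b` splits off a factor X - b, whose value at b + 1 + i is `suc i`. That is at
    -- most the degree, hence prime to p, so the quotient inherits the remaining roots. Taking
    -- consecutive integers makes distinctness modulo p automatic.
    no-roots : ∀ n cs b → length cs ≡ n → n ℕ.< p → ¬ (∀ i → i ℕ.≤ n → ev cs (+ (b ℕ.+ i)) ≋ + 0)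
    no-roots zero    [] b _ _ roots = p∤1 (≋0⇒∣ (roots 0 z≤n))
    no-roots (suc n) (c ∷ cs) b len n<p roots with factor c cs (+ b)
    ... | ds , len′ , h = no-roots n ds (suc b) (trans len′ (ℕ.suc-injective len)) (ℕ.<-trans (ℕ.n<1+n n) n<p) roots′
      where
      roots′ : ∀ i → i ℕ.≤ n → ev ds (+ (suc b ℕ.+ i)) ≋ + 0
      roots′ i i≤n = cancelˡ {+ suc i} (λ d → ℕ.<⇒≱ (ℕ.≤-<-trans (s≤s i≤n) n<p) (ℕ.∣⇒≤ (∣⇒∣ᵤ d))) (begin
        + suc i * ev ds (+ (suc b ℕ.+ i))  ≡⟨ ℤ.+-identityˡ _ ⟨
        + 0 + + suc i * ev ds (+ (suc b ℕ.+ i))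
          ≈⟨ ≋-+ (subst (λ t → ev (c ∷ cs) (+ t) ≋ + 0) (ℕ.+-identityʳ b) (roots 0 z≤n)) ≋-refl ⟨
        ev (c ∷ cs) (+ b) + + suc i * ev ds (+ (suc b ℕ.+ i))
          ≡⟨ cong (λ t → ev (c ∷ cs) (+ b) + t * ev ds (+ (suc b ℕ.+ i))) shift ⟨
        ev (c ∷ cs) (+ b) + (+ (suc b ℕ.+ i) - + b) * ev ds (+ (suc b ℕ.+ i))  ≡⟨ h (+ (suc b ℕ.+ i)) ⟨
        ev (c ∷ cs) (+ (suc b ℕ.+ i))  ≡⟨ cong (λ t → ev (c ∷ cs) (+ t)) (ℕ.+-suc b i) ⟨
        ev (c ∷ cs) (+ (b ℕ.+ suc i))  ≈⟨ roots (suc i) (s≤s i≤n) ⟩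
        + 0  ≡⟨ ℤ.*-zeroʳ (+ suc i) ⟨
        + suc i * + 0  ∎)
        where
        shift : + (suc b ℕ.+ i) - + b ≡ + suc i
        shift = trans (cong (λ t → + t - + b) (sym (ℕ.+-suc b i)))
          (trans (cong (_- + b) (ℤ.pos-+ b (suc i)))
            (solve 2 (λ x y → x :+ y :- x := y) refl (+ b) (+ suc i)))

    ev-power : ∀ n x → ev (replicate n (+ 0)) x ≡ x ^ᶻ n
    ev-power zero    x = refl
    ev-power (suc n) x = trans (ℤ.+-identityˡ _) (cong (x *_) (ev-power n x))

  -- Otherwise Xⁿ⁺¹ - 1, of degree n + 1, would vanish at the n + 2 integers 1, ..., n + 2.
  nonresidue : ∀ {n} → suc (suc n) ℕ.< p → ∃ λ a → ¬ (+ p ∣ a) × ¬ (a ^ᶻ suc n ≋ + 1)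
  nonresidue {n} n<p with ℕ.anyUpTo? (λ i → ¬? ((+ suc i) ^ᶻ suc n ≋? + 1)) (suc (suc n))
    where open import Relation.Nullary using (¬?)
  ... | yes (i , i<n , h) = + suc i , (λ d → ℕ.<⇒≱ (ℕ.≤-<-trans i<n n<p) (ℕ.∣⇒≤ (∣⇒∣ᵤ d))) , h
  ... | no none = ⊥-elim (no-roots (suc n) (- + 1 ∷ replicate n (+ 0)) 1
      (cong suc (List.length-replicate n)) (ℕ.<-trans (ℕ.n<1+n _) n<p) roots)
    where
    roots : ∀ i → i ℕ.≤ suc n → - + 1 + + suc i * ev (replicate n (+ 0)) (+ suc i) ≋ + 0
    roots i i≤ with (+ suc i) ^ᶻ suc n ≋? + 1
    ... | yes h = ≋-+ {x = - + 1} ≋-refl (≋-trans (≈⇒≋ (cong (+ suc i *_) (ev-power n (+ suc i)))) h)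
    ... | no ¬h = ⊥-elim (none (i , s≤s i≤ , ¬h))

  module _ where
    open 𝔼/ (+ p) using () renaming (_≋_ to _≋ᴱ_; ≋-+ to ≋ᴱ-+; ≋-*ʳ to ≋ᴱ-*ʳ; by to byᴱ; ≈⇒≋ to ≡⇒≋ᴱ; ≋-setoid to ≋ᴱ-setoid)

    -- The freshman's dream splits a + b ω, and Fermat fixes a and b; only ω^p remains, so the
    -- residue of p modulo 3 decides between the identity and conjugation.
    frobenius : ∀ x → x ^ᴱ p ≋ᴱ ι (re x) ⊕ ι (im x) ⊗ ωᴱ ^ᴱ p
    frobenius x@(⟨ a , b ⟩) = 𝔼/.≋-trans (+ p)
      (𝔼/.≋-trans (+ p) (≡⇒≋ᴱ (cong (_^ᴱ p) split))
        (byᴱ (proj₁ F) (trans (proj₂ F) (cong (ι a ^ᴱ p ⊕ (ι b ⊗ ωᴱ) ^ᴱ p ⊕_) (·ᴱ≡⊗ p _)))))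
      (≋ᴱ-+ (fermat-ι a)
        (𝔼/.≋-trans (+ p) (≡⇒≋ᴱ (^ᴱ-distrib (ι b) ωᴱ p)) (≋ᴱ-*ʳ (ωᴱ ^ᴱ p) (fermat-ι b))))
      where
      F = Frobenius.freshman 𝔼-ring.commutativeSemiring pr (ι a) (ι b ⊗ ωᴱ)
      split : ⟨ a , b ⟩ ≡ ι a ⊕ ι b ⊗ ωᴱ
      split = cong₂ ⟨_,_⟩
        (solve 2 (λ a b → a := :re (:ι a :⊕ :ι b :⊗ (# 0 , # 1))) refl a b)
        (solve 2 (λ a b → b := :im (:ι a :⊕ :ι b :⊗ (# 0 , # 1))) refl a b)
      fermat-ι : ∀ c → ι c ^ᴱ p ≋ᴱ ι c
      fermat-ι c = 𝔼/.≋-trans (+ p) (≡⇒≋ᴱ (sym (ι-^ c p))) (ι-≋ (fermat c))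

    frobenius₁ : ∀ {k} → p ≡ suc (3 ℕ.* k) → ∀ x → x ^ᴱ p ≋ᴱ x
    frobenius₁ {k} p≡ x@(⟨ _ , _ ⟩) = 𝔼/.≋-trans (+ p) (frobenius x) (≡⇒≋ᴱ (trans
      (cong (λ t → ι (re x) ⊕ ι (im x) ⊗ t)
        (trans (cong (ωᴱ ^ᴱ_) p≡) (cong (ωᴱ ⊗_) (ω^3k k))))
      (cong₂ ⟨_,_⟩
        (solve 2 (λ a b → :re (:ι a :⊕ :ι b :⊗ (# 0 , # 1)) := a) refl (re x) (im x))
        (solve 2 (λ a b → :im (:ι a :⊕ :ι b :⊗ (# 0 , # 1)) := b) refl (re x) (im x)))))

    frobenius₂ : ∀ {k} → suc p ≡ 3 ℕ.* k → ∀ x → x ^ᴱ p ≋ᴱ conj x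
    frobenius₂ {k} 1+p≡ x@(⟨ _ , _ ⟩) = 𝔼/.≋-trans (+ p) (frobenius x) (≡⇒≋ᴱ (trans
      (cong (λ t → ι (re x) ⊕ ι (im x) ⊗ t) ω^p)
      (cong₂ ⟨_,_⟩
        (solve 2 (λ a b → :re (:ι a :⊕ :ι b :⊗ (con -[1+ 0 ] , con -[1+ 0 ])) := a :- b) refl (re x) (im x))
        (solve 2 (λ a b → :im (:ι a :⊕ :ι b :⊗ (con -[1+ 0 ] , con -[1+ 0 ])) := :- b) refl (re x) (im x)))))
      where
      ω² = ⟨ - + 1 , - + 1 ⟩
      ω^p : ωᴱ ^ᴱ p ≡ ω²
      ω^p = trans (sym (⊗-identityˡ _)) (trans (⊗-assoc ω² ωᴱ (ωᴱ ^ᴱ p))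
        (trans (cong (ω² ⊗_) (trans (cong (ωᴱ ^ᴱ_) 1+p≡) (ω^3k k))) refl))

-- The group ring of ℤ/q over ℤ[ω]

sum-single : ∀ {n} (f : Fin n → 𝔼) i → (∀ j → j ≢ i → f j ≡ 0ᴱ) → sum f ≡ f i
sum-single {suc n} f Fin.zero h = trans
  (cong (f Fin.zero ⊕_) (trans (sum-cong-≗ (λ j → h (Fin.suc j) (λ ()))) (sum-replicate-zero n)))
  (⊕-identityʳ _)
sum-single {suc n} f (Fin.suc i) h = trans
  (cong₂ _⊕_ (h Fin.zero (λ ())) (sum-single (f ∘ Fin.suc) i (λ j j≢i → h (Fin.suc j) (j≢i ∘ Fin.suc-injective))))
  (⊕-identityˡ _)

module Residues (q : ℕ) {{q≢0 : ℕ.NonZero q}} where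
  open ℤ/ (+ q)

  red : ℤ → Fin q
  red a = fromℕ< (n%ℕd<d a q)

  red-≋ : ∀ a → + toℕ (red a) ≋ a
  red-≋ a = ≋-sym (by (a /ℕ q) (trans (a≡a%ℕn+[a/ℕn]*n a q)
    (cong₂ _+_ (cong +_ (sym (Fin.toℕ-fromℕ< (n%ℕd<d a q)))) (ℤ.*-comm (a /ℕ q) (+ q)))))

  private
    small-≋′ : ∀ {r s} → r ℕ.≤ s → s ℕ.< q → + s ≋ + r → r ≡ s
    small-≋′ {r} {s} r≤s s<q h with s ℕ.∸ r in eq
    ... | zero  = ℕ.≤-antisym r≤s (ℕ.m∸n≡0⇒m≤n eq)
    ... | suc d = ⊥-elim (ℕ.<⇒≱ (ℕ.≤-<-trans (subst (ℕ._≤ s) eq (ℕ.m∸n≤m s r)) s<q)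
            (ℕ.∣⇒≤ (∣⇒∣ᵤ (subst (+ q ∣_) (trans (ℤ.m-n≡m⊖n s r) (trans (ℤ.⊖-≥ r≤s) (cong +_ eq))) (≋⇒∣ h)))))

  small-≋ : ∀ {r s} → r ℕ.< q → s ℕ.< q → + r ≋ + s → r ≡ s
  small-≋ {r} {s} r<q s<q h with ℕ.≤-total r s
  ... | inj₁ r≤s = small-≋′ r≤s s<q (≋-sym h)
  ... | inj₂ s≤r = sym (small-≋′ s≤r r<q h)

  toℕ-≋ : ∀ {i j : Fin q} → + toℕ i ≋ + toℕ j → i ≡ j
  toℕ-≋ {i} {j} h = Fin.toℕ-injective (small-≋ (Fin.toℕ<n i) (Fin.toℕ<n j) h)

  -- Functions on ℤ/q are periodic functions on ℤ: arguments such as s - t are computed in ℤ, and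
  -- representatives enter only through the range of `Σq`.
  Periodic : (ℤ → 𝔼) → Set
  Periodic f = ∀ {a b} → a ≋ b → f a ≡ f b

  Σq : (ℤ → 𝔼) → 𝔼
  Σq f = sum {q} (λ i → f (+ toℕ i))

  Σq-cong : ∀ {f g} → (∀ a → f a ≡ g a) → Σq f ≡ Σq g
  Σq-cong {f} {g} h = sum-cong-≗ {q} {λ i → f (+ toℕ i)} {λ i → g (+ toℕ i)} (λ i → h (+ toℕ i))

  Σq-comm : ∀ (f : ℤ → ℤ → 𝔼) → Σq (λ a → Σq (f a)) ≡ Σq (λ b → Σq (λ a → f a b))
  Σq-comm f = ∑-comm {q} {q} (λ i j → f (+ toℕ i) (+ toℕ j))

  Σq-*ˡ : ∀ x f → x ⊗ Σq f ≡ Σq (λ a → x ⊗ f a)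
  Σq-*ˡ x f = *-distribˡ-sum {q} x (λ i → f (+ toℕ i))

  Σq-*ʳ : ∀ x f → Σq f ⊗ x ≡ Σq (λ a → f a ⊗ x)
  Σq-*ʳ x f = *-distribʳ-sum {q} x (λ i → f (+ toℕ i))

  reindex : ∀ {f} → Periodic f → (φ ψ : ℤ → ℤ) → (∀ {a b} → a ≋ b → φ a ≋ φ b) → (∀ {a b} → a ≋ b → ψ a ≋ ψ b) →
            (∀ a → φ (ψ a) ≋ a) → (∀ a → ψ (φ a) ≋ a) → Σq f ≡ Σq (f ∘ φ)
  reindex {f} per φ ψ φ-cong ψ-cong φψ ψφ = trans
    (sum-permute (λ i → f (+ toℕ i)) (permutation to from to∘from from∘to))
    (sum-cong-≗ {q} {λ i → f (+ toℕ (to i))} {λ i → f (φ (+ toℕ i))} (λ i → per (red-≋ (φ (+ toℕ i)))))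
    where
    to from : Fin q → Fin q
    to i = red (φ (+ toℕ i))
    from i = red (ψ (+ toℕ i))
    to∘from : ∀ i → to (from i) ≡ i
    to∘from i = toℕ-≋ (≋-trans (red-≋ _) (≋-trans (φ-cong (red-≋ _)) (φψ _)))
    from∘to : ∀ i → from (to i) ≡ i
    from∘to i = toℕ-≋ (≋-trans (red-≋ _) (≋-trans (ψ-cong (red-≋ _)) (ψφ _)))

  reflect : ∀ {f} → Periodic f → ∀ s → Σq f ≡ Σq (λ t → f (s - t))
  reflect per s = reindex per (λ t → s - t) (λ t → s - t) c c inv inv
    where
    c : ∀ {a b} → a ≋ b → s - a ≋ s - b
    c h = ≋-+ {x = s} ≋-refl (≋-neg h)
    inv : ∀ a → s - (s - a) ≋ a
    inv a = ≈⇒≋ (solve 2 (λ s a → s :- (s :- a) := a) refl s a)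

  shift : ∀ {f} → Periodic f → ∀ r → Σq f ≡ Σq (λ t → f (t + r))
  shift per r = reindex per (_+ r) (_- r) (λ h → ≋-+ h ≋-refl) (λ h → ≋-+ h ≋-refl)
    (λ a → ≈⇒≋ (solve 2 (λ r a → a :- r :+ r := a) refl r a))
    (λ a → ≈⇒≋ (solve 2 (λ r a → a :+ r :- r := a) refl r a))

  abstract
    δ : ℤ → ℤ → 𝔼
    δ a t with _≋?_ {+ q} t a
    ... | yes _ = 1ᴱ
    ... | no  _ = 0ᴱ

    δ-≋ : ∀ {a t} → t ≋ a → δ a t ≡ 1ᴱ
    δ-≋ {a} {t} h with _≋?_ {+ q} t a
    ... | yes _ = refl
    ... | no ¬h = ⊥-elim (¬h h)

    δ-≇ : ∀ {a t} → ¬ (t ≋ a) → δ a t ≡ 0ᴱ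
    δ-≇ {a} {t} ¬h with _≋?_ {+ q} t a
    ... | yes h = ⊥-elim (¬h h)
    ... | no _  = refl

  δ-iff : ∀ a t b s → (t ≋ a → s ≋ b) → (s ≋ b → t ≋ a) → δ a t ≡ δ b s
  δ-iff a t b s f g with _≋?_ {+ q} s b
  ... | yes h = trans (δ-≋ (g h)) (sym (δ-≋ h))
  ... | no ¬h = trans (δ-≇ (¬h ∘ f)) (sym (δ-≇ ¬h))

  Σq-δ : ∀ {f} → Periodic f → ∀ a → Σq (λ t → δ a t ⊗ f t) ≡ f a
  Σq-δ {f} per a = trans
    (sum-single (λ i → δ a (+ toℕ i) ⊗ f (+ toℕ i)) (red a) (λ j j≢ → trans
      (cong (_⊗ f (+ toℕ j)) (δ-≇ (λ h → j≢ (toℕ-≋ (≋-trans h (≋-sym (red-≋ a)))))))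
      (⊗-zeroˡ _)))
    (trans (cong (_⊗ f (+ toℕ (red a))) (δ-≋ (red-≋ a))) (trans (⊗-identityˡ _) (per (red-≋ a))))

  record 𝔼[ℤ/q] : Set where
    constructor _,ᵖ_
    field
      at       : ℤ → 𝔼
      periodic : Periodic at
  open 𝔼[ℤ/q] public

  infixl 7 _⋆_
  _⋆_ _⊞_ : 𝔼[ℤ/q] → 𝔼[ℤ/q] → 𝔼[ℤ/q]
  f ⋆ g = (λ s → Σq (λ t → at f t ⊗ at g (s - t))) ,ᵖ
          (λ h → Σq-cong (λ t → cong (at f t ⊗_) (periodic g (≋-+ h (≋-refl { - t})))))
  f ⊞ g = (λ s → at f s ⊕ at g s) ,ᵖ (λ h → cong₂ _⊕_ (periodic f h) (periodic g h))

  mono : 𝔼 → ℤ → 𝔼[ℤ/q]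
  mono c a = (λ s → c ⊗ δ a s) ,ᵖ (λ h → cong (c ⊗_) (δ-iff a _ a _ (≋-trans (≋-sym h)) (≋-trans h)))

  infix 4 _≐_
  _≐_ : 𝔼[ℤ/q] → 𝔼[ℤ/q] → Set
  f ≐ g = ∀ s → at f s ≡ at g s

  ⋆-comm : ∀ f g → f ⋆ g ≐ g ⋆ f
  ⋆-comm f g s = trans
    (reflect (λ h → cong₂ _⊗_ (periodic f h) (periodic g (≋-+ (≋-refl {s}) (≋-neg h)))) s)
    (Σq-cong (λ t → trans
      (cong (at f (s - t) ⊗_) (cong (at g) (solve 2 (λ s a → s :- (s :- a) := a) refl s t)))
      (⊗-comm (at f (s - t)) (at g t))))

  ⋆-assoc : ∀ f g h → (f ⋆ g) ⋆ h ≐ f ⋆ (g ⋆ h)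
  ⋆-assoc f g h s = begin
    Σq (λ t → Σq (λ r → at f r ⊗ at g (t - r)) ⊗ at h (s - t))
      ≡⟨ Σq-cong (λ t → Σq-*ʳ (at h (s - t)) (λ r → at f r ⊗ at g (t - r))) ⟩
    Σq (λ t → Σq (λ r → at f r ⊗ at g (t - r) ⊗ at h (s - t)))
      ≡⟨ Σq-comm (λ t r → at f r ⊗ at g (t - r) ⊗ at h (s - t)) ⟩
    Σq (λ r → Σq (λ t → at f r ⊗ at g (t - r) ⊗ at h (s - t)))
      ≡⟨ Σq-cong inner ⟩
    Σq (λ r → at f r ⊗ Σq (λ t → at g t ⊗ at h ((s - r) - t)))  ∎
    where
    open ≡.≡-Reasoning
    inner : ∀ r → Σq (λ t → at f r ⊗ at g (t - r) ⊗ at h (s - t)) ≡ at f r ⊗ Σq (λ t → at g t ⊗ at h ((s - r) - t))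
    inner r = begin
      Σq (λ t → at f r ⊗ at g (t - r) ⊗ at h (s - t))
        ≡⟨ Σq-cong (λ t → ⊗-assoc (at f r) (at g (t - r)) (at h (s - t))) ⟩
      Σq (λ t → at f r ⊗ (at g (t - r) ⊗ at h (s - t)))
        ≡⟨ Σq-*ˡ (at f r) (λ t → at g (t - r) ⊗ at h (s - t)) ⟨
      at f r ⊗ Σq (λ t → at g (t - r) ⊗ at h (s - t))
        ≡⟨ cong (at f r ⊗_) (shift (λ e → cong₂ _⊗_ (periodic g (≋-+ e ≋-refl)) (periodic h (≋-+ (≋-refl {s}) (≋-neg e)))) r) ⟩
      at f r ⊗ Σq (λ t → at g (t + r - r) ⊗ at h (s - (t + r)))
        ≡⟨ cong (at f r ⊗_) (Σq-cong (λ t → cong₂ (λ a b → at g a ⊗ at h b)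
             (solve 2 (λ t r → t :+ r :- r := t) refl t r)
             (solve 3 (λ s t r → s :- (t :+ r) := s :- r :- t) refl s t r))) ⟩
      at f r ⊗ Σq (λ t → at g t ⊗ at h ((s - r) - t))  ∎

  Σq-mono : ∀ f c a s → at (mono c a ⋆ f) s ≡ c ⊗ at f (s - a)
  Σq-mono f c a s = trans
    (Σq-cong (λ t → ⊗-assoc c (δ a t) (at f (s - t))))
    (trans (sym (Σq-*ˡ c (λ t → δ a t ⊗ at f (s - t))))
      (cong (c ⊗_) (Σq-δ (λ h → periodic f (≋-+ (≋-refl {s}) (≋-neg h))) a)))

  ⋆-identityˡ : ∀ f → mono 1ᴱ (+ 0) ⋆ f ≐ f
  ⋆-identityˡ f s = trans (Σq-mono f 1ᴱ (+ 0) s) (trans (⊗-identityˡ _) (cong (at f) (ℤ.+-identityʳ s)))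

  mono-⋆ : ∀ c a d b → mono c a ⋆ mono d b ≐ mono (c ⊗ d) (a + b)
  mono-⋆ c a d b s = trans (Σq-mono (mono d b) c a s) (trans (sym (⊗-assoc c d _))
    (cong (c ⊗ d ⊗_) (δ-iff b (s - a) (a + b) s
      (λ h → ≋-trans (≈⇒≋ (solve 2 (λ s a → s := a :+ (s :- a)) refl s a)) (≋-+ (≋-refl {a}) h))
      (λ h → ≋-trans (≋-+ h (≋-refl { - a})) (≈⇒≋ (solve 2 (λ a b → a :+ b :- a := b) refl a b))))))

  𝔼[ℤ/q]-commutativeSemiring : CommutativeSemiring 0ℓ 0ℓ
  𝔼[ℤ/q]-commutativeSemiring = record
    { Carrier = 𝔼[ℤ/q] ; _≈_ = _≐_ ; _+_ = _⊞_ ; _*_ = _⋆_ ; 0# = (λ _ → 0ᴱ) ,ᵖ (λ _ → refl) ; 1# = mono 1ᴱ (+ 0)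
    ; isCommutativeSemiring = isCommutativeSemiringˡ (record
      { +-isCommutativeMonoid = record
        { isMonoid = record
          { isSemigroup = record
            { isMagma = record { isEquivalence = ≐-isEquivalence ; ∙-cong = λ h k s → cong₂ _⊕_ (h s) (k s) }
            ; assoc = λ f g h s → ⊕-assoc (at f s) (at g s) (at h s) }
          ; identity = (λ f s → ⊕-identityˡ (at f s)) , (λ f s → ⊕-identityʳ (at f s)) }
        ; comm = λ f g s → ⊕-comm (at f s) (at g s) }
      ; *-isCommutativeMonoid = record
        { isMonoid = record
          { isSemigroup = record
            { isMagma = record { isEquivalence = ≐-isEquivalence
              ; ∙-cong = λ h k s → Σq-cong (λ t → cong₂ _⊗_ (h t) (k (s - t))) }
            ; assoc = ⋆-assoc }
          ; identity = ⋆-identityˡ , λ f s → trans (⋆-comm f (mono 1ᴱ (+ 0)) s) (⋆-identityˡ f s) }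
        ; comm = ⋆-comm }
      ; distribʳ = λ f g h s → trans
          (Σq-cong (λ t → ⊗-distribʳ (at f (s - t)) (at g t) (at h t)))
          (∑-distrib-+ {q} (λ i → at g (+ toℕ i) ⊗ at f (s - + toℕ i)) (λ i → at h (+ toℕ i) ⊗ at f (s - + toℕ i)))
      ; zeroˡ = λ f s → trans (Σq-cong (λ t → ⊗-zeroˡ (at f (s - t)))) (sum-replicate-zero q)
      })
    }
    where
    open import Algebra.Structures.Biased using (isCommutativeSemiringˡ)
    open import Relation.Binary using (IsEquivalence)
    ≐-isEquivalence : IsEquivalence _≐_
    ≐-isEquivalence = record { refl = λ _ → refl ; sym = λ h s → sym (h s) ; trans = λ h k s → trans (h s) (k s) }

  open Exp 𝔼[ℤ/q]-commutativeSemiring public using () renaming (_^_ to _^⋆_)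

  private
    module G = CommutativeSemiring 𝔼[ℤ/q]-commutativeSemiring
    open Sum G.semiring using () renaming (sum to sumᴳ)
    open Mult G.semiring using () renaming (_×_ to _·ᴳ_)

    sumᴳ-at : ∀ {n} (F : Fin n → 𝔼[ℤ/q]) s → at (sumᴳ F) s ≡ sum (λ i → at (F i) s)
    sumᴳ-at {zero}  F s = refl
    sumᴳ-at {suc n} F s = cong (at (F Fin.zero) s ⊕_) (sumᴳ-at (F ∘ Fin.suc) s)

    ·ᴳ-at : ∀ n f s → at (n ·ᴳ f) s ≡ ι (+ n) ⊗ at f s
    ·ᴳ-at n f s = trans (go n) (·ᴱ≡⊗ n (at f s))
      where
      go : ∀ n → at (n ·ᴳ f) s ≡ n ·ᴱ at f s
      go zero    = refl
      go (suc n) = cong (at f s ⊕_) (go n)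

    mono-^ : ∀ c a n → mono c a ^⋆ n ≐ mono (c ^ᴱ n) (+ n * a)
    mono-^ c a zero    s = refl
    mono-^ c a (suc n) s = trans
      (Σq-cong (λ t → cong (at (mono c a) t ⊗_) (mono-^ c a n (s - t))))
      (trans (mono-⋆ c a (c ^ᴱ n) (+ n * a) s) (cong (λ b → at (mono (c ⊗ c ^ᴱ n) b) s) (sym (ℤ.suc-* (+ n) a))))

  -- Write f as a sum of monomials c [t]. Modulo ℓ, the ℓth power sends each to c^ℓ [ℓ t], and
  -- injectivity of multiplication by ℓ modulo q leaves only t ≡ a at the index ℓ a.
  ^⋆-frobenius : ∀ {ℓ} → Prime ℓ → (∀ {a b} → + ℓ * a ≋ + ℓ * b → a ≋ b) →
                 ∀ f a → at (f ^⋆ ℓ) (+ ℓ * a) ≋ at f a ^ᴱ ℓ [𝔼/ + ℓ ]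
  ^⋆-frobenius {ℓ} pr ℓ-inj f a = 𝔼/.by (at (proj₁ F) (+ ℓ * a)) (begin
    at (f ^⋆ ℓ) (+ ℓ * a)  ≡⟨ G-^-cong ℓ expand (+ ℓ * a) ⟩
    at (sumᴳ monos ^⋆ ℓ) (+ ℓ * a)  ≡⟨ proj₂ F (+ ℓ * a) ⟩
    at (sumᴳ (λ i → monos i ^⋆ ℓ)) (+ ℓ * a) ⊕ at (ℓ ·ᴳ proj₁ F) (+ ℓ * a)
      ≡⟨ cong₂ _⊕_ main (·ᴳ-at ℓ (proj₁ F) (+ ℓ * a)) ⟩
    at f a ^ᴱ ℓ ⊕ ι (+ ℓ) ⊗ at (proj₁ F) (+ ℓ * a) ∎)
    where
    open ≡.≡-Reasoning
    open Exp 𝔼[ℤ/q]-commutativeSemiring using () renaming (^-congˡ to G-^-cong)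
    monos : Fin q → 𝔼[ℤ/q]
    monos i = mono (at f (+ toℕ i)) (+ toℕ i)
    F = Frobenius.freshman-sum 𝔼[ℤ/q]-commutativeSemiring pr monos
    expand : f ≐ sumᴳ monos
    expand s = sym (trans (sumᴳ-at monos s) (trans
      (Σq-cong (λ t → trans (⊗-comm (at f t) (δ t s)) (cong (_⊗ at f t) (δ-iff t s s t ≋-sym ≋-sym))))
      (Σq-δ (periodic f) s)))
    main : at (sumᴳ (λ i → monos i ^⋆ ℓ)) (+ ℓ * a) ≡ at f a ^ᴱ ℓ
    main = begin
      at (sumᴳ (λ i → monos i ^⋆ ℓ)) (+ ℓ * a)
        ≡⟨ sumᴳ-at (λ i → monos i ^⋆ ℓ) (+ ℓ * a) ⟩
      Σq (λ t → at (mono (at f t) t ^⋆ ℓ) (+ ℓ * a))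
        ≡⟨ Σq-cong (λ t → mono-^ (at f t) t ℓ (+ ℓ * a)) ⟩
      Σq (λ t → at f t ^ᴱ ℓ ⊗ δ (+ ℓ * t) (+ ℓ * a))
        ≡⟨ Σq-cong (λ t → trans (⊗-comm (at f t ^ᴱ ℓ) _) (cong (_⊗ at f t ^ᴱ ℓ)
             (δ-iff (+ ℓ * t) (+ ℓ * a) a t (≋-sym ∘ ℓ-inj) (≋-*ˡ (+ ℓ) ∘ ≋-sym)))) ⟩
      Σq (λ t → δ a t ⊗ at f t ^ᴱ ℓ)
        ≡⟨ Σq-δ {f = λ t → at f t ^ᴱ ℓ} (λ h → cong (_^ᴱ ℓ) (periodic f h)) a ⟩
      at f a ^ᴱ ℓ ∎

-- Cubic characters and Gauss sums

-- The values of a cubic symbol form a finite type, so that identities between them are settled by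
-- cases and equality is decidable. `𝟘` is the value at non-units.
data Cubic : Set where
  𝟘 𝟙 𝕨 𝕨² : Cubic

⟦_⟧ : Cubic → 𝔼
⟦ 𝟘 ⟧ = 0ᴱ
⟦ 𝟙 ⟧ = 1ᴱ
⟦ 𝕨 ⟧ = ωᴱ
⟦ 𝕨² ⟧ = ⟨ -[1+ 0 ] , -[1+ 0 ] ⟩

infixl 7 _•_
_•_ : Cubic → Cubic → Cubic
𝟘 • _ = 𝟘
𝟙 • c = c
𝕨 • 𝟘 = 𝟘
𝕨 • 𝟙 = 𝕨
𝕨 • 𝕨 = 𝕨²
𝕨 • 𝕨² = 𝟙
𝕨² • 𝟘 = 𝟘
𝕨² • 𝟙 = 𝕨²
𝕨² • 𝕨 = 𝟙
𝕨² • 𝕨² = 𝕨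

⟦⟧-• : ∀ c d → ⟦ c • d ⟧ ≡ ⟦ c ⟧ ⊗ ⟦ d ⟧
⟦⟧-• 𝟘 d = sym (⊗-zeroˡ ⟦ d ⟧)
⟦⟧-• 𝟙 d = sym (⊗-identityˡ ⟦ d ⟧)
⟦⟧-• 𝕨 𝟘 = refl
⟦⟧-• 𝕨 𝟙 = refl
⟦⟧-• 𝕨 𝕨 = refl
⟦⟧-• 𝕨 𝕨² = refl
⟦⟧-• 𝕨² 𝟘 = refl
⟦⟧-• 𝕨² 𝟙 = refl
⟦⟧-• 𝕨² 𝕨 = refl
⟦⟧-• 𝕨² 𝕨² = refl

private
  read : 𝔼 → Cubic
  read ⟨ + 1 , _ ⟩         = 𝟙
  read ⟨ + 0 , + 1 ⟩       = 𝕨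
  read ⟨ -[1+ 0 ] , _ ⟩    = 𝕨²
  read ⟨ _ , _ ⟩           = 𝟘

  read-⟦⟧ : ∀ c → read ⟦ c ⟧ ≡ c
  read-⟦⟧ 𝟘 = refl
  read-⟦⟧ 𝟙 = refl
  read-⟦⟧ 𝕨 = refl
  read-⟦⟧ 𝕨² = refl

⟦⟧-injective : ∀ {c d} → ⟦ c ⟧ ≡ ⟦ d ⟧ → c ≡ d
⟦⟧-injective {c} {d} e = trans (sym (read-⟦⟧ c)) (trans (cong read e) (read-⟦⟧ d))

•-comm : ∀ c d → c • d ≡ d • c
•-comm c d = ⟦⟧-injective (trans (⟦⟧-• c d) (trans (⊗-comm ⟦ c ⟧ ⟦ d ⟧) (sym (⟦⟧-• d c))))

•-interchange : ∀ a b c d → (a • b) • (c • d) ≡ (a • c) • (b • d)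
•-interchange a b c d = ⟦⟧-injective (trans (expand a b c d)
  (trans (interchange ⟦ a ⟧ ⟦ b ⟧ ⟦ c ⟧ ⟦ d ⟧) (sym (expand a c b d))))
  where
  expand : ∀ a b c d → ⟦ (a • b) • (c • d) ⟧ ≡ (⟦ a ⟧ ⊗ ⟦ b ⟧) ⊗ (⟦ c ⟧ ⊗ ⟦ d ⟧)
  expand a b c d = trans (⟦⟧-• (a • b) (c • d)) (cong₂ _⊗_ (⟦⟧-• a b) (⟦⟧-• c d))

-- Every value satisfies c⁴ = c, so squaring again undoes the square.
•-square-injective : ∀ c d → c • c ≡ d • d → c ≡ d
•-square-injective c d e = trans (sym (fourth-power c)) (trans (cong₂ _•_ e e) (fourth-power d))
  where
  fourth-power : ∀ c → (c • c) • (c • c) ≡ c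
  fourth-power 𝟘 = refl
  fourth-power 𝟙 = refl
  fourth-power 𝕨 = refl
  fourth-power 𝕨² = refl

-- This makes reduction injective on symbol values: a prime identifying two different ones would
-- divide 1 or 3.
separated : ∀ c d → c ≡ d ⊎ norm (⟦ c ⟧ ⊕ ⊖ ⟦ d ⟧) ≡ + 1 ⊎ norm (⟦ c ⟧ ⊕ ⊖ ⟦ d ⟧) ≡ + 3
separated 𝟘 𝟘 = inj₁ refl
separated 𝟘 𝟙 = inj₂ (inj₁ refl)
separated 𝟘 𝕨 = inj₂ (inj₁ refl)
separated 𝟘 𝕨² = inj₂ (inj₁ refl)
separated 𝟙 𝟘 = inj₂ (inj₁ refl)
separated 𝟙 𝟙 = inj₁ refl
separated 𝟙 𝕨 = inj₂ (inj₂ refl)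
separated 𝟙 𝕨² = inj₂ (inj₂ refl)
separated 𝕨 𝟘 = inj₂ (inj₁ refl)
separated 𝕨 𝟙 = inj₂ (inj₂ refl)
separated 𝕨 𝕨 = inj₁ refl
separated 𝕨 𝕨² = inj₂ (inj₂ refl)
separated 𝕨² 𝟘 = inj₂ (inj₁ refl)
separated 𝕨² 𝟙 = inj₂ (inj₂ refl)
separated 𝕨² 𝕨 = inj₂ (inj₂ refl)
separated 𝕨² 𝕨² = inj₁ refl

⊗-zero-cancel : ∀ x z → norm x ≢ + 0 → x ⊗ z ≡ 0ᴱ → z ≡ 0ᴱ
⊗-zero-cancel x z@(⟨ c , d ⟩) N≢0 h = cong₂ ⟨_,_⟩ (zero-factor (cong re scaled)) (zero-factor (cong im scaled))
  where
  scaled : ⟨ norm x * c , norm x * d ⟩ ≡ 0ᴱ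
  scaled = begin
    ⟨ norm x * c , norm x * d ⟩  ≡⟨ ι-scale (norm x) c d ⟨
    ι (norm x) ⊗ z  ≡⟨ cong (_⊗ z) (⊗-conj x) ⟨
    x ⊗ conj x ⊗ z  ≡⟨ cong (_⊗ z) (⊗-comm x (conj x)) ⟩
    conj x ⊗ x ⊗ z  ≡⟨ ⊗-assoc (conj x) x z ⟩
    conj x ⊗ (x ⊗ z)  ≡⟨ cong (conj x ⊗_) h ⟩
    conj x ⊗ 0ᴱ  ≡⟨ ⊗-zeroʳ (conj x) ⟩
    0ᴱ  ∎
    where open ≡.≡-Reasoning
  zero-factor : ∀ {e} → norm x * e ≡ + 0 → e ≡ + 0
  zero-factor {e} h with ℤ.i*j≡0⇒i≡0∨j≡0 (norm x) h
  ... | inj₁ N≡0 = ⊥-elim (N≢0 N≡0)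
  ... | inj₂ e≡0 = e≡0

⊗-cancelˡ : ∀ x y z → norm x ≢ + 0 → x ⊗ y ≡ x ⊗ z → y ≡ z
⊗-cancelˡ x y z N≢0 h = trans (sym (⊕-identityʳ y)) (trans (cong (y ⊕_) (sym (⊕-inverseˡ z)))
  (trans (sym (⊕-assoc y (⊖ z) z)) (trans (cong (_⊕ z) y-z≡0) (⊕-identityˡ z))))
  where
  y-z≡0 : y ⊕ ⊖ z ≡ 0ᴱ
  y-z≡0 = ⊗-zero-cancel x (y ⊕ ⊖ z) N≢0 (trans (⊗-distribˡ x y (⊖ z))
    (trans (cong₂ _⊕_ h (sym (-‿distribʳ-* x z))) (⊕-inverseʳ (x ⊗ z))))

module CubicCharacter {q : ℕ} (pr : Prime q) {n : ℕ} (q≡ : q ≡ suc (3 ℕ.* n))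
  (w : ℤ) (w-root : w * w + w + + 1 ≋ + 0 [ℤ/ + q ]) where
  open ℤ/ (+ q)
  open ModPrime pr

  private
    instance
      q≢0 : ℕ.NonZero q
      q≢0 = prime⇒nonZero pr

    -- Modulo q this is the ring homomorphism ℤ[ω] → ℤ/q with ω ↦ `w`, that is, reduction modulo one
    -- of the two primes above q. The character is defined through it by Euler's criterion with
    -- exponent n = (q - 1)/3.
    H : 𝔼 → ℤ
    H ⟨ a , b ⟩ = a + b * w

    H-⊗ : ∀ x y → H (x ⊗ y) ≋ H x * H y
    H-⊗ ⟨ a , b ⟩ ⟨ c , d ⟩ = begin
      a * c - b * d + (a * d + b * c - b * d) * w
        ≡⟨ solve 5 (λ a b c d w → a :* c :- b :* d :+ (a :* d :+ b :* c :- b :* d) :* w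
             := (a :+ b :* w) :* (c :+ d :* w) :- b :* d :* (w :* w :+ w :+ # 1)) refl a b c d w ⟩
      (a + b * w) * (c + d * w) - b * d * (w * w + w + + 1)
        ≈⟨ ≋-+ (≋-refl {(a + b * w) * (c + d * w)}) (≋-neg (≋-*ˡ (b * d) w-root)) ⟩
      (a + b * w) * (c + d * w) - b * d * + 0
        ≡⟨ solve 2 (λ x y → x :- y :* # 0 := x) refl ((a + b * w) * (c + d * w)) (b * d) ⟩
      (a + b * w) * (c + d * w) ∎
      where open SetoidReasoning ≋-setoid

    H-diff : ∀ x y → H (x ⊕ ⊖ y) ≡ H x - H y
    H-diff ⟨ a , b ⟩ ⟨ c , d ⟩ = solve 5 (λ a b c d w → a :- c :+ (b :- d) :* w := a :+ b :* w :- (c :+ d :* w))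
        refl a b c d w

    H-norm : ∀ x → H x ≋ + 0 → + q ∣ norm x
    H-norm x h = ≋0⇒∣ (begin
      norm x  ≡⟨ ℤ.+-identityʳ (norm x) ⟨
      H (ι (norm x))  ≡⟨ cong H (⊗-conj x) ⟨
      H (x ⊗ conj x)  ≈⟨ H-⊗ x (conj x) ⟩
      H x * H (conj x)  ≈⟨ ≋-*ʳ (H (conj x)) h ⟩
      + 0 * H (conj x)  ≡⟨ ℤ.*-zeroˡ (H (conj x)) ⟩
      + 0  ∎)
      where open SetoidReasoning ≋-setoid

    n>0 : ∃ λ m → n ≡ suc m
    n>0 = go n q≡
      where
      go : ∀ n → q ≡ suc (3 ℕ.* n) → ∃ λ m → n ≡ suc m
      go zero e = ⊥-elim (p∤1 (subst (λ t → + t ∣ + 1) (sym e) ∣.∣-refl))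
      go (suc m) _ = m , refl

    q>3 : 3 ℕ.< q
    q>3 = subst (3 ℕ.<_) (sym q≡) (s≤s (subst (λ k → 3 ℕ.≤ 3 ℕ.* k) (sym (proj₂ n>0)) (ℕ.m≤m*n 3 (suc (proj₁ n>0)))))

    q∤3 : ¬ (+ q ∣ + 3)
    q∤3 d = ℕ.<⇒≱ q>3 (ℕ.∣⇒≤ (∣⇒∣ᵤ d))

    H-injective : ∀ {c d} → H ⟦ c ⟧ ≋ H ⟦ d ⟧ → c ≡ d
    H-injective {c} {d} h = [ (λ e → e) , ⊥-elim ∘ [ (λ e → p∤1 (subst (+ q ∣_) e q∣)) , (λ e → q∤3
        (subst (+ q ∣_) e q∣)) ]′ ]′ (separated c d)
      where
      x : 𝔼
      x = ⟦ c ⟧ ⊕ ⊖ ⟦ d ⟧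
      q∣ : + q ∣ norm x
      q∣ = H-norm x (≋-trans (≈⇒≋ (H-diff ⟦ c ⟧ ⟦ d ⟧)) (∣⇒≋0 (≋⇒∣ h)))

    cubic-root : ∀ t → ∃ λ c → H ⟦ c ⟧ ≋ t ^ᶻ n
    cubic-root t with + q ∣.∣? t
    ... | yes q∣t = 𝟘 , ≋-sym (subst (λ k → t ^ᶻ k ≋ + 0) (sym (proj₂ n>0))
            (≋-trans (≋-*ʳ (t ^ᶻ proj₁ n>0) (∣⇒≋0 q∣t)) (≈⇒≋ (ℤ.*-zeroˡ (t ^ᶻ proj₁ n>0)))))
    ... | no q∤t = roots
      where
      T = t ^ᶻ n
      T³≋1 : T * (T * (T * + 1)) ≋ + 1
      T³≋1 = ≋-trans (≈⇒≋ (trans (^ᶻ-* t n 3) (cong (t ^ᶻ_) (ℕ.*-comm n 3)))) (fermat′ q≡ q∤t)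
      -- X³ - 1 splits modulo q with roots 1, w and -1 - w, the images of `𝟙`, `𝕨` and `𝕨²`.
      q∣product : + q ∣ (T - + 1) * ((T - w) * (T - (-[1+ 0 ] + -[1+ 0 ] * w)))
      q∣product = ≋0⇒∣ (begin
        (T - + 1) * ((T - w) * (T - (-[1+ 0 ] + -[1+ 0 ] * w)))
          ≡⟨ solve 2 (λ T w → (T :- # 1) :* ((T :- w) :* (T :- (con -[1+ 0 ] :+ con -[1+ 0 ] :* w)))
               := T :* (T :* (T :* # 1)) :- # 1 :- (T :- # 1) :* (w :* w :+ w :+ # 1)) refl T w ⟩
        T * (T * (T * + 1)) - + 1 - (T - + 1) * (w * w + w + + 1)
          ≈⟨ ≋-+ (≋-+ T³≋1 (≋-refl { - + 1})) (≋-neg (≋-*ˡ (T - + 1) w-root)) ⟩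
        + 1 - + 1 - (T - + 1) * + 0
          ≡⟨ cong (λ z → + 0 - z) (ℤ.*-zeroʳ (T - + 1)) ⟩
        + 0 ∎)
        where open SetoidReasoning ≋-setoid
      roots : ∃ λ c → H ⟦ c ⟧ ≋ T
      roots = [ one , [ two , three ]′ ∘ euclidℤ pr (T - w) (T - (-[1+ 0 ] + -[1+ 0 ] * w)) ]′
                (euclidℤ pr (T - + 1) ((T - w) * (T - (-[1+ 0 ] + -[1+ 0 ] * w))) q∣product)
        where
        one : + q ∣ T - + 1 → ∃ λ c → H ⟦ c ⟧ ≋ T
        one d = 𝟙 , ≋-sym (≋-trans (∣⇒≋ d) (≈⇒≋ (sym (ℤ.+-identityʳ (+ 1)))))
        two : + q ∣ T - w → ∃ λ c → H ⟦ c ⟧ ≋ T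
        two d = 𝕨 , ≋-sym (≋-trans (∣⇒≋ d) (≈⇒≋ (solve 1 (λ w → w := # 0 :+ # 1 :* w) refl w)))
        three : + q ∣ T - (-[1+ 0 ] + -[1+ 0 ] * w) → ∃ λ c → H ⟦ c ⟧ ≋ T
        three d = 𝕨² , ≋-sym (∣⇒≋ d)

  abstract
    χ : ℤ → Cubic
    χ t = proj₁ (cubic-root t)

    χ-spec : ∀ t → H ⟦ χ t ⟧ ≋ t ^ᶻ n
    χ-spec t = proj₂ (cubic-root t)

  χ-periodic : ∀ {s t} → s ≋ t → χ s ≡ χ t
  χ-periodic {s} {t} h = H-injective (≋-trans (χ-spec s) (≋-trans (≋-^ n h) (≋-sym (χ-spec t))))

  χ-* : ∀ s t → χ (s * t) ≡ χ s • χ t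
  χ-* s t = H-injective (begin
    H ⟦ χ (s * t) ⟧  ≈⟨ χ-spec (s * t) ⟩
    (s * t) ^ᶻ n  ≡⟨ ^ᶻ-distrib s t n ⟩
    s ^ᶻ n * t ^ᶻ n  ≈⟨ ≋-* (χ-spec s) (χ-spec t) ⟨
    H ⟦ χ s ⟧ * H ⟦ χ t ⟧  ≈⟨ H-⊗ ⟦ χ s ⟧ ⟦ χ t ⟧ ⟨
    H (⟦ χ s ⟧ ⊗ ⟦ χ t ⟧)  ≡⟨ cong H (⟦⟧-• (χ s) (χ t)) ⟨
    H ⟦ χ s • χ t ⟧  ∎)
    where open SetoidReasoning ≋-setoid

  χ-1 : χ (+ 1) ≡ 𝟙
  χ-1 = H-injective (≋-trans (χ-spec (+ 1)) (≈⇒≋ (trans (1^ᶻ n) (sym (ℤ.+-identityʳ (+ 1))))))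

  χ-0 : ∀ {t} → + q ∣ t → χ t ≡ 𝟘
  χ-0 {t} q∣t = trans (χ-periodic (∣⇒≋0 q∣t)) (H-injective (≋-trans (χ-spec (+ 0))
    (subst (λ k → (+ 0) ^ᶻ k ≋ + 0) (sym (proj₂ n>0)) ≋-refl)))

  χ-unit : ∀ {t} → ¬ (+ q ∣ t) → χ t ≢ 𝟘
  χ-unit {t} q∤t χt≡0 = 𝟙≢𝟘 (trans (sym χ-1) (trans (χ-periodic (≋-sym (proj₂ t⁻¹)))
    (trans (χ-* (proj₁ t⁻¹) t) (trans (•-comm (χ (proj₁ t⁻¹)) (χ t)) (cong (_• χ (proj₁ t⁻¹)) χt≡0)))))
    where
    t⁻¹ = inverse q∤t
    𝟙≢𝟘 : 𝟙 ≢ 𝟘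
    𝟙≢𝟘 ()

  χ-neg1 : χ (- + 1) ≡ 𝟙
  χ-neg1 = square-one _ (trans (sym (χ-* (- + 1) (- + 1))) χ-1)
    where
    square-one : ∀ c → c • c ≡ 𝟙 → c ≡ 𝟙
    square-one 𝟙 _ = refl

  χ-neg : ∀ t → χ (- t) ≡ χ t
  χ-neg t = trans (cong χ (sym (ℤ.-1*i≡-i t))) (trans (χ-* (- + 1) t) (cong (_• χ t) χ-neg1))

  χ-nontrivial : ∃ λ a → ¬ (+ q ∣ a) × χ a ≢ 𝟙
  χ-nontrivial = a , proj₁ (proj₂ non) , λ χa≡1 → proj₂ (proj₂ non) (subst (λ k → a ^ᶻ k ≋ + 1) (proj₂ n>0)
    (≋-trans (≋-sym (χ-spec a)) (≈⇒≋ (trans (cong (H ∘ ⟦_⟧) χa≡1) (ℤ.+-identityʳ (+ 1))))))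
    where
    bound : suc (suc (proj₁ n>0)) ℕ.< q
    bound = subst (suc (suc (proj₁ n>0)) ℕ.<_) (sym (trans q≡ (cong (λ k → suc (3 ℕ.* k)) (proj₂ n>0))))
      (s≤s (s≤s (ℕ.≤-trans (ℕ.≤-reflexive (ℕ.+-comm 1 (proj₁ n>0)))
        (ℕ.+-monoʳ-≤ (proj₁ n>0) (s≤s z≤n)))))
    non = nonresidue {proj₁ n>0} bound
    a : ℤ
    a = proj₁ non

-- If g is the Gauss sum of a cubic character with Jacobi sum J, then g⁴ = θ J g.
θ : 𝔼 → 𝔼
θ x = x ⊗ (x ⊗ conj x)

conj-⟦⟧ : ∀ c → conj ⟦ c ⟧ ≡ ⟦ c • c ⟧
conj-⟦⟧ 𝟘 = refl
conj-⟦⟧ 𝟙 = refl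
conj-⟦⟧ 𝕨 = refl
conj-⟦⟧ 𝕨² = refl

⟦⟧-conj : ∀ {c} → c ≢ 𝟘 → ⟦ c ⟧ ⊗ conj ⟦ c ⟧ ≡ 1ᴱ
⟦⟧-conj {𝟘} c≢0 = ⊥-elim (c≢0 refl)
⟦⟧-conj {𝟙} _ = refl
⟦⟧-conj {𝕨} _ = refl
⟦⟧-conj {𝕨²} _ = refl

module GaussSum {q : ℕ} (pr : Prime q) {n : ℕ} (q≡ : q ≡ suc (3 ℕ.* n))
  (w : ℤ) (w-root : w * w + w + + 1 ≋ + 0 [ℤ/ + q ]) where
  open CubicCharacter pr {n} q≡ w w-root
  open ModPrime pr
  open ℤ/ (+ q)

  private
    instance
      q≢0 : ℕ.NonZero q
      q≢0 = prime⇒nonZero pr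
  open Residues q
  open ≡.≡-Reasoning

  private
    χᴱ χ̄ᴱ : ℤ → 𝔼
    χᴱ t = ⟦ χ t ⟧
    χ̄ᴱ t = conj ⟦ χ t ⟧

    χᴱ-* : ∀ s t → χᴱ (s * t) ≡ χᴱ s ⊗ χᴱ t
    χᴱ-* s t = trans (cong ⟦_⟧ (χ-* s t)) (⟦⟧-• (χ s) (χ t))

    χ̄ᴱ-* : ∀ s t → χ̄ᴱ (s * t) ≡ χ̄ᴱ s ⊗ χ̄ᴱ t
    χ̄ᴱ-* s t = trans (cong conj (χᴱ-* s t)) (conj-⊗ (χᴱ s) (χᴱ t))

    g ḡ : 𝔼[ℤ/q]
    g = χᴱ ,ᵖ (λ h → cong ⟦_⟧ (χ-periodic h))
    ḡ = χ̄ᴱ ,ᵖ (λ h → cong (conj ∘ ⟦_⟧) (χ-periodic h))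

    scale-index : ∀ {f} → Periodic f → ∀ {a} → ¬ (+ q ∣ a) → Σq f ≡ Σq (λ t → f (a * t))
    scale-index {f} per {a} q∤a with inverse q∤a
    ... | b , ba≋1 = reindex per (a *_) (b *_) (≋-*ˡ a) (≋-*ˡ b)
      (λ t → ≋-trans (≈⇒≋ (solve 3 (λ a b t → a :* (b :* t) := b :* a :* t) refl a b t))
               (≋-trans (≋-*ʳ t ba≋1) (≈⇒≋ (ℤ.*-identityˡ t))))
      (λ t → ≋-trans (≈⇒≋ (sym (ℤ.*-assoc b a t))) (≋-trans (≋-*ʳ t ba≋1) (≈⇒≋ (ℤ.*-identityˡ t))))

    conj-sum : ∀ {m} (f : Fin m → 𝔼) → conj (sum f) ≡ sum (conj ∘ f)
    conj-sum {zero}  f = refl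
    conj-sum {suc m} f = trans (conj-⊕ _ _) (cong (conj (f Fin.zero) ⊕_) (conj-sum (f ∘ Fin.suc)))

    Σχ≡0 : Σq χᴱ ≡ 0ᴱ
    Σχ≡0 with χ-nontrivial
    ... | a , q∤a , χa≢1 with separated (χ a) 𝟙
    ...   | inj₁ e = ⊥-elim (χa≢1 e)
    ...   | inj₂ N = ⊗-zero-cancel (χᴱ a ⊕ ⊖ 1ᴱ) (Σq χᴱ) (nonzero N) (begin
      (χᴱ a ⊕ ⊖ 1ᴱ) ⊗ Σq χᴱ  ≡⟨ ⊗-distribʳ (Σq χᴱ) (χᴱ a) (⊖ 1ᴱ) ⟩
      χᴱ a ⊗ Σq χᴱ ⊕ ⊖ 1ᴱ ⊗ Σq χᴱ
        ≡⟨ cong₂ _⊕_ invariance (trans (sym (-‿distribˡ-* 1ᴱ (Σq χᴱ))) (cong ⊖_ (⊗-identityˡ (Σq χᴱ)))) ⟩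
      Σq χᴱ ⊕ ⊖ Σq χᴱ  ≡⟨ ⊕-inverseʳ (Σq χᴱ) ⟩
      0ᴱ  ∎)
      where
      nonzero : ∀ {z} → z ≡ + 1 ⊎ z ≡ + 3 → z ≢ + 0
      nonzero (inj₁ refl) ()
      nonzero (inj₂ refl) ()
      invariance : χᴱ a ⊗ Σq χᴱ ≡ Σq χᴱ
      invariance = begin
        χᴱ a ⊗ Σq χᴱ  ≡⟨ Σq-*ˡ (χᴱ a) χᴱ ⟩
        Σq (λ t → χᴱ a ⊗ χᴱ t)  ≡⟨ Σq-cong (λ t → sym (χᴱ-* a t)) ⟩
        Σq (λ t → χᴱ (a * t))  ≡⟨ scale-index (periodic g) q∤a ⟨
        Σq χᴱ  ∎

    Σχ̄≡0 : Σq χ̄ᴱ ≡ 0ᴱ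
    Σχ̄≡0 = trans (sym (conj-sum {q} (λ i → χᴱ (+ toℕ i)))) (cong conj Σχ≡0)

  -- The Jacobi sum J(χ, χ), which is also the coefficient of g² at 1.
  J : 𝔼
  J = Σq (λ t → χᴱ t ⊗ χᴱ (+ 1 - t))

  private
    homogeneous : ∀ f h → (∀ a b → at f (a * b) ≡ at f a ⊗ at f b) → (∀ a b → at h (a * b) ≡ at h a ⊗ at h b) →
                  ∀ {s} → ¬ (+ q ∣ s) → at (f ⋆ h) s ≡ (at f s ⊗ at h s) ⊗ at (f ⋆ h) (+ 1)
    homogeneous f h f-* h-* {s} q∤s = begin
      Σq (λ t → at f t ⊗ at h (s - t))
        ≡⟨ scale-index (λ e → cong₂ _⊗_ (periodic f e) (periodic h (≋-+ (≋-refl {s}) (≋-neg e)))) q∤s ⟩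
      Σq (λ t → at f (s * t) ⊗ at h (s - s * t))
        ≡⟨ Σq-cong (λ t → cong₂ _⊗_ (f-* s t)
             (trans (cong (at h) (solve 2 (λ s t → s :- s :* t := s :* (# 1 :- t)) refl s t)) (h-* s (+ 1 - t)))) ⟩
      Σq (λ t → (at f s ⊗ at f t) ⊗ (at h s ⊗ at h (+ 1 - t)))
        ≡⟨ Σq-cong (λ t → interchange (at f s) (at f t) (at h s) (at h (+ 1 - t))) ⟩
      Σq (λ t → (at f s ⊗ at h s) ⊗ (at f t ⊗ at h (+ 1 - t)))
        ≡⟨ Σq-*ˡ (at f s ⊗ at h s) (λ t → at f t ⊗ at h (+ 1 - t)) ⟨
      (at f s ⊗ at h s) ⊗ Σq (λ t → at f t ⊗ at h (+ 1 - t)) ∎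

    χ²≡χ̄ : ∀ s → χᴱ s ⊗ χᴱ s ≡ χ̄ᴱ s
    χ²≡χ̄ s = trans (sym (⟦⟧-• (χ s) (χ s))) (sym (conj-⟦⟧ (χ s)))

    -- For s prime to q, the substitution t ↦ s t pulls out χ(s)² = χ̄(s). At s ≡ 0 both sides
    -- vanish, since χ(-t) = χ(t) turns the sum into Σ χ̄.
    g⋆g : ∀ s → at (g ⋆ g) s ≡ J ⊗ χ̄ᴱ s
    g⋆g s with + q ∣.∣? s
    ... | no q∤s = trans (homogeneous g g χᴱ-* χᴱ-* q∤s) (trans (cong (_⊗ J) (χ²≡χ̄ s)) (⊗-comm (χ̄ᴱ s) J))
    ... | yes q∣s = begin
      Σq (λ t → χᴱ t ⊗ χᴱ (s - t))  ≡⟨ Σq-cong (λ t → cong (χᴱ t ⊗_) (cong ⟦_⟧ (trans (χ-periodic (s-t t)) (χ-neg t)))) ⟩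
      Σq (λ t → χᴱ t ⊗ χᴱ t)  ≡⟨ Σq-cong χ²≡χ̄ ⟩
      Σq χ̄ᴱ  ≡⟨ Σχ̄≡0 ⟩
      0ᴱ  ≡⟨ ⊗-zeroʳ J ⟨
      J ⊗ conj ⟦ 𝟘 ⟧  ≡⟨ cong (λ c → J ⊗ conj ⟦ c ⟧) (χ-0 q∣s) ⟨
      J ⊗ χ̄ᴱ s  ∎
      where
      s-t : ∀ t → s - t ≋ - t
      s-t t = ≋-trans (≋-+ (∣⇒≋0 q∣s) (≋-refl { - t})) (≈⇒≋ (ℤ.+-identityˡ (- t)))

    ḡ⋆ḡ : ∀ s → at (ḡ ⋆ ḡ) s ≡ conj J ⊗ χᴱ s
    ḡ⋆ḡ s = begin
      Σq (λ t → χ̄ᴱ t ⊗ χ̄ᴱ (s - t))  ≡⟨ Σq-cong (λ t → sym (conj-⊗ (χᴱ t) (χᴱ (s - t)))) ⟩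
      Σq (λ t → conj (χᴱ t ⊗ χᴱ (s - t)))  ≡⟨ conj-sum {q} (λ i → χᴱ (+ toℕ i) ⊗ χᴱ (s - + toℕ i)) ⟨
      conj (at (g ⋆ g) s)  ≡⟨ cong conj (g⋆g s) ⟩
      conj (J ⊗ χ̄ᴱ s)  ≡⟨ conj-⊗ J (χ̄ᴱ s) ⟩
      conj J ⊗ conj (χ̄ᴱ s)  ≡⟨ cong (conj J ⊗_) (conj-conj (χᴱ s)) ⟩
      conj J ⊗ χᴱ s  ∎

    Σq-⊕ : ∀ f h → Σq (λ t → f t ⊕ h t) ≡ Σq f ⊕ Σq h
    Σq-⊕ f h = ∑-distrib-+ {q} (λ i → f (+ toℕ i)) (λ i → h (+ toℕ i))

    Σq-const : ∀ x → Σq (λ _ → x) ≡ ι (+ q) ⊗ x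
    Σq-const x = trans (go q) (·ᴱ≡⊗ q x)
      where
      go : ∀ m → sum {m} (λ _ → x) ≡ m ·ᴱ x
      go zero = refl
      go (suc m) = cong (x ⊕_) (go m)

    ĝ : ℤ → 𝔼
    ĝ = at (g ⋆ ḡ)

    ĝ-0 : ∀ {s} → + q ∣ s → ĝ s ≡ ι (+ q) ⊕ ⊖ 1ᴱ
    ĝ-0 {s} q∣s = begin
      Σq (λ t → χᴱ t ⊗ χ̄ᴱ (s - t))
        ≡⟨ Σq-cong (λ t → cong (λ c → χᴱ t ⊗ conj ⟦ c ⟧) (trans (χ-periodic (s-t t)) (χ-neg t))) ⟩
      Σq (λ t → χᴱ t ⊗ χ̄ᴱ t)
        ≡⟨ Σq-cong absolute ⟩
      Σq (λ t → 1ᴱ ⊕ δ (+ 0) t ⊗ ⊖ 1ᴱ)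
        ≡⟨ Σq-⊕ (λ _ → 1ᴱ) (λ t → δ (+ 0) t ⊗ ⊖ 1ᴱ) ⟩
      Σq (λ _ → 1ᴱ) ⊕ Σq (λ t → δ (+ 0) t ⊗ ⊖ 1ᴱ)
        ≡⟨ cong₂ _⊕_ (trans (Σq-const 1ᴱ) (⊗-identityʳ (ι (+ q)))) (Σq-δ {f = λ _ → ⊖ 1ᴱ} (λ _ → refl) (+ 0)) ⟩
      ι (+ q) ⊕ ⊖ 1ᴱ ∎
      where
      s-t : ∀ t → s - t ≋ - t
      s-t t = ≋-trans (≋-+ (∣⇒≋0 q∣s) (≋-refl { - t})) (≈⇒≋ (ℤ.+-identityˡ (- t)))
      absolute : ∀ t → χᴱ t ⊗ χ̄ᴱ t ≡ 1ᴱ ⊕ δ (+ 0) t ⊗ ⊖ 1ᴱ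
      absolute t with + q ∣.∣? t
      ... | yes q∣t = trans (cong (λ c → ⟦ c ⟧ ⊗ conj ⟦ c ⟧) (χ-0 q∣t))
                        (sym (cong (λ z → 1ᴱ ⊕ z ⊗ ⊖ 1ᴱ) (δ-≋ {+ 0} {t} (∣⇒≋0 q∣t))))
      ... | no q∤t = trans (⟦⟧-conj (χ-unit q∤t))
                       (sym (cong (λ z → 1ᴱ ⊕ z ⊗ ⊖ 1ᴱ) (δ-≇ {+ 0} {t} (q∤t ∘ ≋0⇒∣))))

    ĝ-unit : ∀ {s} → ¬ (+ q ∣ s) → ĝ s ≡ ĝ (+ 1)
    ĝ-unit {s} q∤s = trans (homogeneous g ḡ χᴱ-* χ̄ᴱ-* q∤s)
      (trans (cong (_⊗ ĝ (+ 1)) (⟦⟧-conj (χ-unit q∤s))) (⊗-identityˡ (ĝ (+ 1))))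

    Σĝ≡0 : Σq ĝ ≡ 0ᴱ
    Σĝ≡0 = begin
      Σq (λ s → Σq (λ t → χᴱ t ⊗ χ̄ᴱ (s - t)))  ≡⟨ Σq-comm (λ s t → χᴱ t ⊗ χ̄ᴱ (s - t)) ⟩
      Σq (λ t → Σq (λ s → χᴱ t ⊗ χ̄ᴱ (s - t)))  ≡⟨ Σq-cong (λ t → sym (Σq-*ˡ (χᴱ t) (λ s → χ̄ᴱ (s - t)))) ⟩
      Σq (λ t → χᴱ t ⊗ Σq (λ s → χ̄ᴱ (s - t)))
        ≡⟨ Σq-cong (λ t → cong (χᴱ t ⊗_) (trans (sym (shift (periodic ḡ) (- t))) Σχ̄≡0)) ⟩
      Σq (λ t → χᴱ t ⊗ 0ᴱ)  ≡⟨ Σq-cong (λ t → ⊗-zeroʳ (χᴱ t)) ⟩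
      Σq (λ t → 0ᴱ)  ≡⟨ sum-replicate-zero q ⟩
      0ᴱ  ∎

    -- The values of ĝ sum to zero, and all but one of them agree.
    ĝ-1 : ĝ (+ 1) ≡ ⊖ 1ᴱ
    ĝ-1 = ⊗-cancelˡ (ι (+ q) ⊕ ⊖ 1ᴱ) (ĝ (+ 1)) (⊖ 1ᴱ) N≢0
      (balance (ĝ (+ 1)) (begin
        ι (+ q) ⊗ ĝ (+ 1) ⊕ (ι (+ q) ⊕ ⊖ 1ᴱ ⊕ ⊖ ĝ (+ 1))
          ≡⟨ cong₂ _⊕_ (Σq-const (ĝ (+ 1))) (Σq-δ {f = λ _ → ι (+ q) ⊕ ⊖ 1ᴱ ⊕ ⊖ ĝ (+ 1)} (λ _ → refl) (+ 0)) ⟨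
        Σq (λ _ → ĝ (+ 1)) ⊕ Σq (λ s → δ (+ 0) s ⊗ (ι (+ q) ⊕ ⊖ 1ᴱ ⊕ ⊖ ĝ (+ 1)))
          ≡⟨ Σq-⊕ (λ _ → ĝ (+ 1)) (λ s → δ (+ 0) s ⊗ (ι (+ q) ⊕ ⊖ 1ᴱ ⊕ ⊖ ĝ (+ 1))) ⟨
        Σq (λ s → ĝ (+ 1) ⊕ δ (+ 0) s ⊗ (ι (+ q) ⊕ ⊖ 1ᴱ ⊕ ⊖ ĝ (+ 1)))
          ≡⟨ Σq-cong shape ⟨
        Σq ĝ
          ≡⟨ Σĝ≡0 ⟩
        0ᴱ ∎))
      where
      shape : ∀ s → ĝ s ≡ ĝ (+ 1) ⊕ δ (+ 0) s ⊗ (ι (+ q) ⊕ ⊖ 1ᴱ ⊕ ⊖ ĝ (+ 1))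
      shape s with + q ∣.∣? s
      ... | yes q∣s = trans (ĝ-0 q∣s) (trans (lemma (ι (+ q) ⊕ ⊖ 1ᴱ) (ĝ (+ 1)))
                        (sym (cong (λ z → ĝ (+ 1) ⊕ z ⊗ (ι (+ q) ⊕ ⊖ 1ᴱ ⊕ ⊖ ĝ (+ 1))) (δ-≋ {+ 0} {s} (∣⇒≋0 q∣s)))))
        where
        lemma : ∀ x y → x ≡ y ⊕ 1ᴱ ⊗ (x ⊕ ⊖ y)
        lemma x y = sym (trans (cong (y ⊕_) (trans (⊗-identityˡ (x ⊕ ⊖ y)) (⊕-comm x (⊖ y))))
          (trans (sym (⊕-assoc y (⊖ y) x)) (trans (cong (_⊕ x) (⊕-inverseʳ y)) (⊕-identityˡ x))))
      ... | no q∤s = trans (ĝ-unit q∤s) (sym (trans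
              (cong (λ z → ĝ (+ 1) ⊕ z ⊗ (ι (+ q) ⊕ ⊖ 1ᴱ ⊕ ⊖ ĝ (+ 1))) (δ-≇ {+ 0} {s} (q∤s ∘ ≋0⇒∣)))
              (trans (cong (ĝ (+ 1) ⊕_) (⊗-zeroˡ _)) (⊕-identityʳ (ĝ (+ 1))))))
      balance : ∀ K → ι (+ q) ⊗ K ⊕ (ι (+ q) ⊕ ⊖ 1ᴱ ⊕ ⊖ K) ≡ 0ᴱ → (ι (+ q) ⊕ ⊖ 1ᴱ) ⊗ K ≡ (ι (+ q) ⊕ ⊖ 1ᴱ) ⊗ ⊖ 1ᴱ
      balance ⟨ c , d ⟩ h = trans (cong₂ ⟨_,_⟩
          (solve 3 (λ q c d → :re ((q :- # 1 , # 0) :⊗ (c , d)) :=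
              :re ((:ι q :⊗ (c , d)) :⊕ ((q :- # 1 , # 0) :⊕ (:- c , :- d)) :⊕ (# 1 :- q , # 0))) refl (+ q) c d)
          (solve 3 (λ q c d → :im ((q :- # 1 , # 0) :⊗ (c , d)) :=
              :im ((:ι q :⊗ (c , d)) :⊕ ((q :- # 1 , # 0) :⊕ (:- c , :- d)) :⊕ (# 1 :- q , # 0))) refl (+ q) c d))
        (trans (cong (_⊕ ⟨ + 1 - + q , + 0 ⟩) h) (cong₂ ⟨_,_⟩
          (solve 1 (λ q → # 0 :+ (# 1 :- q) := :re ((q :- # 1 , # 0) :⊗ (con -[1+ 0 ] , # 0))) refl (+ q))
          (solve 1 (λ q → # 0 := :im ((q :- # 1 , # 0) :⊗ (con -[1+ 0 ] , # 0))) refl (+ q))))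
      N≢0 : norm (ι (+ q) ⊕ ⊖ 1ᴱ) ≢ + 0
      N≢0 e with ℤ.i*j≡0⇒i≡0∨j≡0 (+ q - + 1)
        (trans (solve 1 (λ q → (q :- # 1) :* (q :- # 1) := :norm (q :- # 1 , # 0)) refl (+ q)) e)
      ... | inj₁ z = p∤1 (subst (_∣ + 1) (sym (ℤ.i-j≡0⇒i≡j (+ q) (+ 1) z)) ∣.∣-refl)
      ... | inj₂ z = p∤1 (subst (_∣ + 1) (sym (ℤ.i-j≡0⇒i≡j (+ q) (+ 1) z)) ∣.∣-refl)

    infixr 7 _▪_
    _▪_ : 𝔼 → 𝔼[ℤ/q] → 𝔼[ℤ/q]
    c ▪ f = (λ s → c ⊗ at f s) ,ᵖ (λ h → cong (c ⊗_) (periodic f h))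

    ⋆-congˡ : ∀ f {h k} → h ≐ k → f ⋆ h ≐ f ⋆ k
    ⋆-congˡ f e s = Σq-cong (λ t → cong (at f t ⊗_) (e (s - t)))

    ⋆-congʳ : ∀ f {h k} → h ≐ k → h ⋆ f ≐ k ⋆ f
    ⋆-congʳ f e s = Σq-cong (λ t → cong (_⊗ at f (s - t)) (e t))

    ⋆-▪ : ∀ f c h → f ⋆ (c ▪ h) ≐ c ▪ (f ⋆ h)
    ⋆-▪ f c h s = trans (Σq-cong (λ t → x∙yz≈y∙xz (at f t) c (at h (s - t)))) (sym (Σq-*ˡ c (λ t → at f t ⊗ at h (s - t))))

    ▪-⋆ : ∀ f c h → (c ▪ f) ⋆ h ≐ c ▪ (f ⋆ h)
    ▪-⋆ f c h s = trans (Σq-cong (λ t → ⊗-assoc c (at f t) (at h (s - t)))) (sym (Σq-*ˡ c (λ t → at f t ⊗ at h (s - t))))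

    -- Bracketed as (g g) ḡ, the product is J ḡ² = J J̄ g, an exact identity in the group ring.
    g⋆g⋆ḡ : ∀ s → at (g ⋆ (g ⋆ ḡ)) s ≡ (J ⊗ conj J) ⊗ χᴱ s
    g⋆g⋆ḡ s = begin
      at (g ⋆ (g ⋆ ḡ)) s  ≡⟨ ⋆-assoc g g ḡ s ⟨
      at ((g ⋆ g) ⋆ ḡ) s  ≡⟨ ⋆-congʳ ḡ {g ⋆ g} {J ▪ ḡ} g⋆g s ⟩
      at ((J ▪ ḡ) ⋆ ḡ) s  ≡⟨ ▪-⋆ ḡ J ḡ s ⟩
      J ⊗ at (ḡ ⋆ ḡ) s  ≡⟨ cong (J ⊗_) (ḡ⋆ḡ s) ⟩
      J ⊗ (conj J ⊗ χᴱ s)  ≡⟨ ⊗-assoc J (conj J) (χᴱ s) ⟨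
      (J ⊗ conj J) ⊗ χᴱ s  ∎

    ĝ-shape : ∀ s → ĝ s ≡ δ (+ 0) s ⊗ ι (+ q) ⊕ ⊖ 1ᴱ
    ĝ-shape s with + q ∣.∣? s
    ... | yes q∣s = trans (ĝ-0 q∣s) (cong (_⊕ ⊖ 1ᴱ) (sym (trans
        (cong (_⊗ ι (+ q)) (δ-≋ {+ 0} {s} (∣⇒≋0 q∣s))) (⊗-identityˡ (ι (+ q))))))
    ... | no q∤s = trans (ĝ-unit q∤s) (trans ĝ-1 (trans (sym (⊕-identityˡ (⊖ 1ᴱ)))
                     (cong (_⊕ ⊖ 1ᴱ) (sym (trans (cong (_⊗ ι (+ q)) (δ-≇ {+ 0} {s} (q∤s ∘ ≋0⇒∣))) (⊗-zeroˡ (ι (+ q))))))))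

  -- The same triple product at 1, now bracketed as g (g ḡ). By `ĝ-shape`, g ḡ is q [0] minus the
  -- sum of all group elements, and that sum is killed by g because Σ χ = 0.
  J⊗conjJ : J ⊗ conj J ≡ ι (+ q)
  J⊗conjJ = begin
    J ⊗ conj J  ≡⟨ ⊗-identityʳ (J ⊗ conj J) ⟨
    J ⊗ conj J ⊗ 1ᴱ  ≡⟨ cong (λ c → J ⊗ conj J ⊗ ⟦ c ⟧) χ-1 ⟨
    J ⊗ conj J ⊗ χᴱ (+ 1)  ≡⟨ g⋆g⋆ḡ (+ 1) ⟨
    at (g ⋆ (g ⋆ ḡ)) (+ 1)  ≡⟨ Σq-cong expand ⟩
    Σq (λ t → δ (+ 1) t ⊗ (χᴱ t ⊗ ι (+ q)) ⊕ χᴱ t ⊗ ⊖ 1ᴱ)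
      ≡⟨ Σq-⊕ (λ t → δ (+ 1) t ⊗ (χᴱ t ⊗ ι (+ q))) (λ t → χᴱ t ⊗ ⊖ 1ᴱ) ⟩
    Σq (λ t → δ (+ 1) t ⊗ (χᴱ t ⊗ ι (+ q))) ⊕ Σq (λ t → χᴱ t ⊗ ⊖ 1ᴱ)
      ≡⟨ cong₂ _⊕_ (Σq-δ (λ h → cong (_⊗ ι (+ q)) (periodic g h)) (+ 1))
                   (trans (sym (Σq-*ʳ (⊖ 1ᴱ) χᴱ)) (trans (cong (_⊗ ⊖ 1ᴱ) Σχ≡0) (⊗-zeroˡ (⊖ 1ᴱ)))) ⟩
    χᴱ (+ 1) ⊗ ι (+ q) ⊕ 0ᴱ  ≡⟨ ⊕-identityʳ _ ⟩
    χᴱ (+ 1) ⊗ ι (+ q)  ≡⟨ cong (λ c → ⟦ c ⟧ ⊗ ι (+ q)) χ-1 ⟩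
    1ᴱ ⊗ ι (+ q)  ≡⟨ ⊗-identityˡ (ι (+ q)) ⟩
    ι (+ q)  ∎
    where
    expand : ∀ t → χᴱ t ⊗ ĝ (+ 1 - t) ≡ δ (+ 1) t ⊗ (χᴱ t ⊗ ι (+ q)) ⊕ χᴱ t ⊗ ⊖ 1ᴱ
    expand t = begin
      χᴱ t ⊗ ĝ (+ 1 - t)
        ≡⟨ cong (χᴱ t ⊗_) (ĝ-shape (+ 1 - t)) ⟩
      χᴱ t ⊗ (δ (+ 0) (+ 1 - t) ⊗ ι (+ q) ⊕ ⊖ 1ᴱ)
        ≡⟨ ⊗-distribˡ (χᴱ t) (δ (+ 0) (+ 1 - t) ⊗ ι (+ q)) (⊖ 1ᴱ) ⟩
      χᴱ t ⊗ (δ (+ 0) (+ 1 - t) ⊗ ι (+ q)) ⊕ χᴱ t ⊗ ⊖ 1ᴱ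
        ≡⟨ cong (_⊕ χᴱ t ⊗ ⊖ 1ᴱ) (x∙yz≈y∙xz (χᴱ t) (δ (+ 0) (+ 1 - t)) (ι (+ q))) ⟩
      δ (+ 0) (+ 1 - t) ⊗ (χᴱ t ⊗ ι (+ q)) ⊕ χᴱ t ⊗ ⊖ 1ᴱ
        ≡⟨ cong (λ z → z ⊗ (χᴱ t ⊗ ι (+ q)) ⊕ χᴱ t ⊗ ⊖ 1ᴱ) (δ-iff (+ 0) (+ 1 - t) (+ 1) t
             (λ h → ≋-sym (∣⇒≋ (≋0⇒∣ h))) (λ h → ∣⇒≋0 (≋⇒∣ (≋-sym h)))) ⟩
      δ (+ 1) t ⊗ (χᴱ t ⊗ ι (+ q)) ⊕ χᴱ t ⊗ ⊖ 1ᴱ ∎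

  norm-J : norm J ≡ + q
  norm-J = cong re (trans (sym (⊗-conj J)) J⊗conjJ)

  private
    g^1 : g ^⋆ 1 ≐ g
    g^1 s = trans (⋆-comm g (mono 1ᴱ (+ 0)) s) (⋆-identityˡ g s)

    g⁴ : ∀ c → g ⋆ (g ⋆ (g ⋆ (c ▪ g))) ≐ (θ J ⊗ c) ▪ g
    g⁴ c s = begin
      at (g ⋆ (g ⋆ (g ⋆ (c ▪ g)))) s
        ≡⟨ ⋆-congˡ g {g ⋆ (g ⋆ (c ▪ g))} {g ⋆ ((c ⊗ J) ▪ ḡ)} (⋆-congˡ g {g ⋆ (c ▪ g)} {(c ⊗ J) ▪ ḡ} step) s ⟩
      at (g ⋆ (g ⋆ ((c ⊗ J) ▪ ḡ))) s  ≡⟨ ⋆-congˡ g {g ⋆ ((c ⊗ J) ▪ ḡ)} {(c ⊗ J) ▪ (g ⋆ ḡ)} (⋆-▪ g (c ⊗ J) ḡ) s ⟩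
      at (g ⋆ ((c ⊗ J) ▪ (g ⋆ ḡ))) s  ≡⟨ ⋆-▪ g (c ⊗ J) (g ⋆ ḡ) s ⟩
      (c ⊗ J) ⊗ at (g ⋆ (g ⋆ ḡ)) s  ≡⟨ cong (c ⊗ J ⊗_) (g⋆g⋆ḡ s) ⟩
      (c ⊗ J) ⊗ ((J ⊗ conj J) ⊗ χᴱ s)  ≡⟨ ⊗-assoc (c ⊗ J) (J ⊗ conj J) (χᴱ s) ⟨
      (c ⊗ J) ⊗ (J ⊗ conj J) ⊗ χᴱ s  ≡⟨ cong (_⊗ χᴱ s) (trans (⊗-assoc c J (J ⊗ conj J)) (⊗-comm c (θ J))) ⟩
      (θ J ⊗ c) ⊗ χᴱ s  ∎
      where
      step : g ⋆ (c ▪ g) ≐ (c ⊗ J) ▪ ḡ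
      step s = trans (⋆-▪ g c g s) (trans (cong (c ⊗_) (g⋆g s)) (sym (⊗-assoc c J (χ̄ᴱ s))))

    g^1+3k : ∀ k → g ^⋆ suc (3 ℕ.* k) ≐ (θ J ^ᴱ k) ▪ g
    g^1+3k zero s = trans (g^1 s) (sym (⊗-identityˡ (χᴱ s)))
    g^1+3k (suc k) s = begin
      at (g ^⋆ suc (3 ℕ.* suc k)) s  ≡⟨ cong (λ m → at (g ^⋆ suc m) s) (ℕ.*-suc 3 k) ⟩
      at (g ⋆ (g ⋆ (g ⋆ (g ^⋆ suc (3 ℕ.* k))))) s
        ≡⟨ ⋆-congˡ g {g ⋆ (g ⋆ (g ^⋆ suc (3 ℕ.* k)))} {g ⋆ (g ⋆ ((θ J ^ᴱ k) ▪ g))}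
             (⋆-congˡ g {g ⋆ (g ^⋆ suc (3 ℕ.* k))} {g ⋆ ((θ J ^ᴱ k) ▪ g)}
               (⋆-congˡ g {g ^⋆ suc (3 ℕ.* k)} {(θ J ^ᴱ k) ▪ g} (g^1+3k k))) s ⟩
      at (g ⋆ (g ⋆ (g ⋆ ((θ J ^ᴱ k) ▪ g)))) s  ≡⟨ g⁴ (θ J ^ᴱ k) s ⟩
      θ J ^ᴱ suc k ⊗ χᴱ s  ∎

    g^2+3k : ∀ k → g ^⋆ suc (suc (3 ℕ.* k)) ≐ ((θ J ^ᴱ k) ⊗ J) ▪ ḡ
    g^2+3k k s = begin
      at (g ⋆ g ^⋆ suc (3 ℕ.* k)) s  ≡⟨ ⋆-congˡ g {g ^⋆ suc (3 ℕ.* k)} {(θ J ^ᴱ k) ▪ g} (g^1+3k k) s ⟩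
      at (g ⋆ ((θ J ^ᴱ k) ▪ g)) s  ≡⟨ ⋆-▪ g (θ J ^ᴱ k) g s ⟩
      θ J ^ᴱ k ⊗ at (g ⋆ g) s  ≡⟨ cong (θ J ^ᴱ k ⊗_) (g⋆g s) ⟩
      θ J ^ᴱ k ⊗ (J ⊗ χ̄ᴱ s)  ≡⟨ ⊗-assoc (θ J ^ᴱ k) J (χ̄ᴱ s) ⟨
      (θ J ^ᴱ k ⊗ J) ⊗ χ̄ᴱ s  ∎

    -- The Frobenius congruence at the index ℓ · 1, where the coefficient of g is χ(1) = 1.
    g^ℓ : ∀ {ℓ} → Prime ℓ → ¬ (+ q ∣ + ℓ) → at (g ^⋆ ℓ) (+ ℓ) ≋ 1ᴱ [𝔼/ + ℓ ]
    g^ℓ {ℓ} ℓ-prime q∤ℓ = 𝔼/.≋-trans (+ ℓ)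
      (𝔼/.≈⇒≋ (+ ℓ) (cong (at (g ^⋆ ℓ)) (sym (ℤ.*-identityʳ (+ ℓ)))))
      (𝔼/.≋-trans (+ ℓ) (^⋆-frobenius ℓ-prime (cancelˡ q∤ℓ) g (+ 1))
        (𝔼/.≈⇒≋ (+ ℓ) (trans (cong (λ c → ⟦ c ⟧ ^ᴱ ℓ) χ-1) (1^ᴱ ℓ))))

  reciprocity₁ : ∀ {ℓ k} → Prime ℓ → ¬ (+ q ∣ + ℓ) → ℓ ≡ suc (3 ℕ.* k) →
                 θ J ^ᴱ k ⊗ ⟦ χ (+ ℓ) ⟧ ≋ 1ᴱ [𝔼/ + ℓ ]
  reciprocity₁ {ℓ} {k} ℓ-prime q∤ℓ refl = 𝔼/.≋-trans (+ ℓ) (𝔼/.≈⇒≋ (+ ℓ) (sym (g^1+3k k (+ ℓ)))) (g^ℓ ℓ-prime q∤ℓ)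

  -- Here ℓ = 3(k - 1) + 2 and g^ℓ = (θ J)^(k-1) J ḡ. Multiplication by q = J J̄ completes the power
  -- of θ J to the kth, so that both laws have the same shape.
  reciprocity₂ : ∀ {ℓ k} → Prime ℓ → ¬ (+ q ∣ + ℓ) → suc ℓ ≡ 3 ℕ.* k →
                 θ J ^ᴱ k ⊗ conj ⟦ χ (+ ℓ) ⟧ ≋ ι (+ q) [𝔼/ + ℓ ]
  reciprocity₂ {ℓ} {zero}  ℓ-prime q∤ℓ ()
  reciprocity₂ {ℓ} {suc k} ℓ-prime q∤ℓ 1+ℓ≡ = 𝔼/.≋-trans (+ ℓ)
    (𝔼/.≈⇒≋ (+ ℓ) (begin
      (θ J ⊗ θ J ^ᴱ k) ⊗ χ̄ᴱ (+ ℓ)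
        ≡⟨ cong (_⊗ χ̄ᴱ (+ ℓ)) (trans (cong (_⊗ θ J ^ᴱ k) (⊗-comm J (J ⊗ conj J))) (⊗-assoc (J ⊗ conj J) J (θ J ^ᴱ k))) ⟩
      (J ⊗ conj J ⊗ (J ⊗ θ J ^ᴱ k)) ⊗ χ̄ᴱ (+ ℓ)
        ≡⟨ ⊗-assoc (J ⊗ conj J) (J ⊗ θ J ^ᴱ k) (χ̄ᴱ (+ ℓ)) ⟩
      J ⊗ conj J ⊗ ((J ⊗ θ J ^ᴱ k) ⊗ χ̄ᴱ (+ ℓ))
        ≡⟨ cong₂ (λ x y → x ⊗ (y ⊗ χ̄ᴱ (+ ℓ))) J⊗conjJ (⊗-comm J (θ J ^ᴱ k)) ⟩
      ι (+ q) ⊗ ((θ J ^ᴱ k ⊗ J) ⊗ χ̄ᴱ (+ ℓ))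
        ≡⟨ cong (ι (+ q) ⊗_) (g^2+3k k (+ ℓ)) ⟨
      ι (+ q) ⊗ at (g ^⋆ suc (suc (3 ℕ.* k))) (+ ℓ)
        ≡⟨ cong (λ m → ι (+ q) ⊗ at (g ^⋆ m) (+ ℓ)) (ℕ.suc-injective (trans 1+ℓ≡ (ℕ.*-suc 3 k))) ⟨
      ι (+ q) ⊗ at (g ^⋆ ℓ) (+ ℓ) ∎))
    (𝔼/.≋-trans (+ ℓ) (𝔼/.≋-*ˡ (+ ℓ) (ι (+ q)) (g^ℓ ℓ-prime q∤ℓ)) (𝔼/.≈⇒≋ (+ ℓ) (⊗-identityʳ (ι (+ q)))))

  -- The Frobenius congruence for ℓ = 3: g³ = J g ḡ has the coefficient -J at 3, as g ḡ is -1 away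
  -- from 0.
  J-primary : ¬ (+ q ∣ + 3) → ⊖ J ≋ 1ᴱ [𝔼/ + 3 ]
  J-primary q∤3 = 𝔼/.≋-trans (+ 3) (𝔼/.≈⇒≋ (+ 3) (sym (begin
    at (g ⋆ (g ^⋆ 2)) (+ 3)  ≡⟨ ⋆-congˡ g {g ^⋆ 2} {(1ᴱ ⊗ J) ▪ ḡ} (g^2+3k 0) (+ 3) ⟩
    at (g ⋆ ((1ᴱ ⊗ J) ▪ ḡ)) (+ 3)  ≡⟨ ⋆-▪ g (1ᴱ ⊗ J) ḡ (+ 3) ⟩
    1ᴱ ⊗ J ⊗ ĝ (+ 3)  ≡⟨ cong₂ _⊗_ (⊗-identityˡ J) (trans (ĝ-unit q∤3) ĝ-1) ⟩
    J ⊗ ⊖ 1ᴱ  ≡⟨ -‿distribʳ-* J 1ᴱ ⟨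
    ⊖ (J ⊗ 1ᴱ)  ≡⟨ cong ⊖_ (⊗-identityʳ J) ⟩
    ⊖ J  ∎))) (g^ℓ prime[3] q∤3)

-- Cubic reciprocity

conj-θ : ∀ x → conj (θ x) ≡ θ (conj x)
conj-θ x = trans (conj-⊗ x (x ⊗ conj x)) (cong (conj x ⊗_) (conj-⊗ x (conj x)))

θ-⊗ : ∀ x y → θ (x ⊗ y) ≡ θ x ⊗ θ y
θ-⊗ x y = begin
  (x ⊗ y) ⊗ ((x ⊗ y) ⊗ conj (x ⊗ y))  ≡⟨ cong (λ z → (x ⊗ y) ⊗ ((x ⊗ y) ⊗ z)) (conj-⊗ x y) ⟩
  (x ⊗ y) ⊗ ((x ⊗ y) ⊗ (conj x ⊗ conj y))  ≡⟨ cong ((x ⊗ y) ⊗_) (interchange x y (conj x) (conj y)) ⟩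
  (x ⊗ y) ⊗ ((x ⊗ conj x) ⊗ (y ⊗ conj y))  ≡⟨ interchange x y (x ⊗ conj x) (y ⊗ conj y) ⟩
  θ x ⊗ θ y  ∎
  where open ≡.≡-Reasoning

θ-⊖ : ∀ x → θ (⊖ x) ≡ ⊖ θ x
θ-⊖ ⟨ a , b ⟩ = cong₂ ⟨_,_⟩
  (solve 2 (λ a b → :re ((:- a , :- b) :⊗ ((:- a , :- b) :⊗ :conj (:- a , :- b)))
    := :- (:re ((a , b) :⊗ ((a , b) :⊗ :conj (a , b))))) refl a b)
  (solve 2 (λ a b → :im ((:- a , :- b) :⊗ ((:- a , :- b) :⊗ :conj (:- a , :- b)))
    := :- (:im ((a , b) :⊗ ((a , b) :⊗ :conj (a , b))))) refl a b)

norm-⊖ : ∀ x → norm (⊖ x) ≡ norm x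
norm-⊖ ⟨ a , b ⟩ = solve 2 (λ a b → :norm (:- a , :- b) := :norm (a , b)) refl a b

even∨odd : ∀ k → (∃ λ j → k ≡ 2 ℕ.* j) ⊎ (∃ λ j → k ≡ suc (2 ℕ.* j))
even∨odd zero = inj₁ (0 , refl)
even∨odd (suc k) with even∨odd k
... | inj₁ (j , e) = inj₂ (j , cong suc e)
... | inj₂ (j , e) = inj₁ (suc j , trans (cong suc e) (sym (ℕ.*-suc 2 j)))

prime-even : ∀ {ℓ} → Prime ℓ → 2 ℕ.∣ ℓ → ℓ ≡ 2
prime-even pr d with prime⇒irreducible pr d
... | inj₂ e = sym e

-- k is even unless ℓ = 2, and modulo 2 signs do not matter.
⊖1^k≋1 : ∀ {ℓ k} → Prime ℓ → ℓ ≡ suc (3 ℕ.* k) ⊎ suc ℓ ≡ 3 ℕ.* k → (⊖ 1ᴱ) ^ᴱ k ≋ 1ᴱ [𝔼/ + ℓ ]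
⊖1^k≋1 {ℓ} {k} pr h with even∨odd k
... | inj₁ (j , refl) = 𝔼/.≈⇒≋ (+ ℓ) (trans (sym (^ᴱ-* (⊖ 1ᴱ) 2 j)) (go j))
  where
  go : ∀ j → ((⊖ 1ᴱ) ^ᴱ 2) ^ᴱ j ≡ 1ᴱ
  go zero = refl
  go (suc j) = trans (⊗-identityˡ _) (go j)
... | inj₂ (j , refl) = odd h
  where
  3k+1 : ∀ j → suc (3 ℕ.* suc (2 ℕ.* j)) ≡ (2 ℕ.+ 3 ℕ.* j) ℕ.* 2
  3k+1 = solveℕ-∀
  3k : ∀ j → 3 ℕ.* suc (2 ℕ.* j) ≡ suc ((1 ℕ.+ 3 ℕ.* j) ℕ.* 2)
  3k = solveℕ-∀
  at-two : ∀ m → (⊖ 1ᴱ) ^ᴱ m ≋ 1ᴱ [𝔼/ + 2 ]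
  at-two zero = 𝔼/.≋-refl (+ 2)
  at-two (suc m) = 𝔼/.≋-trans (+ 2) (𝔼/.≋-* (+ 2) {⊖ 1ᴱ} {1ᴱ} (𝔼/.by ⟨ -[1+ 0 ] , + 0 ⟩ refl) (at-two m))
    (𝔼/.≈⇒≋ (+ 2) (⊗-identityˡ 1ᴱ))
  odd : ℓ ≡ suc (3 ℕ.* suc (2 ℕ.* j)) ⊎ suc ℓ ≡ 3 ℕ.* suc (2 ℕ.* j) → (⊖ 1ᴱ) ^ᴱ suc (2 ℕ.* j) ≋ 1ᴱ [𝔼/ + ℓ ]
  odd (inj₁ e) = subst (λ t → (⊖ 1ᴱ) ^ᴱ suc (2 ℕ.* j) ≋ 1ᴱ [𝔼/ + t ])
    (sym (prime-even pr (ℕ.divides (2 ℕ.+ 3 ℕ.* j) (trans e (3k+1 j))))) (at-two (suc (2 ℕ.* j)))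
  odd (inj₂ e) = subst (λ t → (⊖ 1ᴱ) ^ᴱ suc (2 ℕ.* j) ≋ 1ᴱ [𝔼/ + t ])
    (sym (prime-even pr (ℕ.divides (1 ℕ.+ 3 ℕ.* j) (ℕ.suc-injective (trans e (3k j)))))) (at-two (suc (2 ℕ.* j)))

-- X is the cubic residue character modulo α on ℤ; law₁ and law₂ are reciprocity between α and
-- a rational prime that splits, respectively stays inert, in ℤ[ω].
record Reciprocal (α : 𝔼) : Set where
  field
    X          : ℤ → Cubic
    X-1        : X (+ 1) ≡ 𝟙
    X-*        : ∀ s t → X (s * t) ≡ X s • X t
    X-periodic : ∀ {s t} → s ≋ t [ℤ/ norm α ] → X s ≡ X t
    υ          : 𝔼
    υ-unit     : norm υ ≡ + 1
    primary    : α ≋ υ [𝔼/ + 3 ]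
    law₁       : ∀ {ℓ k} → Prime ℓ → ¬ (+ ℓ ∣ norm α) → ℓ ≡ suc (3 ℕ.* k) →
                 θ α ^ᴱ k ⊗ ⟦ X (+ ℓ) ⟧ ≋ υ ^ᴱ k [𝔼/ + ℓ ]
    law₂       : ∀ {ℓ k} → Prime ℓ → ¬ (+ ℓ ∣ norm α) → suc ℓ ≡ 3 ℕ.* k →
                 θ α ^ᴱ k ⊗ conj ⟦ X (+ ℓ) ⟧ ≋ υ ^ᴱ k ⊗ ι (norm α) [𝔼/ + ℓ ]

-- The unit `υ` in the laws makes this possible: with the trivial character and υ = α, both sides
-- agree because norm 1 gives θ α = α.
reciprocal-unit : ∀ α → norm α ≡ + 1 → Reciprocal α
reciprocal-unit α N≡1 = record
  { X = λ _ → 𝟙 ; X-1 = refl ; X-* = λ _ _ → refl ; X-periodic = λ _ → refl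
  ; υ = α ; υ-unit = N≡1 ; primary = 𝔼/.≋-refl (+ 3)
  ; law₁ = λ {ℓ} {k} _ _ _ → 𝔼/.≈⇒≋ (+ ℓ) (trans (⊗-identityʳ _) (cong (_^ᴱ k) θα))
  ; law₂ = λ {ℓ} {k} _ _ _ → 𝔼/.≈⇒≋ (+ ℓ) (cong₂ (λ x y → x ^ᴱ k ⊗ ι y) θα (sym N≡1))
  }
  where
  θα : θ α ≡ α
  θα = trans (cong (α ⊗_) (trans (⊗-conj α) (cong ι N≡1))) (⊗-identityʳ α)

reciprocal-⊗ : ∀ {α β} → Reciprocal α → Reciprocal β → Reciprocal (α ⊗ β)
reciprocal-⊗ {α} {β} A B = record
  { X = λ t → A.X t • B.X t
  ; X-1 = cong₂ _•_ A.X-1 B.X-1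
  ; X-* = λ s t → trans (cong₂ _•_ (A.X-* s t) (B.X-* s t)) (•-interchange (A.X s) (A.X t) (B.X s) (B.X t))
  ; X-periodic = λ h → cong₂ _•_
      (A.X-periodic (∣⇒≋ (∣.∣-trans Nα∣N (≋⇒∣ h)))) (B.X-periodic (∣⇒≋ (∣.∣-trans Nβ∣N (≋⇒∣ h))))
  ; υ = A.υ ⊗ B.υ
  ; υ-unit = trans (norm-⊗ A.υ B.υ) (cong₂ ℤ._*_ A.υ-unit B.υ-unit)
  ; primary = 𝔼/.≋-* (+ 3) A.primary B.primary
  ; law₁ = λ {ℓ} {k} pr ℓ∤N ℓ≡ → let open SetoidReasoning (𝔼/.≋-setoid (+ ℓ)) in begin
      θ (α ⊗ β) ^ᴱ k ⊗ ⟦ A.X (+ ℓ) • B.X (+ ℓ) ⟧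
        ≡⟨ cong₂ _⊗_ (θ-^ k) (⟦⟧-• (A.X (+ ℓ)) (B.X (+ ℓ))) ⟩
      (θ α ^ᴱ k ⊗ θ β ^ᴱ k) ⊗ (⟦ A.X (+ ℓ) ⟧ ⊗ ⟦ B.X (+ ℓ) ⟧)
        ≡⟨ interchange (θ α ^ᴱ k) (θ β ^ᴱ k) ⟦ A.X (+ ℓ) ⟧ ⟦ B.X (+ ℓ) ⟧ ⟩
      (θ α ^ᴱ k ⊗ ⟦ A.X (+ ℓ) ⟧) ⊗ (θ β ^ᴱ k ⊗ ⟦ B.X (+ ℓ) ⟧)
        ≈⟨ 𝔼/.≋-* (+ ℓ) (A.law₁ {ℓ} {k} pr (ℓ∤N ∘ ∣α) ℓ≡) (B.law₁ {ℓ} {k} pr (ℓ∤N ∘ ∣β) ℓ≡) ⟩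
      A.υ ^ᴱ k ⊗ B.υ ^ᴱ k
        ≡⟨ ^ᴱ-distrib A.υ B.υ k ⟨
      (A.υ ⊗ B.υ) ^ᴱ k ∎
  ; law₂ = λ {ℓ} {k} pr ℓ∤N ℓ≡ → let open SetoidReasoning (𝔼/.≋-setoid (+ ℓ)) in begin
      θ (α ⊗ β) ^ᴱ k ⊗ conj ⟦ A.X (+ ℓ) • B.X (+ ℓ) ⟧
        ≡⟨ cong₂ _⊗_ (θ-^ k) (trans (cong conj (⟦⟧-• (A.X (+ ℓ)) (B.X (+ ℓ)))) (conj-⊗ _ _)) ⟩
      (θ α ^ᴱ k ⊗ θ β ^ᴱ k) ⊗ (conj ⟦ A.X (+ ℓ) ⟧ ⊗ conj ⟦ B.X (+ ℓ) ⟧)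
        ≡⟨ interchange (θ α ^ᴱ k) (θ β ^ᴱ k) (conj ⟦ A.X (+ ℓ) ⟧) (conj ⟦ B.X (+ ℓ) ⟧) ⟩
      (θ α ^ᴱ k ⊗ conj ⟦ A.X (+ ℓ) ⟧) ⊗ (θ β ^ᴱ k ⊗ conj ⟦ B.X (+ ℓ) ⟧)
        ≈⟨ 𝔼/.≋-* (+ ℓ) (A.law₂ {ℓ} {k} pr (ℓ∤N ∘ ∣α) ℓ≡) (B.law₂ {ℓ} {k} pr (ℓ∤N ∘ ∣β) ℓ≡) ⟩
      (A.υ ^ᴱ k ⊗ ι (norm α)) ⊗ (B.υ ^ᴱ k ⊗ ι (norm β))
        ≡⟨ interchange (A.υ ^ᴱ k) (ι (norm α)) (B.υ ^ᴱ k) (ι (norm β)) ⟩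
      (A.υ ^ᴱ k ⊗ B.υ ^ᴱ k) ⊗ (ι (norm α) ⊗ ι (norm β))
        ≡⟨ cong₂ _⊗_ (sym (^ᴱ-distrib A.υ B.υ k)) (trans (sym (ι-⊗ (norm α) (norm β))) (cong ι (sym (norm-⊗ α β)))) ⟩
      (A.υ ⊗ B.υ) ^ᴱ k ⊗ ι (norm (α ⊗ β)) ∎
  }
  where
  module A = Reciprocal A
  module B = Reciprocal B
  θ-^ : ∀ k → θ (α ⊗ β) ^ᴱ k ≡ θ α ^ᴱ k ⊗ θ β ^ᴱ k
  θ-^ k = trans (cong (_^ᴱ k) (θ-⊗ α β)) (^ᴱ-distrib (θ α) (θ β) k)
  Nα∣N : norm α ∣ norm (α ⊗ β)
  Nα∣N = divides (norm β) (trans (norm-⊗ α β) (ℤ.*-comm (norm α) (norm β)))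
  Nβ∣N : norm β ∣ norm (α ⊗ β)
  Nβ∣N = divides (norm α) (norm-⊗ α β)
  ∣α : ∀ {m} → m ∣ norm α → m ∣ norm (α ⊗ β)
  ∣α d = ∣.∣-trans d Nα∣N
  ∣β : ∀ {m} → m ∣ norm β → m ∣ norm (α ⊗ β)
  ∣β d = ∣.∣-trans d Nβ∣N

-- Conjugating the laws replaces each symbol by its conjugate, which is its square; hence the new
-- character is X².
reciprocal-conj : ∀ {α} → Reciprocal α → Reciprocal (conj α)
reciprocal-conj {α} A = record
  { X = λ t → A.X t • A.X t
  ; X-1 = cong (λ c → c • c) A.X-1
  ; X-* = λ s t → trans (cong (λ c → c • c) (A.X-* s t)) (•-interchange (A.X s) (A.X t) (A.X s) (A.X t))
  ; X-periodic = λ {s} {t} h → cong (λ c → c • c) (A.X-periodic (subst (λ m → s ≋ t [ℤ/ m ]) (norm-conj α) h))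
  ; υ = conj A.υ
  ; υ-unit = trans (norm-conj A.υ) A.υ-unit
  ; primary = conj-≋ A.primary
  ; law₁ = λ {ℓ} {k} pr ℓ∤N ℓ≡ → 𝔼/.≋-trans (+ ℓ)
      (𝔼/.≈⇒≋ (+ ℓ) (sym (trans (conj-⊗ (θ α ^ᴱ k) ⟦ A.X (+ ℓ) ⟧) (cong₂ _⊗_ (θ-conj k) (conj-⟦⟧ (A.X (+ ℓ)))))))
      (𝔼/.≋-trans (+ ℓ) (conj-≋ (A.law₁ {ℓ} {k} pr (∤N ℓ∤N) ℓ≡)) (𝔼/.≈⇒≋ (+ ℓ) (conj-^ A.υ k)))
  ; law₂ = λ {ℓ} {k} pr ℓ∤N ℓ≡ → 𝔼/.≋-trans (+ ℓ)
      (𝔼/.≈⇒≋ (+ ℓ) (sym (trans (conj-⊗ (θ α ^ᴱ k) (conj ⟦ A.X (+ ℓ) ⟧)) (cong₂ _⊗_ (θ-conj k)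
        (cong conj (conj-⟦⟧ (A.X (+ ℓ))))))))
      (𝔼/.≋-trans (+ ℓ) (conj-≋ (A.law₂ {ℓ} {k} pr (∤N ℓ∤N) ℓ≡))
        (𝔼/.≈⇒≋ (+ ℓ) (trans (conj-⊗ (A.υ ^ᴱ k) (ι (norm α))) (cong₂ _⊗_ (conj-^ A.υ k)
          (cong (λ m → ⟨ m , + 0 ⟩) (trans (ℤ.+-identityʳ (norm α)) (sym (norm-conj α))))))))
  }
  where
  module A = Reciprocal A
  θ-conj : ∀ k → conj (θ α ^ᴱ k) ≡ θ (conj α) ^ᴱ k
  θ-conj k = trans (conj-^ (θ α) k) (cong (_^ᴱ k) (conj-θ α))
  ∤N : ∀ {m} → ¬ (m ∣ norm (conj α)) → ¬ (m ∣ norm α)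
  ∤N {m} h d = h (subst (m ∣_) (sym (norm-conj α)) d)

module _ {q : ℕ} (pr : Prime q) {n : ℕ} (q≡ : q ≡ suc (3 ℕ.* n))
  (w : ℤ) (w-root : w * w + w + + 1 ≋ + 0 [ℤ/ + q ]) (q∤3 : ¬ (+ q ∣ + 3)) where
  open CubicCharacter pr {n} q≡ w w-root
  open GaussSum pr {n} q≡ w w-root

  norm-⊖J : norm (⊖ J) ≡ + q
  norm-⊖J = trans (norm-⊖ J) norm-J

  -- The sign is chosen so that -J ≡ 1 modulo 3 and υ = 1. In the laws it disappears by `⊖1^k≋1`.
  reciprocal-J : Reciprocal (⊖ J)
  reciprocal-J = record
    { X = χ ; X-1 = χ-1 ; X-* = χ-*
    ; X-periodic = λ {s} {t} h → χ-periodic (subst (λ m → s ≋ t [ℤ/ m ]) norm-⊖J h)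
    ; υ = 1ᴱ ; υ-unit = refl ; primary = J-primary q∤3
    ; law₁ = λ {ℓ} {k} ℓ-prime ℓ∤N ℓ≡ → 𝔼/.≋-trans (+ ℓ) (𝔼/.≋-*ʳ (+ ℓ) ⟦ χ (+ ℓ) ⟧ (sign {ℓ} {k} ℓ-prime (inj₁ ℓ≡)))
        (𝔼/.≋-trans (+ ℓ) (reciprocity₁ {ℓ} {k} ℓ-prime (q∤ℓ ℓ-prime ℓ∤N) ℓ≡) (𝔼/.≈⇒≋ (+ ℓ) (sym (1^ᴱ k))))
    ; law₂ = λ {ℓ} {k} ℓ-prime ℓ∤N ℓ≡ → 𝔼/.≋-trans (+ ℓ) (𝔼/.≋-*ʳ (+ ℓ) (conj ⟦ χ (+ ℓ) ⟧) (sign {ℓ} {k} ℓ-prime (inj₂ ℓ≡)))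
        (𝔼/.≋-trans (+ ℓ) (reciprocity₂ {ℓ} {k} ℓ-prime (q∤ℓ ℓ-prime ℓ∤N) ℓ≡)
          (𝔼/.≈⇒≋ (+ ℓ) (sym (trans (cong₂ _⊗_ (1^ᴱ k) (cong ι norm-⊖J)) (⊗-identityˡ (ι (+ q)))))))
    }
    where
    q∤ℓ : ∀ {ℓ} → Prime ℓ → ¬ (+ ℓ ∣ norm (⊖ J)) → ¬ (+ q ∣ + ℓ)
    q∤ℓ {ℓ} ℓ-prime ℓ∤N d with prime⇒irreducible ℓ-prime (∣⇒∣ᵤ d)
    ... | inj₁ e = ModPrime.p∤1 pr (subst (λ t → + t ∣ + 1) (sym e) ∣.∣-refl)
    ... | inj₂ e = ℓ∤N (subst (+ ℓ ∣_) (sym norm-⊖J) (subst (λ t → + ℓ ∣ + t) (sym e) ∣.∣-refl))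
    sign : ∀ {ℓ k} → Prime ℓ → ℓ ≡ suc (3 ℕ.* k) ⊎ suc ℓ ≡ 3 ℕ.* k → θ (⊖ J) ^ᴱ k ≋ θ J ^ᴱ k [𝔼/ + ℓ ]
    sign {ℓ} {k} ℓ-prime h = begin
      θ (⊖ J) ^ᴱ k  ≡⟨ cong (_^ᴱ k) (trans (θ-⊖ J) (trans (cong ⊖_ (sym (⊗-identityˡ (θ J)))) (-‿distribˡ-* 1ᴱ (θ J)))) ⟩
      (⊖ 1ᴱ ⊗ θ J) ^ᴱ k  ≡⟨ ^ᴱ-distrib (⊖ 1ᴱ) (θ J) k ⟩
      (⊖ 1ᴱ) ^ᴱ k ⊗ θ J ^ᴱ k  ≈⟨ 𝔼/.≋-*ʳ (+ ℓ) (θ J ^ᴱ k) (⊖1^k≋1 {ℓ} {k} ℓ-prime h) ⟩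
      1ᴱ ⊗ θ J ^ᴱ k  ≡⟨ ⊗-identityˡ (θ J ^ᴱ k) ⟩
      θ J ^ᴱ k  ∎
      where open SetoidReasoning (𝔼/.≋-setoid (+ ℓ))

-- Factorisation of primitive elements into Jacobi sums

-- Without rational prime factors, an element has no inert prime factor: a prime other than 3
-- dividing its norm is 1 modulo 3, hence the norm of a Jacobi sum.
Primitive : 𝔼 → Set
Primitive x = ∀ {r} → Prime r → ¬ (+ r ∣ re x × + r ∣ im x)

∣-⊗ : ∀ {m} x y → m ∣ re y → m ∣ im y → m ∣ re (x ⊗ y) × m ∣ im (x ⊗ y)
∣-⊗ ⟨ a , b ⟩ ⟨ c , d ⟩ m∣c m∣d =
  ∣.∣m∣n⇒∣m-n (∣.∣n⇒∣m*n a m∣c) (∣.∣n⇒∣m*n b m∣d) ,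
  ∣.∣m∣n⇒∣m-n (∣.∣m∣n⇒∣m+n (∣.∣n⇒∣m*n a m∣d) (∣.∣n⇒∣m*n b m∣c)) (∣.∣n⇒∣m*n b m∣d)

primitive-factor : ∀ x y → Primitive (x ⊗ y) → Primitive y
primitive-factor x y prim pr (r∣re , r∣im) = prim pr (∣-⊗ x y r∣re r∣im)

∣im⇒∣re : ∀ {q} → Prime q → ∀ x → + q ∣ norm x → + q ∣ im x → + q ∣ re x
∣im⇒∣re {q} pr ⟨ a , b ⟩ q∣N q∣b = [ (λ d → d) , (λ d → d) ]′ (euclidℤ pr a a (subst (+ q ∣_)
  (solve 2 (λ a b → :norm (a , b) :- (b :* (b :- a)) := a :* a) refl a b)
  (∣.∣m∣n⇒∣m-n q∣N (∣.∣m⇒∣m*n (b - a) q∣b))))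

-- The product of the imaginary parts of x y and x ȳ is a combination of norm x and norm y.
norm-split : ∀ {q} → Prime q → ∀ x y → + q ∣ norm x → + q ∣ norm y →
             (+ q ∣ re (x ⊗ y) × + q ∣ im (x ⊗ y)) ⊎ (+ q ∣ re (x ⊗ conj y) × + q ∣ im (x ⊗ conj y))
norm-split {q} pr x@(⟨ a , b ⟩) y@(⟨ c , d ⟩) q∣x q∣y = [ inj₁ ∘ left , inj₂ ∘ right ]′
  (euclidℤ pr (im (x ⊗ y)) (im (x ⊗ conj y)) q∣product)
  where
  q∣product : + q ∣ im (x ⊗ y) * im (x ⊗ conj y)
  q∣product = subst (+ q ∣_) (solve 4 (λ a b c d → b :* b :* :norm (c , d) :- d :* d :* :norm (a , b)
        := :im ((a , b) :⊗ (c , d)) :* :im ((a , b) :⊗ :conj (c , d))) refl a b c d)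
      (∣.∣m∣n⇒∣m-n (∣.∣n⇒∣m*n (b * b) q∣y) (∣.∣n⇒∣m*n (d * d) q∣x))
  left : + q ∣ im (x ⊗ y) → + q ∣ re (x ⊗ y) × + q ∣ im (x ⊗ y)
  left h = ∣im⇒∣re pr (x ⊗ y) (subst (+ q ∣_) (sym (norm-⊗ x y)) (∣.∣m⇒∣m*n (norm y) q∣x)) h , h
  right : + q ∣ im (x ⊗ conj y) → + q ∣ re (x ⊗ conj y) × + q ∣ im (x ⊗ conj y)
  right h = ∣im⇒∣re pr (x ⊗ conj y) (subst (+ q ∣_) (sym (norm-⊗ x (conj y))) (∣.∣m⇒∣m*n (norm (conj y)) q∣x)) h , h

divide-out : ∀ m x → m ∣ re x → m ∣ im x → ∃ λ y → x ≡ ι m ⊗ y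
divide-out m ⟨ a , b ⟩ (divides s refl) (divides t refl) =
  ⟨ s , t ⟩ , sym (trans (ι-scale m s t) (cong₂ ⟨_,_⟩ (ℤ.*-comm m s) (ℤ.*-comm m t)))

-- Division by y is multiplication by ȳ / q, so divisibility of x ȳ by q is all that is required.
factor-through : ∀ {q} → Prime q → ∀ x y → norm y ≡ + q → + q ∣ re (x ⊗ conj y) → + q ∣ im (x ⊗ conj y) → ∃ λ z → x ≡ y ⊗ z
factor-through {q} pr x y N≡q d₁ d₂ = z , ⊗-cancelˡ (conj y) x (y ⊗ z) N≢0 (begin
  conj y ⊗ x  ≡⟨ ⊗-comm (conj y) x ⟩
  x ⊗ conj y  ≡⟨ proj₂ quotient ⟩
  ι (+ q) ⊗ z  ≡⟨ cong (λ t → ι t ⊗ z) N≡q ⟨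
  ι (norm y) ⊗ z  ≡⟨ cong (_⊗ z) (⊗-conj y) ⟨
  y ⊗ conj y ⊗ z  ≡⟨ cong (_⊗ z) (⊗-comm y (conj y)) ⟩
  conj y ⊗ y ⊗ z  ≡⟨ ⊗-assoc (conj y) y z ⟩
  conj y ⊗ (y ⊗ z)  ∎)
  where
  open ≡.≡-Reasoning
  quotient = divide-out (+ q) (x ⊗ conj y) d₁ d₂
  z = proj₁ quotient
  N≢0 : norm (conj y) ≢ + 0
  N≢0 h = ℕ.≢-nonZero⁻¹ q {{prime⇒nonZero pr}} (ℤ.+-injective (trans (sym N≡q) (trans (sym (norm-conj y)) h)))

prime-divisor : ∀ n → n ≢ 1 → ∃ λ q → Prime q × q ℕ.∣ n
prime-divisor zero    _   = 2 , prime[2] , ℕ.divides 0 refl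
prime-divisor n@(suc _) n≢1 with factorise n
... | record { factors = [] ; isFactorisation = e } = ⊥-elim (n≢1 e)
... | record { factors = q ∷ qs ; isFactorisation = e ; factorsPrime = pr ∷ _ } = q , pr , subst (q ℕ.∣_) (sym e) (ℕ.m∣m*n _)

-- Where a + b ω vanishes modulo q, ω is −a / b.
cube-root : ∀ {q} → Prime q → ∀ α → Primitive α → + q ∣ norm α → ∃ λ w → w * w + w + + 1 ≋ + 0 [ℤ/ + q ]
cube-root {q} pr α@(⟨ a , b ⟩) prim q∣N with + q ∣.∣? b
... | yes q∣b = ⊥-elim (prim pr (∣im⇒∣re pr α q∣N q∣b , q∣b))
... | no q∤b = w , (begin
  w * w + w + + 1
    ≡⟨ solve 3 (λ a b b′ → :w a b′ :* :w a b′ :+ :w a b′ :+ # 1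
         := b′ :* b′ :* :norm (a , b) :+ (# 1 :- b′ :* b) :* (# 1 :+ b′ :* b :- a :* b′)) refl a b b′ ⟩
  b′ * b′ * norm α + (+ 1 - b′ * b) * (+ 1 + b′ * b - a * b′)
    ≈⟨ ≋-+ (≋-*ˡ (b′ * b′) (∣⇒≋0 q∣N)) (≋-*ʳ (+ 1 + b′ * b - a * b′) (≋-+ (≋-refl {+ 1}) (≋-neg h))) ⟩
  b′ * b′ * + 0 + + 0 * (+ 1 + b′ * b - a * b′)
    ≡⟨ solve 2 (λ x y → x :* # 0 :+ # 0 :* y := # 0) refl (b′ * b′) (+ 1 + b′ * b - a * b′) ⟩
  + 0 ∎)
  where
  open ℤ/ (+ q)
  open SetoidReasoning ≋-setoid
  b⁻¹ = ModPrime.inverse pr q∤b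
  b′ : ℤ
  b′ = proj₁ b⁻¹
  h : b′ * b ≋ + 1
  h = proj₂ b⁻¹
  w : ℤ
  w = - (a * b′)
  :w : ∀ {n} → Polynomial n → Polynomial n → Polynomial n
  :w a b′ = :- (a :* b′)

residue-mod-3 : ∀ m → (∃ λ k → m ≡ 3 ℕ.* k) ⊎ (∃ λ k → m ≡ suc (3 ℕ.* k)) ⊎ (∃ λ k → m ≡ suc (suc (3 ℕ.* k)))
residue-mod-3 zero = inj₁ (0 , refl)
residue-mod-3 (suc m) with residue-mod-3 m
... | inj₁ (k , e) = inj₂ (inj₁ (k , cong suc e))
... | inj₂ (inj₁ (k , e)) = inj₂ (inj₂ (k , cong suc e))
... | inj₂ (inj₂ (k , e)) = inj₁ (suc k , trans (cong suc e) (sym (ℕ.*-suc 3 k)))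

-- If q = 3k + 2, Fermat gives w^(3k+1) ≡ 1. Together with w³ ≡ 1 this forces w ≡ 1, and then q
-- divides 1 + 1 + 1 = 3.
cube-root⇒1mod3 : ∀ {q} → Prime q → q ≢ 3 → ∀ w → w * w + w + + 1 ≋ + 0 [ℤ/ + q ] → ∃ λ n → q ≡ suc (3 ℕ.* n)
cube-root⇒1mod3 {q} pr q≢3 w root with residue-mod-3 q
... | inj₁ (k , e) with prime⇒irreducible pr (ℕ.divides k (trans e (ℕ.*-comm 3 k)))
...   | inj₂ 3≡q = ⊥-elim (q≢3 (sym 3≡q))
cube-root⇒1mod3 {q} pr q≢3 w root | inj₂ (inj₁ r) = r
cube-root⇒1mod3 {q} pr q≢3 w root | inj₂ (inj₂ (k , e)) = ⊥-elim (q∤3 (≋0⇒∣ (begin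
  + 1 * + 1 + + 1 + + 1  ≈⟨ ≋-+ (≋-+ (≋-* w≋1 w≋1) w≋1) (≋-refl {+ 1}) ⟨
  w * w + w + + 1  ≈⟨ root ⟩
  + 0  ∎)))
  where
  open ℤ/ (+ q)
  open ModPrime pr
  open SetoidReasoning ≋-setoid
  q∤3 : ¬ (+ q ∣ + 3)
  q∤3 d = [ (λ q≡1 → p∤1 (subst (λ t → + t ∣ + 1) (sym q≡1) ∣.∣-refl)) , q≢3 ]′ (prime⇒irreducible prime[3] (∣⇒∣ᵤ d))
  w³≋1 : w ^ᶻ 3 ≋ + 1
  w³≋1 = begin
    w * (w * (w * + 1))  ≡⟨ solve 1 (λ w → w :* (w :* (w :* # 1)) := # 1 :+ (w :- # 1) :* (w :* w :+ w :+ # 1)) refl w ⟩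
    + 1 + (w - + 1) * (w * w + w + + 1)  ≈⟨ ≋-+ (≋-refl {+ 1}) (≋-*ˡ (w - + 1) root) ⟩
    + 1 + (w - + 1) * + 0  ≡⟨ cong (_+_ (+ 1)) (ℤ.*-zeroʳ (w - + 1)) ⟩
    + 1  ∎
  q∤w : ¬ (+ q ∣ w)
  q∤w d = p∤1 (≋0⇒∣ (≋-trans (≋-sym w³≋1) (≋-trans (≋-*ʳ (w * (w * + 1)) (∣⇒≋0 d)) (≈⇒≋ (ℤ.*-zeroˡ (w * (w * + 1)))))))
  w≋1 : w ≋ + 1
  w≋1 = begin
    w  ≡⟨ ℤ.*-identityʳ w ⟨
    w * + 1  ≡⟨ cong (w *_) (1^ᶻ k) ⟨
    w * (+ 1) ^ᶻ k  ≈⟨ ≋-*ˡ w (≋-^ k w³≋1) ⟨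
    w * (w ^ᶻ 3) ^ᶻ k  ≡⟨ cong (w *_) (^ᶻ-* w 3 k) ⟩
    w ^ᶻ suc (3 ℕ.* k)  ≈⟨ fermat′ e q∤w ⟩
    + 1  ∎

reciprocal-prime : ∀ {q} → Prime q → q ≢ 3 → (∃ λ w → w * w + w + + 1 ≋ + 0 [ℤ/ + q ]) →
                   ∃ λ β → norm β ≡ + q × Reciprocal β
reciprocal-prime {q} pr q≢3 (w , root) =
  ⊖ GaussSum.J pr {n} q≡ w root , norm-⊖J pr {n} q≡ w root q∤3 , reciprocal-J pr {n} q≡ w root q∤3
  where
  n : ℕ
  n = proj₁ (cube-root⇒1mod3 pr q≢3 w root)
  q≡ : q ≡ suc (3 ℕ.* n)
  q≡ = proj₂ (cube-root⇒1mod3 pr q≢3 w root)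
  q∤3 : ¬ (+ q ∣ + 3)
  q∤3 d = [ (λ q≡1 → ModPrime.p∤1 pr (subst (λ t → + t ∣ + 1) (sym q≡1) ∣.∣-refl)) , q≢3 ]′
    (prime⇒irreducible prime[3] (∣⇒∣ᵤ d))

-- Strong induction on the norm. A prime q dividing it is the norm of some -J, and -J or its
-- conjugate divides α by `norm-split`, leaving a primitive cofactor of smaller norm.
reciprocal : ∀ N α → norm α ≡ + N → Primitive α → ¬ (+ 3 ∣ norm α) → Reciprocal α
reciprocal = <-rec (λ N → ∀ α → norm α ≡ + N → Primitive α → ¬ (+ 3 ∣ norm α) → Reciprocal α) step
  where
  step : ∀ N → (∀ {M} → M ℕ.< N → ∀ α → norm α ≡ + M → Primitive α → ¬ (+ 3 ∣ norm α) → Reciprocal α) →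
         ∀ α → norm α ≡ + N → Primitive α → ¬ (+ 3 ∣ norm α) → Reciprocal α
  step N rec α N≡ prim 3∤N with N ℕ.≟ 1
  ... | yes refl = reciprocal-unit α N≡
  ... | no N≢1 with prime-divisor N N≢1
  ...   | q , pr , q∣N = result
    where
    q∣norm : + q ∣ norm α
    q∣norm = subst (+ q ∣_) (sym N≡) (∣ᵤ⇒∣ q∣N)
    q≢3 : q ≢ 3
    q≢3 refl = 3∤N q∣norm
    Jacobi : ∃ λ β → norm β ≡ + q × Reciprocal β
    Jacobi = reciprocal-prime pr q≢3 (cube-root pr α prim q∣norm)

    continue : ∀ β → norm β ≡ + q → Reciprocal β → (∃ λ γ → α ≡ β ⊗ γ) → Reciprocal α
    continue β Nβ β-rec (γ , α≡βγ) = subst Reciprocal (sym α≡βγ) (reciprocal-⊗ β-rec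
      (rec M<N γ Nγ (primitive-factor β γ (subst Primitive α≡βγ prim)) (λ d → 3∤N (subst (+ 3 ∣_)
        (sym Nα) (∣.∣n⇒∣m*n (norm β) d)))))
      where
      instance
        q≢0 : ℕ.NonZero q
        q≢0 = prime⇒nonZero pr
      M : ℕ
      M = ℕ.quotient q∣N
      N≡Mq : N ≡ M ℕ.* q
      N≡Mq = ℕ._∣_.equality q∣N
      Nα : norm α ≡ norm β * norm γ
      Nα = trans (cong norm α≡βγ) (norm-⊗ β γ)
      Nγ : norm γ ≡ + M
      Nγ = ℤ.*-cancelˡ-≡ (+ q) (norm γ) (+ M) (trans (cong (ℤ._* norm γ) (sym Nβ))
        (trans (sym Nα) (trans N≡ (trans (cong +_ (trans N≡Mq (ℕ.*-comm M q))) (ℤ.pos-* q M)))))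
      -- A vanishing norm would be divisible by 3.
      M≢0 : M ≢ 0
      M≢0 e = 3∤N (subst (+ 3 ∣_) (sym (trans N≡ (cong +_ (trans N≡Mq (cong (ℕ._* q) e))))) (∣ᵤ⇒∣ (ℕ.divides 0 refl)))
      M<N : M ℕ.< N
      M<N = subst (M ℕ.<_) (sym N≡Mq) (ℕ.m<m*n M q {{ℕ.≢-nonZero M≢0}} (ℕ.nonTrivial⇒n>1 q {{prime⇒nonTrivial pr}}))

    split : ∀ β → norm β ≡ + q → Reciprocal β → Reciprocal α
    split β Nβ β-rec = [ (λ (d₁ , d₂) → continue (conj β) (trans (norm-conj β) Nβ) (reciprocal-conj β-rec)
        (factor-through pr α (conj β) (trans (norm-conj β) Nβ)
          (subst (λ z → + q ∣ re (α ⊗ z)) (sym (conj-conj β)) d₁) (subst (λ z → + q ∣ im (α ⊗ z)) (sym (conj-conj β)) d₂)))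
      , (λ (d₁ , d₂) → continue β Nβ β-rec (factor-through pr α β Nβ d₁ d₂)) ]′
      (norm-split pr α β q∣norm (subst (+ q ∣_) (sym Nβ) ∣.∣-refl))

    result : Reciprocal α
    result = split (proj₁ Jacobi) (proj₁ (proj₂ Jacobi)) (proj₂ (proj₂ Jacobi))

-- Symbol values modulo ℓ, the character modulo 9, units of ℤ[ω]

prime∣prime : ∀ {r p} → Prime r → Prime p → r ℕ.∣ p → r ≡ p
prime∣prime {r} pr-r pr-p d = [ (λ e → ⊥-elim (ModPrime.p∤1 pr-r (subst (λ t → + t ∣ + 1) (sym e) ∣.∣-refl)))
    , (λ e → e) ]′ (prime⇒irreducible pr-p d)

module _ {ℓ : ℕ} (pr : Prime ℓ) where
  open 𝔼/ (+ ℓ)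

  ι-cancelˡ : ∀ {m x y} → ¬ (+ ℓ ∣ m) → ι m ⊗ x ≋ ι m ⊗ y → x ≋ y
  ι-cancelˡ {m} {⟨ a , b ⟩} {⟨ c , d ⟩} ℓ∤m h = ⟨⟩-≋ (ModPrime.cancelˡ pr ℓ∤m (re-≋ h′)) (ModPrime.cancelˡ pr ℓ∤m (im-≋ h′))
    where
    h′ : ⟨ m * a , m * b ⟩ ≋ ⟨ m * c , m * d ⟩
    h′ = ≋-trans (≈⇒≋ (sym (ι-scale m a b))) (≋-trans h (≈⇒≋ (ι-scale m c d)))

  ⊗-cancel-≋ : ∀ z {x y} → ¬ (+ ℓ ∣ norm z) → z ⊗ x ≋ z ⊗ y → x ≋ y
  ⊗-cancel-≋ z {x} {y} ℓ∤N h = ι-cancelˡ {norm z} ℓ∤N (≋-trans (≈⇒≋ (expand x)) (≋-trans (≋-*ˡ (conj z) h) (≈⇒≋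
      (sym (expand y)))))
    where
    expand : ∀ x → ι (norm z) ⊗ x ≡ conj z ⊗ (z ⊗ x)
    expand x = trans (cong (_⊗ x) (trans (sym (⊗-conj z)) (⊗-comm z (conj z)))) (⊗-assoc (conj z) z x)

  ⟦⟧-≋-injective : ℓ ≢ 3 → ∀ {c d} → ⟦ c ⟧ ≋ ⟦ d ⟧ → c ≡ d
  ⟦⟧-≋-injective ℓ≢3 {c} {d} (by z e) = [ (λ e → e) , ⊥-elim ∘ [ (λ N≡1 → ModPrime.p∤1 pr (subst (+ ℓ ∣_) N≡1 ℓ∣N))
                                                     , (λ N≡3 → ℓ≢3 (prime∣prime pr prime[3] (∣⇒∣ᵤ
                                                         (subst (+ ℓ ∣_) N≡3 ℓ∣N)))) ]′ ]′ (separated c d)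
    where
    diff : ⟦ c ⟧ ⊕ ⊖ ⟦ d ⟧ ≡ ι (+ ℓ) ⊗ z
    diff = trans (cong (_⊕ ⊖ ⟦ d ⟧) e) (trans (cong (_⊕ ⊖ ⟦ d ⟧) (⊕-comm ⟦ d ⟧ (ι (+ ℓ) ⊗ z)))
      (trans (⊕-assoc (ι (+ ℓ) ⊗ z) ⟦ d ⟧ (⊖ ⟦ d ⟧)) (trans (cong (ι (+ ℓ) ⊗ z ⊕_) (⊕-inverseʳ ⟦ d ⟧)) (⊕-identityʳ _))))
    ℓ∣N : + ℓ ∣ norm (⟦ c ⟧ ⊕ ⊖ ⟦ d ⟧)
    ℓ∣N = subst (λ t → + ℓ ∣ norm t) (sym diff) (subst (+ ℓ ∣_) (sym (norm-⊗ (ι (+ ℓ)) z))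
      (∣.∣m⇒∣m*n (norm z) (divides (+ ℓ) (solve 1 (λ l → :norm (:ι l) := l :* l) refl (+ ℓ)))))

infixr 8 _^ᶜ_
_^ᶜ_ : Cubic → ℕ → Cubic
c ^ᶜ zero  = 𝟙
c ^ᶜ suc k = c • c ^ᶜ k

⟦⟧-^ : ∀ c k → ⟦ c ^ᶜ k ⟧ ≡ ⟦ c ⟧ ^ᴱ k
⟦⟧-^ c zero    = refl
⟦⟧-^ c (suc k) = trans (⟦⟧-• c (c ^ᶜ k)) (cong (⟦ c ⟧ ⊗_) (⟦⟧-^ c k))

𝟙^ : ∀ k → 𝟙 ^ᶜ k ≡ 𝟙
𝟙^ zero = refl
𝟙^ (suc k) = 𝟙^ k

_≟ᶜ_ : (c d : Cubic) → Dec (c ≡ d)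
c ≟ᶜ d = map′ (λ e → trans (sym (decode c)) (trans (cong back e) (decode d))) (cong code) (code c ℕ.≟ code d)
  where
  code : Cubic → ℕ
  code 𝟘 = 0
  code 𝟙 = 1
  code 𝕨 = 2
  code 𝕨² = 3
  back : ℕ → Cubic
  back 0 = 𝟘
  back 1 = 𝟙
  back 2 = 𝕨
  back _ = 𝕨²
  decode : ∀ c → back (code c) ≡ c
  decode 𝟘 = refl
  decode 𝟙 = refl
  decode 𝕨 = refl
  decode 𝕨² = refl

-- The table of ω^((m² - 1)/3) for m prime to 3.
ψ : ℕ → Cubic
ψ 1 = 𝟙
ψ 2 = 𝕨
ψ 4 = 𝕨²
ψ 5 = 𝕨²
ψ 7 = 𝕨
ψ 8 = 𝟙
ψ _ = 𝟘

-- The cubic character of (ℤ/9)ˣ attached to the supplementary law for ω.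
Ψ : ℕ → Cubic
Ψ m = ψ (m % 9)

private
  abstract
    ψ-table : ∀ (i j : Fin 9) → ψ ((toℕ i ℕ.* toℕ j) % 9) ≡ ψ (toℕ i) • ψ (toℕ j)
    ψ-table = from-yes (Fin.all? {9} λ i → Fin.all? {9} λ j → ψ ((toℕ i ℕ.* toℕ j) % 9) ≟ᶜ (ψ (toℕ i) • ψ (toℕ j)))

Ψ-* : ∀ m n → Ψ (m ℕ.* n) ≡ Ψ m • Ψ n
Ψ-* m n = trans (cong ψ (%-distribˡ-* m n 9)) (subst₂ (λ a b → ψ ((a ℕ.* b) % 9) ≡ ψ a • ψ b)
  (Fin.toℕ-fromℕ< (m%n<n m 9)) (Fin.toℕ-fromℕ< (m%n<n n 9)) (ψ-table (fromℕ< (m%n<n m 9)) (fromℕ< (m%n<n n 9))))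
  where open ≡ using (subst₂)

Ψ-+9 : ∀ m → Ψ (9 ℕ.+ m) ≡ Ψ m
Ψ-+9 m = cong ψ (trans (cong (_% 9) (ℕ.+-comm 9 m)) ([m+n]%n≡m%n m 9))

cube≡𝟙 : ∀ {c} → c ≢ 𝟘 → ∀ d → c • (c • (c • d)) ≡ d
cube≡𝟙 {𝟘} h d = ⊥-elim (h refl)
cube≡𝟙 {𝟙} h d = refl
cube≡𝟙 {𝕨} h 𝟘 = refl
cube≡𝟙 {𝕨} h 𝟙 = refl
cube≡𝟙 {𝕨} h 𝕨 = refl
cube≡𝟙 {𝕨} h 𝕨² = refl
cube≡𝟙 {𝕨²} h 𝟘 = refl
cube≡𝟙 {𝕨²} h 𝟙 = refl
cube≡𝟙 {𝕨²} h 𝕨 = refl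
cube≡𝟙 {𝕨²} h 𝕨² = refl

private
  3*[3+k] : ∀ k → 3 ℕ.* (3 ℕ.+ k) ≡ 9 ℕ.+ 3 ℕ.* k
  3*[3+k] k = ℕ.*-distribˡ-+ 3 3 k

-- For υ = ±ω² these powers of ω are the symbols that reciprocity assigns to the primes dividing 2x.
-- Since ω³ = 1, only k modulo 3 matters, hence the period 9.
Ψ-1+3k : ∀ k → Ψ (suc (3 ℕ.* k)) ≡ 𝕨² ^ᶜ k
Ψ-1+3k 0 = refl
Ψ-1+3k 1 = refl
Ψ-1+3k 2 = refl
Ψ-1+3k (suc (suc (suc k))) = trans (cong (Ψ ∘ suc) (3*[3+k] k)) (trans (Ψ-+9 (suc (3 ℕ.* k)))
  (trans (Ψ-1+3k k) (sym (cube≡𝟙 {𝕨²} (λ ()) (𝕨² ^ᶜ k)))))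

Ψ-2+3k : ∀ k → Ψ (suc (suc (3 ℕ.* k))) ≡ 𝕨 ^ᶜ suc k
Ψ-2+3k 0 = refl
Ψ-2+3k 1 = refl
Ψ-2+3k 2 = refl
Ψ-2+3k (suc (suc (suc k))) = trans (cong (Ψ ∘ suc ∘ suc) (3*[3+k] k)) (trans (Ψ-+9 (suc (suc (3 ℕ.* k))))
  (trans (Ψ-2+3k k) (cong (𝕨 •_) (sym (cube≡𝟙 {𝕨} (λ ()) (𝕨 ^ᶜ k))))))

Ψ-3k-1 : ∀ {ℓ k} → suc ℓ ≡ 3 ℕ.* k → Ψ ℓ ≡ 𝕨 ^ᶜ k
Ψ-3k-1 {ℓ} {suc k} e = trans (cong Ψ (ℕ.suc-injective (trans e (ℕ.*-suc 3 k)))) (Ψ-2+3k k)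

multiplicative-≡ : (F G : ℕ → Cubic) → F 1 ≡ G 1 → (∀ m n → F (m ℕ.* n) ≡ F m • F n) → (∀ m n → G (m ℕ.* n) ≡ G m • G n) →
                   ∀ n .{{_ : ℕ.NonZero n}} → (∀ {ℓ} → Prime ℓ → ℓ ℕ.∣ n → F ℓ ≡ G ℓ) → F n ≡ G n
multiplicative-≡ F G one F-* G-* n agree = subst (λ m → F m ≡ G m) (sym isFactorisation)
  (go factors factorsPrime (λ pr d → agree pr (subst (_ ℕ.∣_) (sym isFactorisation) d)))
  where
  open PrimeFactorisation (factorise n)
  go : ∀ ps → All Prime ps → (∀ {ℓ} → Prime ℓ → ℓ ℕ.∣ product ps → F ℓ ≡ G ℓ) → F (product ps) ≡ G (product ps)
  go [] [] h = one
  go (p ∷ ps) (pr ∷ prs) h = trans (F-* p (product ps)) (trans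
    (cong₂ _•_ (h pr (ℕ.m∣m*n (product ps))) (go ps prs (λ pr d → h pr (ℕ.∣n⇒∣m*n p d)))) (sym (G-* p (product ps))))

square : ∀ z → z * z ≡ + (ℤ.∣ z ∣ ℕ.* ℤ.∣ z ∣)
square (+ n)    = sym (ℤ.pos-* n n)
square -[1+ n ] = refl

±_ : 𝔼 → 𝔼 → Set
(± y) x = x ≡ y ⊎ x ≡ ⊖ y

-- From 4 norm = (2a - b)² + 3b² one gets 3b² ≤ 4, and likewise for a, so both coordinates are -1, 0
-- or 1.
unit-cases : ∀ a b → norm ⟨ a , b ⟩ ≡ + 1 → (± ⟦ 𝟙 ⟧) ⟨ a , b ⟩ ⊎ (± ⟦ 𝕨 ⟧) ⟨ a , b ⟩ ⊎ (± ⟦ 𝕨² ⟧) ⟨ a , b ⟩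
unit-cases a b N≡1 = cases a b (small b (bound a b N≡1)) (small a (bound b a (trans
    (solve 2 (λ a b → :norm (b , a) := :norm (a , b)) refl a b) N≡1))) N≡1
  where
  bound : ∀ a b → norm ⟨ a , b ⟩ ≡ + 1 → 3 ℕ.* (ℤ.∣ b ∣ ℕ.* ℤ.∣ b ∣) ℕ.≤ 4
  bound a b N≡1 = ℕ.≤-trans (ℕ.m≤n+m _ (ℤ.∣ + 2 * a - b ∣ ℕ.* ℤ.∣ + 2 * a - b ∣)) (ℕ.≤-reflexive (ℤ.+-injective (begin
    + (ℤ.∣ + 2 * a - b ∣ ℕ.* ℤ.∣ + 2 * a - b ∣ ℕ.+ 3 ℕ.* (ℤ.∣ b ∣ ℕ.* ℤ.∣ b ∣))
      ≡⟨ ℤ.pos-+ (ℤ.∣ + 2 * a - b ∣ ℕ.* ℤ.∣ + 2 * a - b ∣) (3 ℕ.* (ℤ.∣ b ∣ ℕ.* ℤ.∣ b ∣)) ⟩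
    + (ℤ.∣ + 2 * a - b ∣ ℕ.* ℤ.∣ + 2 * a - b ∣) + + (3 ℕ.* (ℤ.∣ b ∣ ℕ.* ℤ.∣ b ∣))
      ≡⟨ cong₂ _+_ (sym (square (+ 2 * a - b))) (trans (ℤ.pos-* 3 (ℤ.∣ b ∣ ℕ.* ℤ.∣ b ∣)) (cong (+ 3 *_) (sym (square b)))) ⟩
    (+ 2 * a - b) * (+ 2 * a - b) + + 3 * (b * b)
      ≡⟨ solve 2 (λ a b → (# 2 :* a :- b) :* (# 2 :* a :- b) :+ # 3 :* (b :* b) := # 4 :* :norm (a , b)) refl a b ⟩
    + 4 * norm ⟨ a , b ⟩
      ≡⟨ cong (+ 4 *_) N≡1 ⟩
    + 4 ∎)))
    where open ≡.≡-Reasoning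
  too-big : ∀ n → ¬ (3 ℕ.* (suc (suc n) ℕ.* suc (suc n)) ℕ.≤ 4)
  too-big n h = ℕ.<⇒≱ {4} {12} (s≤s (s≤s (s≤s (s≤s (s≤s z≤n)))))
    (ℕ.≤-trans (ℕ.*-monoʳ-≤ 3 (ℕ.*-mono-≤ {2} {suc (suc n)} {2} (s≤s (s≤s z≤n)) (s≤s (s≤s z≤n)))) h)
  small : ∀ z → 3 ℕ.* (ℤ.∣ z ∣ ℕ.* ℤ.∣ z ∣) ℕ.≤ 4 → z ≡ + 0 ⊎ z ≡ + 1 ⊎ z ≡ -[1+ 0 ]
  small (+ 0) _ = inj₁ refl
  small (+ 1) _ = inj₂ (inj₁ refl)
  small -[1+ 0 ] _ = inj₂ (inj₂ refl)
  small (+ suc (suc n)) h = ⊥-elim (too-big n h)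
  small -[1+ suc n ] h = ⊥-elim (too-big n h)
  cases : ∀ a b → b ≡ + 0 ⊎ b ≡ + 1 ⊎ b ≡ -[1+ 0 ] → a ≡ + 0 ⊎ a ≡ + 1 ⊎ a ≡ -[1+ 0 ] → norm ⟨ a , b ⟩ ≡ + 1 →
          (± ⟦ 𝟙 ⟧) ⟨ a , b ⟩ ⊎ (± ⟦ 𝕨 ⟧) ⟨ a , b ⟩ ⊎ (± ⟦ 𝕨² ⟧) ⟨ a , b ⟩
  cases _ _ (inj₁ refl) (inj₁ refl) ()
  cases _ _ (inj₁ refl) (inj₂ (inj₁ refl)) _ = inj₁ (inj₁ refl)
  cases _ _ (inj₁ refl) (inj₂ (inj₂ refl)) _ = inj₁ (inj₂ refl)
  cases _ _ (inj₂ (inj₁ refl)) (inj₁ refl) _ = inj₂ (inj₁ (inj₁ refl))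
  cases _ _ (inj₂ (inj₁ refl)) (inj₂ (inj₁ refl)) _ = inj₂ (inj₂ (inj₂ refl))
  cases _ _ (inj₂ (inj₁ refl)) (inj₂ (inj₂ refl)) ()
  cases _ _ (inj₂ (inj₂ refl)) (inj₁ refl) _ = inj₂ (inj₁ (inj₂ refl))
  cases _ _ (inj₂ (inj₂ refl)) (inj₂ (inj₁ refl)) ()
  cases _ _ (inj₂ (inj₂ refl)) (inj₂ (inj₂ refl)) _ = inj₂ (inj₂ (inj₁ refl))

private
  3∤unit : ∀ {z} → + 3 ∣ z → ℤ.∣ z ∣ ≢ 1
  3∤unit d e = 3≢1 (ℕ.∣1⇒≡1 (subst (3 ℕ.∣_) e (∣⇒∣ᵤ d)))
    where
    3≢1 : 3 ≢ 1
    3≢1 ()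

unit-∣im : ∀ υ → norm υ ≡ + 1 → + 3 ∣ im υ → (± ⟦ 𝟙 ⟧) υ
unit-∣im ⟨ a , b ⟩ N≡1 d = go (unit-cases a b N≡1) d
  where
  go : ∀ {x} → (± ⟦ 𝟙 ⟧) x ⊎ (± ⟦ 𝕨 ⟧) x ⊎ (± ⟦ 𝕨² ⟧) x → + 3 ∣ im x → (± ⟦ 𝟙 ⟧) x
  go (inj₁ h) _ = h
  go (inj₂ (inj₁ (inj₁ refl))) d = ⊥-elim (3∤unit d refl)
  go (inj₂ (inj₁ (inj₂ refl))) d = ⊥-elim (3∤unit d refl)
  go (inj₂ (inj₂ (inj₁ refl))) d = ⊥-elim (3∤unit d refl)
  go (inj₂ (inj₂ (inj₂ refl))) d = ⊥-elim (3∤unit d refl)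

unit-∣re-im : ∀ υ → norm υ ≡ + 1 → + 3 ∣ re υ - im υ → (± ⟦ 𝕨² ⟧) υ
unit-∣re-im ⟨ a , b ⟩ N≡1 d = go (unit-cases a b N≡1) d
  where
  go : ∀ {x} → (± ⟦ 𝟙 ⟧) x ⊎ (± ⟦ 𝕨 ⟧) x ⊎ (± ⟦ 𝕨² ⟧) x → + 3 ∣ re x - im x → (± ⟦ 𝕨² ⟧) x
  go (inj₂ (inj₂ h)) _ = h
  go (inj₁ (inj₁ refl)) d = ⊥-elim (3∤unit d refl)
  go (inj₁ (inj₂ refl)) d = ⊥-elim (3∤unit d refl)
  go (inj₂ (inj₁ (inj₁ refl))) d = ⊥-elim (3∤unit d refl)
  go (inj₂ (inj₁ (inj₂ refl))) d = ⊥-elim (3∤unit d refl)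

%9-≋ : ∀ m n → + m ≋ + n [ℤ/ + 9 ] → m % 9 ≡ n % 9
%9-≋ m n h = Residues.small-≋ 9 (m%n<n m 9) (m%n<n n 9) (≋-trans (residue m) (≋-trans h (≋-sym (residue n))))
  where
  open ℤ/ (+ 9)
  residue : ∀ m → + (m % 9) ≋ + m
  residue m = ≋-sym (by (+ (m ℕ./ 9)) (trans (cong +_ (m≡m%n+[m/n]*n m 9)) (trans (ℤ.pos-+ (m % 9) (m ℕ./ 9 ℕ.* 9))
    (cong (ℤ._+_ (+ (m % 9))) (trans (cong +_ (ℕ.*-comm (m ℕ./ 9) 9)) (ℤ.pos-* 9 (m ℕ./ 9)))))))

𝕨^≢𝟘 : ∀ k → 𝕨 ^ᶜ k ≢ 𝟘
𝕨^≢𝟘 zero ()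
𝕨^≢𝟘 (suc k) = step (𝕨 ^ᶜ k) (𝕨^≢𝟘 k)
  where
  step : ∀ c → c ≢ 𝟘 → 𝕨 • c ≢ 𝟘
  step 𝟘 h _ = h refl
  step 𝟙 h ()
  step 𝕨 h ()
  step 𝕨² h ()

𝕨^-square : ∀ k → 𝕨 ^ᶜ k • 𝕨 ^ᶜ k ≡ 𝕨² ^ᶜ k
𝕨^-square zero = refl
𝕨^-square (suc k) = trans (•-interchange 𝕨 (𝕨 ^ᶜ k) 𝕨 (𝕨 ^ᶜ k)) (cong (𝕨² •_) (𝕨^-square k))

-- The cubic symbol of x + y √-3 modulo p

-- The parameters `c` and `s` treat both forms at once: with N = x² + 3y², x² + 15y² = 5N - (2x)²
-- and 5x² + 3y² = N + (2x)².
module CubicSymbol {p : ℕ} (pr : Prime p) (x y c s : ℤ) (s≡±1 : s ≡ + 1 ⊎ s ≡ -[1+ 0 ])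
  (p≡ : + p ≡ c * (x * x + + 3 * (y * y)) + s * ((+ 2 * x) * (+ 2 * x)))
  (p∤2x : ¬ (+ p ∣ + 2 * x)) (3∤x : ¬ (+ 3 ∣ x)) where

  N : ℤ
  N = x * x + + 3 * (y * y)

  -- α = x + y √−3, since √−3 = 1 + 2 ω.
  α : 𝔼
  α = ⟨ x + y , + 2 * y ⟩

  norm-α : norm α ≡ N
  norm-α = solve 2 (λ x y → :norm (x :+ y , # 2 :* y) := x :* x :+ # 3 :* (y :* y)) refl x y

  -- A common prime factor would divide p, hence be p, which does not divide 2x. So reciprocity
  -- applies to every prime dividing 2x.
  ∣2x∣N⇒⊥ : ∀ {ℓ} → Prime ℓ → + ℓ ∣ + 2 * x → ¬ (+ ℓ ∣ N)
  ∣2x∣N⇒⊥ {ℓ} ℓ-prime ℓ∣2x ℓ∣N = p∤2x (subst (λ t → + t ∣ + 2 * x) (prime∣prime ℓ-prime pr (∣⇒∣ᵤ ℓ∣p)) ℓ∣2x)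
    where
    ℓ∣p : + ℓ ∣ + p
    ℓ∣p = subst (+ ℓ ∣_) (sym p≡) (∣.∣m∣n⇒∣m+n (∣.∣n⇒∣m*n c ℓ∣N) (∣.∣n⇒∣m*n s (∣.∣m⇒∣m*n (+ 2 * x) ℓ∣2x)))

  p∤N : ¬ (+ p ∣ N)
  p∤N d = [ p∤2x , p∤2x ]′ (euclidℤ pr (+ 2 * x) (+ 2 * x) ([ (λ e → go₁ e) , (λ e → go₂ e) ]′ s≡±1))
    where
    p∣s : + p ∣ s * ((+ 2 * x) * (+ 2 * x))
    p∣s = ∣.∣m+n∣m⇒∣n (subst (+ p ∣_) p≡ ∣.∣-refl) (∣.∣n⇒∣m*n c d)
    go₁ : s ≡ + 1 → + p ∣ (+ 2 * x) * (+ 2 * x)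
    go₁ e = subst (+ p ∣_) (trans (cong (_* ((+ 2 * x) * (+ 2 * x))) e) (ℤ.*-identityˡ _)) p∣s
    go₂ : s ≡ -[1+ 0 ] → + p ∣ (+ 2 * x) * (+ 2 * x)
    go₂ e = subst (+ p ∣_) (trans (cong (λ t → -[1+ 0 ] * (t * ((+ 2 * x) * (+ 2 * x)))) e)
      (solve 1 (λ z → con -[1+ 0 ] :* (con -[1+ 0 ] :* z) := z) refl ((+ 2 * x) * (+ 2 * x)))) (∣.∣n⇒∣m*n -[1+ 0 ] p∣s)

  3∤2x : ¬ (+ 3 ∣ + 2 * x)
  3∤2x d = 3∤x (subst (+ 3 ∣_) (solve 1 (λ x → # 3 :* x :- # 2 :* x := x) refl x)
    (∣.∣m∣n⇒∣m-n (∣.∣m⇒∣m*n x ∣.∣-refl) d))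

  3∤N : ¬ (+ 3 ∣ norm α)
  3∤N d = [ 3∤x , 3∤x ]′ (euclidℤ prime[3] x x (∣.∣m+n∣n⇒∣m (subst (+ 3 ∣_) norm-α d) (∣.∣m⇒∣m*n (y * y) ∣.∣-refl)))

  α-primitive : Primitive α
  α-primitive {r} r-prime (r∣re , r∣im) = ∣2x∣N⇒⊥ r-prime r∣2x (subst (+ r ∣_) norm-α r∣norm)
    where
    r∣2x : + r ∣ + 2 * x
    r∣2x = subst (+ r ∣_) (solve 2 (λ x y → # 2 :* (x :+ y) :- # 2 :* y := # 2 :* x) refl x y)
      (∣.∣m∣n⇒∣m-n (∣.∣n⇒∣m*n (+ 2) r∣re) r∣im)
    r∣norm : + r ∣ norm α
    r∣norm = ∣.∣m∣n⇒∣m+n (∣.∣m∣n⇒∣m-n (∣.∣m⇒∣m*n (x + y) r∣re) (∣.∣m⇒∣m*n (+ 2 * y) r∣re)) (∣.∣m⇒∣m*n (+ 2 * y) r∣im)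

  private
    norm-pos : norm α ≡ + (ℤ.∣ x ∣ ℕ.* ℤ.∣ x ∣ ℕ.+ 3 ℕ.* (ℤ.∣ y ∣ ℕ.* ℤ.∣ y ∣))
    norm-pos = trans norm-α (sym (trans (ℤ.pos-+ (ℤ.∣ x ∣ ℕ.* ℤ.∣ x ∣) (3 ℕ.* (ℤ.∣ y ∣ ℕ.* ℤ.∣ y ∣)))
      (cong₂ _+_ (sym (square x)) (trans (ℤ.pos-* 3 (ℤ.∣ y ∣ ℕ.* ℤ.∣ y ∣)) (cong (+ 3 *_) (sym (square y)))))))

  abstract
    α-reciprocal : Reciprocal α
    α-reciprocal = reciprocal (ℤ.∣ x ∣ ℕ.* ℤ.∣ x ∣ ℕ.+ 3 ℕ.* (ℤ.∣ y ∣ ℕ.* ℤ.∣ y ∣)) α norm-pos α-primitive 3∤N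

  open Reciprocal α-reciprocal

  X-neg1 : X -[1+ 0 ] ≡ 𝟙
  X-neg1 = •-square-injective (X -[1+ 0 ]) 𝟙 (trans (sym (X-* -[1+ 0 ] -[1+ 0 ])) X-1)

  X-abs : ∀ m → X m ≡ X (+ ℤ.∣ m ∣)
  X-abs (+ m) = refl
  X-abs -[1+ m ] = trans (cong X (sym (ℤ.-1*i≡-i (+ suc m)))) (trans (X-* -[1+ 0 ] (+ suc m)) (cong (_• X (+ suc m)) X-neg1))

  X-s : X s ≡ 𝟙
  X-s = [ (λ e → trans (cong X e) X-1) , (λ e → trans (cong X e) X-neg1) ]′ s≡±1

  X-p : X (+ p) ≡ X (+ 2 * x) • X (+ 2 * x)
  X-p = trans (X-periodic (ℤ/.by c (trans p≡ (trans (ℤ.+-comm (c * N) _)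
      (cong (_+_ (s * ((+ 2 * x) * (+ 2 * x)))) (trans (ℤ.*-comm c N) (cong (_* c) (sym norm-α))))))))
    (trans (X-* s ((+ 2 * x) * (+ 2 * x))) (trans (cong (_• X ((+ 2 * x) * (+ 2 * x))) X-s) (X-* (+ 2 * x) (+ 2 * x))))

  module _ {ℓ : ℕ} (ℓ-prime : Prime ℓ) where
    open 𝔼/ (+ ℓ)

    ±^ : ∀ {d k} → (± ⟦ d ⟧) υ → ℓ ≡ suc (3 ℕ.* k) ⊎ suc ℓ ≡ 3 ℕ.* k → υ ^ᴱ k ≋ ⟦ d ^ᶜ k ⟧
    ±^ {d} {k} (inj₁ e) _ = ≈⇒≋ (trans (cong (_^ᴱ k) e) (sym (⟦⟧-^ d k)))
    ±^ {d} {k} (inj₂ e) h = begin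
      υ ^ᴱ k  ≡⟨ cong (_^ᴱ k) (trans e (trans (cong ⊖_ (sym (⊗-identityˡ ⟦ d ⟧))) (-‿distribˡ-* 1ᴱ ⟦ d ⟧))) ⟩
      (⊖ 1ᴱ ⊗ ⟦ d ⟧) ^ᴱ k  ≡⟨ ^ᴱ-distrib (⊖ 1ᴱ) ⟦ d ⟧ k ⟩
      (⊖ 1ᴱ) ^ᴱ k ⊗ ⟦ d ⟧ ^ᴱ k  ≈⟨ ≋-*ʳ (⟦ d ⟧ ^ᴱ k) (⊖1^k≋1 {ℓ} {k} ℓ-prime h) ⟩
      1ᴱ ⊗ ⟦ d ⟧ ^ᴱ k  ≡⟨ ⊗-identityˡ (⟦ d ⟧ ^ᴱ k) ⟩
      ⟦ d ⟧ ^ᴱ k  ≡⟨ ⟦⟧-^ d k ⟨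
      ⟦ d ^ᶜ k ⟧  ∎
      where open SetoidReasoning ≋-setoid

    module _ (ℓ∣2x : + ℓ ∣ + 2 * x) where
      ℓ∤N : ¬ (+ ℓ ∣ norm α)
      ℓ∤N d = ∣2x∣N⇒⊥ ℓ-prime ℓ∣2x (subst (+ ℓ ∣_) norm-α d)

      ℓ≢3 : ℓ ≢ 3
      ℓ≢3 e = 3∤2x (subst (λ t → + t ∣ + 2 * x) e ℓ∣2x)

      -- conj α = 2x − α, so α is purely imaginary modulo ℓ.
      conj-α : conj α ≋ ⊖ α
      conj-α = ⟨⟩-≋ (∣⇒≋ (subst (+ ℓ ∣_) (solve 2 (λ x y → # 2 :* x := x :+ y :- # 2 :* y :- (:- (x :+ y))) refl x y) ℓ∣2x))
                    (ℤ/.≋-refl (+ ℓ))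

      -- As ᾱ ≡ -α, θ α = α² ᾱ is -α³ modulo ℓ, and the sign is absorbed by `⊖1^k≋1`.
      θ^k : ∀ {k} → ℓ ≡ suc (3 ℕ.* k) ⊎ suc ℓ ≡ 3 ℕ.* k → θ α ^ᴱ k ≋ α ^ᴱ (3 ℕ.* k)
      θ^k {k} h = begin
        θ α ^ᴱ k  ≈⟨ ≋-^ k (≋-*ˡ α (≋-*ˡ α conj-α)) ⟩
        (α ⊗ (α ⊗ ⊖ α)) ^ᴱ k
          ≡⟨ cong (_^ᴱ k) (trans (cong (α ⊗_) (trans (sym (-‿distribʳ-* α α)) (cong (λ t → ⊖ (α ⊗ t))
              (sym (⊗-identityʳ α))))) (trans (sym (-‿distribʳ-* α _)) (trans (cong ⊖_
                (sym (⊗-identityˡ (α ^ᴱ 3)))) (-‿distribˡ-* 1ᴱ (α ^ᴱ 3))))) ⟩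
        (⊖ 1ᴱ ⊗ α ^ᴱ 3) ^ᴱ k  ≡⟨ ^ᴱ-distrib (⊖ 1ᴱ) (α ^ᴱ 3) k ⟩
        (⊖ 1ᴱ) ^ᴱ k ⊗ (α ^ᴱ 3) ^ᴱ k  ≈⟨ ≋-* (⊖1^k≋1 {ℓ} {k} ℓ-prime h) (≈⇒≋ (^ᴱ-* α 3 k)) ⟩
        1ᴱ ⊗ α ^ᴱ (3 ℕ.* k)  ≡⟨ ⊗-identityˡ _ ⟩
        α ^ᴱ (3 ℕ.* k)  ∎
        where open SetoidReasoning ≋-setoid

      -- Here α^(3k) = α^(ℓ-1) ≡ 1, because Frobenius is the identity modulo ℓ; `law₁` then leaves
      -- X(ℓ) ≡ υ^k, in which the sign of υ does not matter.
      X-ℓ₁ : ∀ {d k} → (± ⟦ d ⟧) υ → ℓ ≡ suc (3 ℕ.* k) → X (+ ℓ) ≡ d ^ᶜ k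
      X-ℓ₁ {d} {k} υ≡ ℓ≡ = ⟦⟧-≋-injective ℓ-prime ℓ≢3 (begin
        ⟦ X (+ ℓ) ⟧  ≡⟨ ⊗-identityˡ ⟦ X (+ ℓ) ⟧ ⟨
        1ᴱ ⊗ ⟦ X (+ ℓ) ⟧  ≈⟨ ≋-*ʳ ⟦ X (+ ℓ) ⟧ θ≋1 ⟨
        θ α ^ᴱ k ⊗ ⟦ X (+ ℓ) ⟧  ≈⟨ law₁ {ℓ} {k} ℓ-prime ℓ∤N ℓ≡ ⟩
        υ ^ᴱ k  ≈⟨ ±^ {d} {k} υ≡ (inj₁ ℓ≡) ⟩
        ⟦ d ^ᶜ k ⟧  ∎)
        where
        open SetoidReasoning ≋-setoid
        θ≋1 : θ α ^ᴱ k ≋ 1ᴱ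
        θ≋1 = ≋-trans (θ^k {k} (inj₁ ℓ≡)) (⊗-cancel-≋ ℓ-prime α ℓ∤N (begin
          α ⊗ α ^ᴱ (3 ℕ.* k)  ≡⟨ cong (α ^ᴱ_) ℓ≡ ⟨
          α ^ᴱ ℓ  ≈⟨ ModPrime.frobenius₁ ℓ-prime {k} ℓ≡ α ⟩
          α  ≡⟨ ⊗-identityʳ α ⟨
          α ⊗ 1ᴱ  ∎))

      -- Here Frobenius is conjugation, so α^(3k) = α α^ℓ ≡ α ᾱ, which cancels the norm in `law₂`.
      -- What remains is the conjugate of the symbol, that is, its square.
      X-ℓ₂ : ∀ {d k} → (± ⟦ d ⟧) υ → suc ℓ ≡ 3 ℕ.* k → X (+ ℓ) • X (+ ℓ) ≡ d ^ᶜ k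
      X-ℓ₂ {d} {k} υ≡ ℓ≡ = ⟦⟧-≋-injective ℓ-prime ℓ≢3 (ι-cancelˡ ℓ-prime {norm α} ℓ∤N (begin
        ι (norm α) ⊗ ⟦ X (+ ℓ) • X (+ ℓ) ⟧  ≡⟨ cong (ι (norm α) ⊗_) (conj-⟦⟧ (X (+ ℓ))) ⟨
        ι (norm α) ⊗ conj ⟦ X (+ ℓ) ⟧  ≈⟨ ≋-*ʳ (conj ⟦ X (+ ℓ) ⟧) θ≋N ⟨
        θ α ^ᴱ k ⊗ conj ⟦ X (+ ℓ) ⟧  ≈⟨ law₂ {ℓ} {k} ℓ-prime ℓ∤N ℓ≡ ⟩
        υ ^ᴱ k ⊗ ι (norm α)  ≈⟨ ≋-*ʳ (ι (norm α)) (±^ {d} {k} υ≡ (inj₂ ℓ≡)) ⟩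
        ⟦ d ^ᶜ k ⟧ ⊗ ι (norm α)  ≡⟨ ⊗-comm ⟦ d ^ᶜ k ⟧ (ι (norm α)) ⟩
        ι (norm α) ⊗ ⟦ d ^ᶜ k ⟧  ∎))
        where
        open SetoidReasoning ≋-setoid
        θ≋N : θ α ^ᴱ k ≋ ι (norm α)
        θ≋N = begin
          θ α ^ᴱ k  ≈⟨ θ^k {k} (inj₂ ℓ≡) ⟩
          α ^ᴱ (3 ℕ.* k)  ≡⟨ cong (α ^ᴱ_) ℓ≡ ⟨
          α ⊗ α ^ᴱ ℓ  ≈⟨ ≋-*ˡ α (ModPrime.frobenius₂ ℓ-prime {k} ℓ≡ α) ⟩
          α ⊗ conj α  ≡⟨ ⊗-conj α ⟩
          ι (norm α)  ∎

      residue-cases : (∃ λ k → ℓ ≡ suc (3 ℕ.* k)) ⊎ (∃ λ k → suc ℓ ≡ 3 ℕ.* k)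
      residue-cases = [ (λ (k , e) → ⊥-elim (ℓ≢3 (sym (prime∣prime prime[3] ℓ-prime (ℕ.divides k
          (trans e (ℕ.*-comm 3 k)))))))
        , [ inj₁ , (λ (k , e) → inj₂ (suc k , trans (cong suc e) (sym (ℕ.*-suc 3 k)))) ]′ ]′ (residue-mod-3 ℓ)

  private
    2m : ℕ
    2m = ℤ.∣ + 2 * x ∣

    instance
      2m≢0 : ℕ.NonZero 2m
      2m≢0 = ℕ.≢-nonZero (λ e → 3∤2x (subst (+ 3 ∣_) (sym (ℤ.∣i∣≡0⇒i≡0 e)) (divides (+ 0) refl)))

    X-determined : (F : ℕ → Cubic) → F 1 ≡ 𝟙 → (∀ m n → F (m ℕ.* n) ≡ F m • F n) →
                   (∀ {ℓ} → Prime ℓ → + ℓ ∣ + 2 * x → X (+ ℓ) ≡ F ℓ) → X (+ 2 * x) ≡ F 2m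
    X-determined F F1 F-* h = trans (X-abs (+ 2 * x)) (multiplicative-≡ (X ∘ +_) F (trans X-1 (sym F1))
      (λ m n → trans (cong X (ℤ.pos-* m n)) (X-* (+ m) (+ n))) F-* 2m (λ pr d → h pr (∣ᵤ⇒∣ d)))

  p∤norm : ¬ (+ p ∣ norm α)
  p∤norm d = p∤N (subst (+ p ∣_) norm-α d)

  module Trivial (3∣y : + 3 ∣ y) where
    -- The ω-coordinate of α is 2y, so α is a rational integer modulo 3.
    υ≡±1 : (± ⟦ 𝟙 ⟧) υ
    υ≡±1 = unit-∣im υ υ-unit (≋0⇒∣ (ℤ/.≋-trans (+ 3) (ℤ/.≋-sym (+ 3) (im-≋ primary)) (∣⇒≋0 (∣.∣n⇒∣m*n (+ 2) 3∣y))))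

    X-p≡𝟙 : X (+ p) ≡ 𝟙
    X-p≡𝟙 = trans X-p (cong₂ _•_ X-2x X-2x)
      where
      X-2x : X (+ 2 * x) ≡ 𝟙
      X-2x = X-determined (λ _ → 𝟙)
          refl (λ _ _ → refl) (λ {ℓ} ℓ-prime ℓ∣2x → [ (λ (k , ℓ≡) → trans (X-ℓ₁ ℓ-prime ℓ∣2x {𝟙} {k} υ≡±1 ℓ≡) (𝟙^ k))
        , (λ (k , ℓ≡) → •-square-injective (X (+ ℓ)) 𝟙 (trans (X-ℓ₂ ℓ-prime ℓ∣2x {𝟙} {k} υ≡±1 ℓ≡) (𝟙^ k)))
            ]′ (residue-cases ℓ-prime ℓ∣2x))

    open 𝔼/ (+ p)
    open SetoidReasoning ≋-setoid

    cubic₁ : ∀ {n} → p ≡ suc (3 ℕ.* n) → θ α ^ᴱ n ≋ ⟦ 𝟙 ⟧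
    cubic₁ {n} p≡ = begin
      θ α ^ᴱ n  ≡⟨ ⊗-identityʳ (θ α ^ᴱ n) ⟨
      θ α ^ᴱ n ⊗ 1ᴱ  ≡⟨ cong (λ c → θ α ^ᴱ n ⊗ ⟦ c ⟧) X-p≡𝟙 ⟨
      θ α ^ᴱ n ⊗ ⟦ X (+ p) ⟧  ≈⟨ law₁ {p} {n} pr p∤norm p≡ ⟩
      υ ^ᴱ n  ≈⟨ ±^ pr {𝟙} {n} υ≡±1 (inj₁ p≡) ⟩
      ⟦ 𝟙 ^ᶜ n ⟧  ≡⟨ cong ⟦_⟧ (𝟙^ n) ⟩
      ⟦ 𝟙 ⟧  ∎

    cubic₂ : ∀ {n} → suc p ≡ 3 ℕ.* n → θ α ^ᴱ n ≋ ⟦ 𝟙 ⟧ ⊗ ι (norm α)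
    cubic₂ {n} p≡ = begin
      θ α ^ᴱ n  ≡⟨ ⊗-identityʳ (θ α ^ᴱ n) ⟨
      θ α ^ᴱ n ⊗ 1ᴱ  ≡⟨ cong (λ c → θ α ^ᴱ n ⊗ conj ⟦ c ⟧) X-p≡𝟙 ⟨
      θ α ^ᴱ n ⊗ conj ⟦ X (+ p) ⟧  ≈⟨ law₂ {p} {n} pr p∤norm p≡ ⟩
      υ ^ᴱ n ⊗ ι (norm α)  ≈⟨ ≋-*ʳ (ι (norm α)) (±^ pr {𝟙} {n} υ≡±1 (inj₂ p≡)) ⟩
      ⟦ 𝟙 ^ᶜ n ⟧ ⊗ ι (norm α)  ≡⟨ cong (λ c → ⟦ c ⟧ ⊗ ι (norm α)) (𝟙^ n) ⟩
      ⟦ 𝟙 ⟧ ⊗ ι (norm α)  ∎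

  module Nontrivial (3∣y-x : + 3 ∣ y - x) (e : ℕ) (p-mod-9 : + p ≋ + (4 ℕ.* e) * (x * x) [ℤ/ + 9 ]) where
    -- With y ≡ x modulo 3, α ≡ 2x (1 + ω) = -2x ω².
    υ≡±ω² : (± ⟦ 𝕨² ⟧) υ
    υ≡±ω² = unit-∣re-im υ υ-unit (≋0⇒∣ (begin
      re υ - im υ  ≈⟨ ≋-+ (re-≋ primary) (≋-neg (im-≋ primary)) ⟨
      (x + y) - + 2 * y  ≡⟨ solve 2 (λ x y → x :+ y :- # 2 :* y := :- (y :- x)) refl x y ⟩
      - (y - x)  ≈⟨ ∣⇒≋0 (∣.∣m⇒∣-m 3∣y-x) ⟩
      + 0  ∎))
      where
      open ℤ/ (+ 3)
      open SetoidReasoning ≋-setoid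

    X-2x : X (+ 2 * x) ≡ Ψ 2m
    X-2x = X-determined Ψ refl Ψ-* (λ {ℓ} ℓ-prime ℓ∣2x → [ (λ (k , ℓ≡) → trans (X-ℓ₁ ℓ-prime ℓ∣2x {𝕨²} {k} υ≡±ω² ℓ≡)
        (sym (trans (cong Ψ ℓ≡) (Ψ-1+3k k))))
        , (λ (k , ℓ≡) → •-square-injective (X (+ ℓ)) (Ψ ℓ) (trans (X-ℓ₂ ℓ-prime ℓ∣2x {𝕨²} {k} υ≡±ω² ℓ≡)
            (sym (trans (cong (λ c → c • c) (Ψ-3k-1 {ℓ} {k} ℓ≡)) (𝕨^-square k))))) ]′ (residue-cases ℓ-prime ℓ∣2x))

    -- Modulo 9, p is e (2x)², while Ψ(2x)² = X(2x)² = X(p). The individual value of X(p) is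
    -- unknown, but this relation lets it cancel from the laws, leaving Ψ(e).
    Ψ-p : Ψ p ≡ Ψ e • X (+ p)
    Ψ-p = begin
      Ψ p  ≡⟨ cong ψ (%9-≋ p (e ℕ.* (2m ℕ.* 2m)) (ℤ/.≋-trans (+ 9) p-mod-9 (ℤ/.≈⇒≋ (+ 9) same))) ⟩
      Ψ (e ℕ.* (2m ℕ.* 2m))  ≡⟨ Ψ-* e (2m ℕ.* 2m) ⟩
      Ψ e • Ψ (2m ℕ.* 2m)  ≡⟨ cong (Ψ e •_) (trans (Ψ-* 2m 2m) (trans (cong₂ _•_ (sym X-2x) (sym X-2x)) (sym X-p))) ⟩
      Ψ e • X (+ p)  ∎
      where
      open ≡.≡-Reasoning
      same : + (4 ℕ.* e) * (x * x) ≡ + (e ℕ.* (2m ℕ.* 2m))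
      same = trans (cong (_* (x * x)) (ℤ.pos-* 4 e)) (trans
        (solve 2 (λ e x → # 4 :* e :* (x :* x) := e :* ((# 2 :* x) :* (# 2 :* x))) refl (+ e) x)
        (trans (cong (+ e *_) (square (+ 2 * x))) (sym (ℤ.pos-* e (2m ℕ.* 2m)))))

    open 𝔼/ (+ p)
    open SetoidReasoning ≋-setoid

    private
      X-p-unit : Ψ p ≢ 𝟘 → norm ⟦ X (+ p) ⟧ ≡ + 1
      X-p-unit Ψp≢0 = unit (X (+ p)) (λ X≡0 → Ψp≢0 (trans Ψ-p (trans (cong (Ψ e •_) X≡0) (•-comm (Ψ e) 𝟘))))
        where
        unit : ∀ c → c ≢ 𝟘 → norm ⟦ c ⟧ ≡ + 1
        unit 𝟘 h = ⊥-elim (h refl)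
        unit 𝟙 _ = refl
        unit 𝕨 _ = refl
        unit 𝕨² _ = refl

    cubic₁ : ∀ {n} → Ψ e ≡ 𝕨² → p ≡ suc (3 ℕ.* n) → θ α ^ᴱ n ≋ ⟦ 𝕨² ⟧
    cubic₁ {n} Ψe p≡ = ⊗-cancel-≋ pr ⟦ X (+ p) ⟧ p∤ (begin
      ⟦ X (+ p) ⟧ ⊗ θ α ^ᴱ n  ≡⟨ ⊗-comm ⟦ X (+ p) ⟧ (θ α ^ᴱ n) ⟩
      θ α ^ᴱ n ⊗ ⟦ X (+ p) ⟧  ≈⟨ law₁ {p} {n} pr p∤norm p≡ ⟩
      υ ^ᴱ n  ≈⟨ ±^ pr {𝕨²} {n} υ≡±ω² (inj₁ p≡) ⟩
      ⟦ 𝕨² ^ᶜ n ⟧  ≡⟨ cong ⟦_⟧ (trans (sym Ψp) (trans Ψ-p (trans (cong (_• X (+ p)) Ψe) (•-comm 𝕨² (X (+ p)))))) ⟩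
      ⟦ X (+ p) • 𝕨² ⟧  ≡⟨ ⟦⟧-• (X (+ p)) 𝕨² ⟩
      ⟦ X (+ p) ⟧ ⊗ ⟦ 𝕨² ⟧  ∎)
      where
      Ψp : Ψ p ≡ 𝕨² ^ᶜ n
      Ψp = trans (cong Ψ p≡) (Ψ-1+3k n)
      Ψp≢𝟘 : Ψ p ≢ 𝟘
      Ψp≢𝟘 h = 𝕨^≢𝟘 n (•-square-injective (𝕨 ^ᶜ n) 𝟘 (trans (𝕨^-square n) (trans (sym Ψp) h)))
      p∤ : ¬ (+ p ∣ norm ⟦ X (+ p) ⟧)
      p∤ d = ModPrime.p∤1 pr (subst (+ p ∣_) (X-p-unit Ψp≢𝟘) d)

    -- Since Ψ(p) = ωⁿ here, υⁿ = ω²ⁿ up to sign is Ψ(p)² = Ψ(e)² X(p)², and X(p)² is the conjugate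
    -- symbol occurring in `law₂`.
    cubic₂ : ∀ {n} → Ψ e ≡ 𝕨 → suc p ≡ 3 ℕ.* n → θ α ^ᴱ n ≋ ⟦ 𝕨² ⟧ ⊗ ι (norm α)
    cubic₂ {n} Ψe p≡ = ⊗-cancel-≋ pr (conj ⟦ X (+ p) ⟧) p∤ (begin
      conj ⟦ X (+ p) ⟧ ⊗ θ α ^ᴱ n  ≡⟨ ⊗-comm (conj ⟦ X (+ p) ⟧) (θ α ^ᴱ n) ⟩
      θ α ^ᴱ n ⊗ conj ⟦ X (+ p) ⟧  ≈⟨ law₂ {p} {n} pr p∤norm p≡ ⟩
      υ ^ᴱ n ⊗ ι (norm α)  ≈⟨ ≋-*ʳ (ι (norm α)) (±^ pr {𝕨²} {n} υ≡±ω² (inj₂ p≡)) ⟩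
      ⟦ 𝕨² ^ᶜ n ⟧ ⊗ ι (norm α)
        ≡⟨ cong (_⊗ ι (norm α)) (cong ⟦_⟧ (trans (sym (𝕨^-square n)) (trans (cong (λ c → c • c) 𝕨^n) (regroup (X (+ p)))))) ⟩
      ⟦ (X (+ p) • X (+ p)) • 𝕨² ⟧ ⊗ ι (norm α)
        ≡⟨ cong (_⊗ ι (norm α)) (trans (⟦⟧-• (X (+ p) • X (+ p)) 𝕨²) (cong (_⊗ ⟦ 𝕨² ⟧) (sym (conj-⟦⟧ (X (+ p)))))) ⟩
      conj ⟦ X (+ p) ⟧ ⊗ ⟦ 𝕨² ⟧ ⊗ ι (norm α)  ≡⟨ ⊗-assoc (conj ⟦ X (+ p) ⟧) ⟦ 𝕨² ⟧ (ι (norm α)) ⟩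
      conj ⟦ X (+ p) ⟧ ⊗ (⟦ 𝕨² ⟧ ⊗ ι (norm α))  ∎)
      where
      Ψp : Ψ p ≡ 𝕨 ^ᶜ n
      Ψp = Ψ-3k-1 {p} {n} p≡
      𝕨^n : 𝕨 ^ᶜ n ≡ 𝕨 • X (+ p)
      𝕨^n = trans (sym Ψp) (trans Ψ-p (cong (_• X (+ p)) Ψe))
      regroup : ∀ c → (𝕨 • c) • (𝕨 • c) ≡ (c • c) • 𝕨²
      regroup c = trans (•-interchange 𝕨 c 𝕨 c) (•-comm 𝕨² (c • c))
      p∤ : ¬ (+ p ∣ norm (conj ⟦ X (+ p) ⟧))
      p∤ d = ModPrime.p∤1 pr (subst (+ p ∣_) (trans (norm-conj ⟦ X (+ p) ⟧) (X-p-unit (λ h → 𝕨^≢𝟘 n (trans (sym Ψp) h)))) d)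

-- Fibonacci numbers from powers of α

fib : ℕ → ℤ
fib 0 = + 0
fib 1 = + 1
fib (suc (suc n)) = fib (suc n) + fib n

module Lucas {m : ℤ} {a d : 𝔼} (quadratic : a ⊗ a ≋ d ⊗ a ⊕ d ⊗ d [𝔼/ m ]) where
  open 𝔼/ m
  open SetoidReasoning ≋-setoid

  -- The quotient z = a / d satisfies z² = z + 1, whence z^(k+1) = F₍ₖ₊₁₎ z + Fₖ. Clearing
  -- denominators avoids inverting d.
  power : ∀ k → a ^ᴱ suc k ≋ ι (fib (suc k)) ⊗ d ^ᴱ k ⊗ a ⊕ ι (fib k) ⊗ d ^ᴱ suc k
  power zero = ≈⇒≋ (trans (⊗-identityʳ a) (sym (trans (cong₂ _⊕_ (trans
      (cong (_⊗ a) (⊗-identityˡ 1ᴱ)) (⊗-identityˡ a)) (⊗-zeroˡ (d ^ᴱ 1))) (⊕-identityʳ a))))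
  power (suc k) = begin
    a ⊗ a ^ᴱ suc k
      ≈⟨ ≋-*ˡ a (power k) ⟩
    a ⊗ (F ⊗ D ⊗ a ⊕ G ⊗ (d ⊗ D))
      ≡⟨ solveᴱ 5 (λ a F D G d → a :⋆ (F :⋆ D :⋆ a :⊹ G :⋆ (d :⋆ D)) :≡ F :⋆ D :⋆ (a :⋆ a) :⊹ G :⋆ (d :⋆ D) :⋆ a)
          refl a F D G d ⟩
    F ⊗ D ⊗ (a ⊗ a) ⊕ G ⊗ (d ⊗ D) ⊗ a
      ≈⟨ ≋-+ (≋-*ˡ (F ⊗ D) quadratic) ≋-refl ⟩
    F ⊗ D ⊗ (d ⊗ a ⊕ d ⊗ d) ⊕ G ⊗ (d ⊗ D) ⊗ a
      ≡⟨ solveᴱ 5 (λ a F D G d → F :⋆ D :⋆ (d :⋆ a :⊹ d :⋆ d) :⊹ G :⋆ (d :⋆ D) :⋆ a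
          :≡ (F :⊹ G) :⋆ (d :⋆ D) :⋆ a :⊹ F :⋆ (d :⋆ (d :⋆ D))) refl a F D G d ⟩
    (F ⊕ G) ⊗ (d ⊗ D) ⊗ a ⊕ F ⊗ (d ⊗ (d ⊗ D)) ∎
    where
    F = ι (fib (suc k))
    G = ι (fib k)
    D = d ^ᴱ k

double-power : ∀ x k → x ^ᴱ (2 ℕ.* k) ≡ (x ⊗ x) ^ᴱ k
double-power x k = trans (sym (^ᴱ-* x 2 k)) (cong (λ t → (x ⊗ t) ^ᴱ k) (⊗-identityʳ x))

module _ {p : ℕ} (pr : Prime p) (α : 𝔼) (p∤N : ¬ (+ p ∣ norm α)) where
  open 𝔼/ (+ p)
  open SetoidReasoning ≋-setoid

  private
    Nᴱ : 𝔼
    Nᴱ = ι (norm α)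

    θ-power : ∀ k → θ α ^ᴱ k ≡ α ^ᴱ k ⊗ Nᴱ ^ᴱ k
    θ-power k = trans (cong (λ t → (α ⊗ t) ^ᴱ k) (⊗-conj α)) (^ᴱ-distrib α Nᴱ k)

    squared : ∀ k → (α ^ᴱ k ⊗ Nᴱ ^ᴱ k) ⊗ (α ^ᴱ k ⊗ Nᴱ ^ᴱ k) ⊗ Nᴱ ^ᴱ k ≡ (α ⊗ α) ^ᴱ k ⊗ Nᴱ ^ᴱ (3 ℕ.* k)
    squared k = trans (solveᴱ 2 (λ A B → (A :⋆ B) :⋆ (A :⋆ B) :⋆ B :≡ (A :⋆ A) :⋆ (B :⋆ (B :⋆ B))) refl (α ^ᴱ k) (Nᴱ ^ᴱ k))
      (cong₂ _⊗_ (sym (^ᴱ-distrib α α k)) (trans (cong (λ t → Nᴱ ^ᴱ k ⊗ (Nᴱ ^ᴱ k ⊗ t)) (sym (⊗-identityʳ (Nᴱ ^ᴱ k))))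
        (trans (^ᴱ-* Nᴱ k 3) (cong (Nᴱ ^ᴱ_) (ℕ.*-comm k 3)))))

  p∤N^k : ∀ k → ¬ (+ p ∣ norm α ^ᶻ k)
  p∤N^k zero d = ModPrime.p∤1 pr d
  p∤N^k (suc k) d = [ p∤N , p∤N^k k ]′ (euclidℤ pr (norm α) (norm α ^ᶻ k) d)

  -- As θ α = N α, the square of (θ α)ⁿ times Nⁿ is α²ⁿ N³ⁿ, and N³ⁿ = N^(p-1) ≡ 1. In `α^2n₂` the
  -- same product contains N^(p+1) ≡ N² instead.
  α^2n₁ : ∀ {n c} → p ≡ suc (3 ℕ.* n) → θ α ^ᴱ n ≋ ⟦ c ⟧ → (α ⊗ α) ^ᴱ n ≋ ⟦ c • c ⟧ ⊗ Nᴱ ^ᴱ n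
  α^2n₁ {n} {c} p≡ h = begin
    (α ⊗ α) ^ᴱ n  ≡⟨ ⊗-identityʳ _ ⟨
    (α ⊗ α) ^ᴱ n ⊗ 1ᴱ
      ≈⟨ ≋-*ˡ ((α ⊗ α) ^ᴱ n) (≋-trans (≈⇒≋ (sym (ι-^ (norm α) (3 ℕ.* n)))) (ι-≋ (ModPrime.fermat′ pr p≡ p∤N))) ⟨
    (α ⊗ α) ^ᴱ n ⊗ Nᴱ ^ᴱ (3 ℕ.* n)  ≡⟨ squared n ⟨
    (α ^ᴱ n ⊗ Nᴱ ^ᴱ n) ⊗ (α ^ᴱ n ⊗ Nᴱ ^ᴱ n) ⊗ Nᴱ ^ᴱ n
                                          ≡⟨ cong (λ t → t ⊗ t ⊗ Nᴱ ^ᴱ n) (θ-power n) ⟨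
    θ α ^ᴱ n ⊗ θ α ^ᴱ n ⊗ Nᴱ ^ᴱ n  ≈⟨ ≋-*ʳ (Nᴱ ^ᴱ n) (≋-* h h) ⟩
    ⟦ c ⟧ ⊗ ⟦ c ⟧ ⊗ Nᴱ ^ᴱ n  ≡⟨ cong (_⊗ Nᴱ ^ᴱ n) (⟦⟧-• c c) ⟨
    ⟦ c • c ⟧ ⊗ Nᴱ ^ᴱ n  ∎

  α^2n₂ : ∀ {n c} → suc p ≡ 3 ℕ.* n → θ α ^ᴱ n ≋ ⟦ c ⟧ ⊗ Nᴱ → (α ⊗ α) ^ᴱ n ≋ ⟦ c • c ⟧ ⊗ Nᴱ ^ᴱ n
  α^2n₂ {n} {c} p≡ h = ι-cancelˡ pr {norm α} p∤N (ι-cancelˡ pr {norm α} p∤N (begin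
    Nᴱ ⊗ (Nᴱ ⊗ (α ⊗ α) ^ᴱ n)  ≡⟨ solveᴱ 2 (λ A B → B :⋆ (B :⋆ A) :≡ A :⋆ (B :⋆ B)) refl ((α ⊗ α) ^ᴱ n) Nᴱ ⟩
    (α ⊗ α) ^ᴱ n ⊗ (Nᴱ ⊗ Nᴱ)
      ≈⟨ ≋-*ˡ ((α ⊗ α) ^ᴱ n) (≋-*ˡ Nᴱ (≋-trans (≈⇒≋ (sym (ι-^ (norm α) p))) (ι-≋ (ModPrime.fermat pr (norm α))))) ⟨
    (α ⊗ α) ^ᴱ n ⊗ Nᴱ ^ᴱ suc p  ≡⟨ cong (λ t → (α ⊗ α) ^ᴱ n ⊗ Nᴱ ^ᴱ t) p≡ ⟩
    (α ⊗ α) ^ᴱ n ⊗ Nᴱ ^ᴱ (3 ℕ.* n)  ≡⟨ squared n ⟨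
    (α ^ᴱ n ⊗ Nᴱ ^ᴱ n) ⊗ (α ^ᴱ n ⊗ Nᴱ ^ᴱ n) ⊗ Nᴱ ^ᴱ n
                                          ≡⟨ cong (λ t → t ⊗ t ⊗ Nᴱ ^ᴱ n) (θ-power n) ⟨
    θ α ^ᴱ n ⊗ θ α ^ᴱ n ⊗ Nᴱ ^ᴱ n  ≈⟨ ≋-*ʳ (Nᴱ ^ᴱ n) (≋-* h h) ⟩
    (⟦ c ⟧ ⊗ Nᴱ) ⊗ (⟦ c ⟧ ⊗ Nᴱ) ⊗ Nᴱ ^ᴱ n
      ≡⟨ solveᴱ 3 (λ A B C → (A :⋆ B) :⋆ (A :⋆ B) :⋆ C :≡ B :⋆ (B :⋆ (A :⋆ A :⋆ C))) refl ⟦ c ⟧ Nᴱ (Nᴱ ^ᴱ n) ⟩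
    Nᴱ ⊗ (Nᴱ ⊗ (⟦ c ⟧ ⊗ ⟦ c ⟧ ⊗ Nᴱ ^ᴱ n)) ≡⟨ cong (λ t → Nᴱ ⊗ (Nᴱ ⊗ (t ⊗ Nᴱ ^ᴱ n))) (⟦⟧-• c c) ⟨
    Nᴱ ⊗ (Nᴱ ⊗ (⟦ c • c ⟧ ⊗ Nᴱ ^ᴱ n))  ∎))

  -- This compares two expressions for α^(2n+1), one from the cubic symbol and one from
  -- `Lucas.power`; their common factor Nⁿ is cancelled.
  fib-relation₁ : ∀ {n c d} → p ≡ suc (3 ℕ.* n) → θ α ^ᴱ n ≋ ⟦ c ⟧ →
                  α ⊗ α ≋ d ⊗ α ⊕ d ⊗ d → d ⊗ d ≋ Nᴱ →
                  ⟦ c • c ⟧ ⊗ α ≋ ι (fib (suc (2 ℕ.* n))) ⊗ α ⊕ ι (fib (2 ℕ.* n)) ⊗ d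
  fib-relation₁ {n} {c} {d} p≡ h quad d² = ι-cancelˡ pr {norm α ^ᶻ n} (p∤N^k n) (begin
    ι (norm α ^ᶻ n) ⊗ (⟦ c • c ⟧ ⊗ α)  ≡⟨ cong (_⊗ (⟦ c • c ⟧ ⊗ α)) (ι-^ (norm α) n) ⟩
    Nᴱ ^ᴱ n ⊗ (⟦ c • c ⟧ ⊗ α)  ≡⟨ solveᴱ 3 (λ A B C → A :⋆ (B :⋆ C) :≡ C :⋆ (B :⋆ A)) refl (Nᴱ ^ᴱ n) ⟦ c • c ⟧ α ⟩
    α ⊗ (⟦ c • c ⟧ ⊗ Nᴱ ^ᴱ n)  ≈⟨ ≋-*ˡ α (α^2n₁ {n} {c} p≡ h) ⟨
    α ⊗ (α ⊗ α) ^ᴱ n  ≡⟨ cong (α ⊗_) (double-power α n) ⟨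
    α ^ᴱ suc (2 ℕ.* n)  ≈⟨ Lucas.power quad (2 ℕ.* n) ⟩
    F ⊗ d ^ᴱ (2 ℕ.* n) ⊗ α ⊕ G ⊗ (d ⊗ d ^ᴱ (2 ℕ.* n))
                                            ≈⟨ ≋-+ (≋-*ʳ α (≋-*ˡ F d^2n)) (≋-*ˡ G (≋-*ˡ d d^2n)) ⟩
    F ⊗ Nᴱ ^ᴱ n ⊗ α ⊕ G ⊗ (d ⊗ Nᴱ ^ᴱ n)
      ≡⟨ solveᴱ 5 (λ F A G d M → F :⋆ M :⋆ A :⊹ G :⋆ (d :⋆ M) :≡ M :⋆ (F :⋆ A :⊹ G :⋆ d)) refl F α G d (Nᴱ ^ᴱ n) ⟩
    Nᴱ ^ᴱ n ⊗ (F ⊗ α ⊕ G ⊗ d)  ≡⟨ cong (_⊗ (F ⊗ α ⊕ G ⊗ d)) (ι-^ (norm α) n) ⟨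
    ι (norm α ^ᶻ n) ⊗ (F ⊗ α ⊕ G ⊗ d)  ∎)
    where
    F = ι (fib (suc (2 ℕ.* n)))
    G = ι (fib (2 ℕ.* n))
    d^2n : d ^ᴱ (2 ℕ.* n) ≋ Nᴱ ^ᴱ n
    d^2n = ≋-trans (≈⇒≋ (double-power d n)) (≋-^ n d²)

  -- With n + 1 = (p + 1)/3 the known power is α^(2n+2), where F of index 2n + 1 is the coefficient
  -- of d. An additional factor d turns the Fibonacci side into a multiple of d^(2n+2) ≡ N^(n+1),
  -- which is then cancelled.
  fib-relation₂ : ∀ {n c d} → suc p ≡ 3 ℕ.* suc n → θ α ^ᴱ suc n ≋ ⟦ c ⟧ ⊗ Nᴱ →
                  α ⊗ α ≋ d ⊗ α ⊕ d ⊗ d → (d ⊗ d) ^ᴱ suc n ≋ Nᴱ ^ᴱ suc n →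
                  ⟦ c • c ⟧ ⊗ d ≋ ι (fib (suc (suc (2 ℕ.* n)))) ⊗ α ⊕ ι (fib (suc (2 ℕ.* n))) ⊗ d
  fib-relation₂ {n} {c} {d} p≡ h quad d² = ι-cancelˡ pr {norm α ^ᶻ suc n} (p∤N^k (suc n)) (begin
    ι (norm α ^ᶻ suc n) ⊗ (⟦ c • c ⟧ ⊗ d)  ≡⟨ cong (_⊗ (⟦ c • c ⟧ ⊗ d)) (ι-^ (norm α) (suc n)) ⟩
    M ⊗ (⟦ c • c ⟧ ⊗ d)  ≡⟨ solveᴱ 3 (λ A B C → A :⋆ (B :⋆ C) :≡ C :⋆ (B :⋆ A)) refl M ⟦ c • c ⟧ d ⟩
    d ⊗ (⟦ c • c ⟧ ⊗ M)  ≈⟨ ≋-*ˡ d (α^2n₂ {suc n} {c} p≡ h) ⟨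
    d ⊗ (α ⊗ α) ^ᴱ suc n  ≡⟨ cong (d ⊗_) (trans (sym (double-power α (suc n))) (cong (α ^ᴱ_) (ℕ.*-suc 2 n))) ⟩
    d ⊗ α ^ᴱ suc (suc (2 ℕ.* n))  ≈⟨ ≋-*ˡ d (Lucas.power quad (suc (2 ℕ.* n))) ⟩
    d ⊗ (F ⊗ d ^ᴱ suc (2 ℕ.* n) ⊗ α ⊕ G ⊗ (d ⊗ d ^ᴱ suc (2 ℕ.* n)))
                                              ≡⟨ solveᴱ 5 (λ F A G d E → d :⋆ (F :⋆ E :⋆ A :⊹ G :⋆ (d :⋆ E))
                                                  :≡ (d :⋆ E) :⋆ (F :⋆ A :⊹ G :⋆ d)) refl F α G d (d ^ᴱ suc (2 ℕ.* n)) ⟩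
    d ^ᴱ suc (suc (2 ℕ.* n)) ⊗ (F ⊗ α ⊕ G ⊗ d) ≈⟨ ≋-*ʳ (F ⊗ α ⊕ G ⊗ d) d^2n ⟩
    M ⊗ (F ⊗ α ⊕ G ⊗ d)  ≡⟨ cong (_⊗ (F ⊗ α ⊕ G ⊗ d)) (ι-^ (norm α) (suc n)) ⟨
    ι (norm α ^ᶻ suc n) ⊗ (F ⊗ α ⊕ G ⊗ d)  ∎)
    where
    M = Nᴱ ^ᴱ suc n
    F = ι (fib (suc (suc (2 ℕ.* n))))
    G = ι (fib (suc (2 ℕ.* n)))
    d^2n : d ^ᴱ suc (suc (2 ℕ.* n)) ≋ M
    d^2n = ≋-trans (≈⇒≋ (trans (cong (d ^ᴱ_) (sym (ℕ.*-suc 2 n))) (double-power d (suc n)))) d²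

-- The two quadratic forms

module DiagonalForm {p : ℕ} (pr : Prime p) {A B x y : ℤ} (p∤A : ¬ (+ p ∣ A)) (p∤B : ¬ (+ p ∣ B))
  (p≡ : + p ≡ A * (x * x) + B * (y * y)) where

  private
    -- Otherwise p² would divide p.
    not-both : + p ∣ x → + p ∣ y → ⊥
    not-both (divides a x≡) (divides b y≡) = ModPrime.p∤1 pr (divides (A * (a * a) + B * (b * b)) (ℤ.*-cancelˡ-≡ (+ p) (+ 1) _ {{pos}} (begin
      + p * + 1  ≡⟨ ℤ.*-identityʳ (+ p) ⟩
      + p  ≡⟨ p≡ ⟩
      A * (x * x) + B * (y * y)  ≡⟨ cong₂ (λ x y → A * (x * x) + B * (y * y)) x≡ y≡ ⟩
      A * ((a * + p) * (a * + p)) + B * ((b * + p) * (b * + p))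
        ≡⟨ solve 5 (λ A B a b p → A :* ((a :* p) :* (a :* p)) :+ B :* ((b :* p) :* (b :* p))
            := p :* ((A :* (a :* a) :+ B :* (b :* b)) :* p)) refl A B a b (+ p) ⟩
      + p * ((A * (a * a) + B * (b * b)) * + p)  ∎)))
      where
      open ≡.≡-Reasoning
      pos : ℤ.NonZero (+ p)
      pos = prime⇒nonZero pr

    square-divisor : ∀ z → + p ∣ z * z → + p ∣ z
    square-divisor z d = [ (λ h → h) , (λ h → h) ]′ (euclidℤ pr z z d)

    p∣form : + p ∣ A * (x * x) + B * (y * y)
    p∣form = subst (+ p ∣_) p≡ ∣.∣-refl

  p∤x : ¬ (+ p ∣ x)
  p∤x d = not-both d ([ ⊥-elim ∘ p∤B , square-divisor y ]′ (euclidℤ pr B (y * y)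
    (∣.∣m+n∣m⇒∣n p∣form (∣.∣n⇒∣m*n A (∣.∣m⇒∣m*n x d)))))

  p∤y : ¬ (+ p ∣ y)
  p∤y d = not-both ([ ⊥-elim ∘ p∤A , square-divisor x ]′ (euclidℤ pr A (x * x)
    (∣.∣m+n∣n⇒∣m p∣form (∣.∣n⇒∣m*n B (∣.∣m⇒∣m*n y d))))) d

large∤ : ∀ {p m} → m ℕ.< p → .{{_ : ℕ.NonZero m}} → ¬ (+ p ∣ + m)
large∤ m<p d = ℕ.<⇒≱ m<p (ℕ.∣⇒≤ (∣⇒∣ᵤ d))

prime∤* : ∀ {p} → Prime p → ∀ {a b} → ¬ (+ p ∣ a) → ¬ (+ p ∣ b) → ¬ (+ p ∣ a * b)
prime∤* pr {a} {b} p∤a p∤b d = [ p∤a , p∤b ]′ (euclidℤ pr a b d)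

3∤prime : ∀ {p} → Prime p → 5 ℕ.< p → ¬ (+ 3 ∣ + p)
3∤prime pr 5<p d = ℕ.<⇒≢ (ℕ.≤-trans (s≤s (s≤s (s≤s (s≤s z≤n)))) 5<p) (prime∣prime prime[3] pr (∣⇒∣ᵤ d))

3∣-split : ∀ {x y} → + 3 ∣ y - x → ∃ λ z → y ≡ x + + 3 * z
3∣-split {x} {y} (divides z e) = z , trans (solve 2 (λ x y → y := x :+ (y :- x)) refl x y) (cong (_+_ x)
    (trans e (ℤ.*-comm z (+ 3))))

module FormX²+15Y² {p : ℕ} (pr : Prime p) (5<p : 5 ℕ.< p) (x y : ℤ) (p≡ : + p ≡ x * x + + 15 * (y * y))
  {n : ℕ} (p≡1+3n : p ≡ suc (3 ℕ.* n)) where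

  private
    2<p : 2 ℕ.< p
    2<p = ℕ.≤-trans (s≤s (s≤s (s≤s z≤n))) 5<p
    3<p : 3 ℕ.< p
    3<p = ℕ.≤-trans (s≤s (s≤s (s≤s (s≤s z≤n)))) 5<p

    module Form = DiagonalForm pr {+ 1} {+ 15} {x} {y} (ModPrime.p∤1 pr) (prime∤* pr {+ 3} {+ 5} (large∤ 3<p) (large∤ 5<p))
      (trans p≡ (cong (_+ + 15 * (y * y)) (sym (ℤ.*-identityˡ (x * x)))))

    p∤2x : ¬ (+ p ∣ + 2 * x)
    p∤2x = prime∤* pr (large∤ 2<p) Form.p∤x

    3∤x : ¬ (+ 3 ∣ x)
    3∤x d = 3∤prime pr 5<p (subst (+ 3 ∣_) (sym p≡) (∣.∣m∣n⇒∣m+n (∣.∣m⇒∣m*n x d) (∣.∣m⇒∣m*n (y * y) (divides (+ 5) refl))))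

    module Symbol = CubicSymbol pr x y (+ 5) -[1+ 0 ] (inj₂ refl)
      (trans p≡ (solve 2 (λ x y → x :* x :+ # 15 :* (y :* y)
        := # 5 :* (x :* x :+ # 3 :* (y :* y)) :+ con -[1+ 0 ] :* ((# 2 :* x) :* (# 2 :* x))) refl x y))
      p∤2x 3∤x
    open Symbol using (α; p∤norm)

    f g : ℤ
    f = fib (suc (2 ℕ.* n))
    g = fib (2 ℕ.* n)

    -- d = 2y √−3, chosen so that α / d is a golden ratio modulo p.
    d : 𝔼
    d = ⟨ + 2 * y , + 4 * y ⟩

    module _ where
      open 𝔼/ (+ p)

      :α : ∀ {m} → Polynomial m → Polynomial m → 𝔼[ m ]
      :α x y = x :+ y , # 2 :* y
      :d : ∀ {m} → Polynomial m → 𝔼[ m ]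
      :d y = # 2 :* y , # 4 :* y
      :p : ∀ {m} → Polynomial m → Polynomial m → Polynomial m
      :p x y = x :* x :+ # 15 :* (y :* y)

      -- Since α - d = ᾱ, the difference α² - d α - d² is N + 12y² = p.
      quadratic : α ⊗ α ≋ d ⊗ α ⊕ d ⊗ d
      quadratic = by 1ᴱ (trans (cong₂ ⟨_,_⟩
          (solve 2 (λ x y → :re (:α x y :⊗ :α x y) := :re (:d y :⊗ :α x y :⊕ :d y :⊗ :d y :⊕ :ι (:p x y) :⊗ :ι (# 1)))
            refl x y)
          (solve 2 (λ x y → :im (:α x y :⊗ :α x y) := :im (:d y :⊗ :α x y :⊕ :d y :⊗ :d y :⊕ :ι (:p x y) :⊗ :ι (# 1)))
            refl x y))
        (cong (λ t → d ⊗ α ⊕ d ⊗ d ⊕ ι t ⊗ 1ᴱ) (sym p≡)))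

      d² : d ⊗ d ≋ ι (norm α)
      d² = by (ι -[1+ 0 ]) (trans (cong₂ ⟨_,_⟩
          (solve 2 (λ x y → :re (:d y :⊗ :d y) := :re (:ι (:norm (:α x y)) :⊕ :ι (:p x y) :⊗ :ι (con -[1+ 0 ]))) refl x y)
          (solve 2 (λ x y → :im (:d y :⊗ :d y) := :im (:ι (:norm (:α x y)) :⊕ :ι (:p x y) :⊗ :ι (con -[1+ 0 ]))) refl x y))
        (cong (λ t → ι (norm α) ⊕ ι t ⊗ ι -[1+ 0 ]) (sym p≡)))

    open ℤ/ (+ p)
    open SetoidReasoning ≋-setoid

    -- The functional 2 re − im kills d, so it isolates the Fibonacci number of odd index.
    isolate : ∀ {z} → z ≋ ι f ⊗ α ⊕ ι g ⊗ d [𝔼/ + p ] → + 2 * re z - im z ≋ + 2 * x * f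
    isolate {z} h = begin
      + 2 * re z - im z  ≈⟨ ≋-+ (≋-*ˡ (+ 2) (re-≋ h)) (≋-neg (im-≋ h)) ⟩
      + 2 * re (ι f ⊗ α ⊕ ι g ⊗ d) - im (ι f ⊗ α ⊕ ι g ⊗ d)
        ≡⟨ solve 4 (λ f g x y → # 2 :* :re (:rhs f g x y) :- :im (:rhs f g x y) := # 2 :* x :* f) refl f g x y ⟩
      + 2 * x * f  ∎
      where
      :rhs : ∀ {m} → Polynomial m → Polynomial m → Polynomial m → Polynomial m → 𝔼[ m ]
      :rhs f g x y = :ι f :⊗ :α x y :⊕ :ι g :⊗ :d y

  p∤10y : ¬ (+ p ∣ + 10 * y)
  p∤10y = prime∤* pr (prime∤* pr {+ 2} {+ 5} (large∤ 2<p) (large∤ 5<p)) Form.p∤y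

  fib-trivial : + 3 ∣ y → fib (suc (2 ℕ.* n)) ≋ + 1
  fib-trivial 3∣y = ModPrime.cancelˡ pr p∤2x (begin
    + 2 * x * f
      ≈⟨ isolate (fib-relation₁ pr α p∤norm {n} {𝟙} {d} p≡1+3n (Symbol.Trivial.cubic₁ 3∣y {n} p≡1+3n) quadratic d²) ⟨
    + 2 * re (1ᴱ ⊗ α) - im (1ᴱ ⊗ α)  ≡⟨ cong (λ z → + 2 * re z - im z) (⊗-identityˡ α) ⟩
    + 2 * (x + y) - + 2 * y  ≡⟨ solve 2 (λ x y → # 2 :* (x :+ y) :- # 2 :* y := # 2 :* x :* # 1) refl x y ⟩
    + 2 * x * + 1  ∎)

  fib-nontrivial : + 3 ∣ y - x → + 10 * y * fib (suc (2 ℕ.* n)) ≋ x - + 5 * y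
  fib-nontrivial 3∣y-x = ModPrime.cancelˡ pr p∤2x (begin
    + 2 * x * (+ 10 * y * f)
      ≡⟨ solve 3 (λ x y f → # 2 :* x :* (# 10 :* y :* f) := # 10 :* y :* (# 2 :* x :* f)) refl x y f ⟩
    + 10 * y * (+ 2 * x * f)  ≈⟨ ≋-*ˡ (+ 10 * y) (isolate (fib-relation₁ pr α p∤norm {n} {𝕨²} {d} p≡1+3n
                                                    (Symbol.Nontrivial.cubic₁ 3∣y-x 4 p-mod-9 {n}
                                                      refl p≡1+3n) quadratic d²)) ⟨
    -- The square of ω² is ω, and `isolate` yields F ≡ -(x + 3y)/(2x). The identity -10y (x + 3y) =
    -- 2x (x - 5y) - 2p changes the denominator to 10y.
    + 10 * y * (+ 2 * re (ωᴱ ⊗ α) - im (ωᴱ ⊗ α))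
      ≡⟨ solve 2 (λ x y → # 10 :* y :* (# 2 :* :re ((# 0 , # 1) :⊗ :α x y) :- :im ((# 0 , # 1) :⊗ :α x y))
           := # 2 :* x :* (x :- # 5 :* y) :+ (x :* x :+ # 15 :* (y :* y)) :* con -[1+ 1 ]) refl x y ⟩
    + 2 * x * (x - + 5 * y) + (x * x + + 15 * (y * y)) * -[1+ 1 ]
      ≡⟨ cong (λ t → + 2 * x * (x - + 5 * y) + t * -[1+ 1 ]) p≡ ⟨
    + 2 * x * (x - + 5 * y) + + p * -[1+ 1 ]  ≈⟨ by -[1+ 1 ] refl ⟩
    + 2 * x * (x - + 5 * y)  ∎)
    where
    -- With y = x + 3z, 15y² ≡ 15x² modulo 9, so p ≡ 16x² = 4e x² for e = 4, and Ψ(4) = ω².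
    p-mod-9 : + p ≋ + 16 * (x * x) [ℤ/ + 9 ]
    p-mod-9 = ℤ/.by (+ 10 * (x * z) + + 15 * (z * z)) (trans p≡ (trans
        (cong (λ y → x * x + + 15 * (y * y)) (proj₂ (3∣-split {x} {y} 3∣y-x)))
      (solve 2 (λ x z → x :* x :+ # 15 :* ((x :+ # 3 :* z) :* (x :+ # 3 :* z))
        := # 16 :* (x :* x) :+ # 9 :* (# 10 :* (x :* z) :+ # 15 :* (z :* z))) refl x z)))
      where z = proj₁ (3∣-split {x} {y} 3∣y-x)

module Form5X²+3Y² {p : ℕ} (pr : Prime p) (5<p : 5 ℕ.< p) (x y : ℤ) (p≡ : + p ≡ + 5 * (x * x) + + 3 * (y * y))
  {n : ℕ} (1+p≡ : suc p ≡ 3 ℕ.* suc n) where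

  private
    2<p : 2 ℕ.< p
    2<p = ℕ.≤-trans (s≤s (s≤s (s≤s z≤n))) 5<p
    3<p : 3 ℕ.< p
    3<p = ℕ.≤-trans (s≤s (s≤s (s≤s (s≤s z≤n)))) 5<p

    module Form = DiagonalForm pr {+ 5} {+ 3} {x} {y} (large∤ 5<p) (large∤ 3<p) p≡

    p∤2x : ¬ (+ p ∣ + 2 * x)
    p∤2x = prime∤* pr (large∤ 2<p) Form.p∤x

  p∤2y : ¬ (+ p ∣ + 2 * y)
  p∤2y = prime∤* pr (large∤ 2<p) Form.p∤y

  private
    3∤x : ¬ (+ 3 ∣ x)
    3∤x d = 3∤prime pr 5<p (subst (+ 3 ∣_)
        (sym p≡) (∣.∣m∣n⇒∣m+n (∣.∣n⇒∣m*n (+ 5) (∣.∣m⇒∣m*n x d)) (∣.∣m⇒∣m*n (y * y) ∣.∣-refl)))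

    module Symbol = CubicSymbol pr x y (+ 1) (+ 1) (inj₁ refl)
      (trans p≡ (solve 2 (λ x y → # 5 :* (x :* x) :+ # 3 :* (y :* y)
        := # 1 :* (x :* x :+ # 3 :* (y :* y)) :+ # 1 :* ((# 2 :* x) :* (# 2 :* x))) refl x y))
      p∤2x 3∤x
    open Symbol using (α; p∤norm)

    f g : ℤ
    f = fib (suc (2 ℕ.* n))
    g = fib (suc (suc (2 ℕ.* n)))

    d : 𝔼
    d = ι (+ 2 * x)

    module _ where
      open 𝔼/ (+ p)

      :α : ∀ {m} → Polynomial m → Polynomial m → 𝔼[ m ]
      :α x y = x :+ y , # 2 :* y
      :d : ∀ {m} → Polynomial m → 𝔼[ m ]
      :d x = :ι (# 2 :* x)
      :p : ∀ {m} → Polynomial m → Polynomial m → Polynomial m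
      :p x y = # 5 :* (x :* x) :+ # 3 :* (y :* y)

      -- Since α - 2x = -ᾱ, the difference α² - d α - d² is -(N + 4x²) = -p.
      quadratic : α ⊗ α ≋ d ⊗ α ⊕ d ⊗ d
      quadratic = by (ι -[1+ 0 ]) (trans (cong₂ ⟨_,_⟩
          (solve 2 (λ x y → :re (:α x y :⊗ :α x y)
            := :re (:d x :⊗ :α x y :⊕ :d x :⊗ :d x :⊕ :ι (:p x y) :⊗ :ι (con -[1+ 0 ]))) refl x y)
          (solve 2 (λ x y → :im (:α x y :⊗ :α x y)
            := :im (:d x :⊗ :α x y :⊕ :d x :⊗ :d x :⊕ :ι (:p x y) :⊗ :ι (con -[1+ 0 ]))) refl x y))
        (cong (λ t → d ⊗ α ⊕ d ⊗ d ⊕ ι t ⊗ ι -[1+ 0 ]) (sym p≡)))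

      d² : d ⊗ d ≋ ⊖ 1ᴱ ⊗ ι (norm α)
      d² = by 1ᴱ (trans (cong₂ ⟨_,_⟩
          (solve 2 (λ x y → :re (:d x :⊗ :d x)
            := :re (:ι (con -[1+ 0 ]) :⊗ :ι (:norm (:α x y)) :⊕ :ι (:p x y) :⊗ :ι (# 1))) refl x y)
          (solve 2 (λ x y → :im (:d x :⊗ :d x)
            := :im (:ι (con -[1+ 0 ]) :⊗ :ι (:norm (:α x y)) :⊕ :ι (:p x y) :⊗ :ι (# 1))) refl x y))
        (cong (λ t → ⊖ 1ᴱ ⊗ ι (norm α) ⊕ ι t ⊗ 1ᴱ) (sym p≡)))

      -- In this form d² = 4x² is -N rather than N modulo p; the sign vanishes in the power n + 1 =
      -- (p + 1)/3.
      d^ : (d ⊗ d) ^ᴱ suc n ≋ ι (norm α) ^ᴱ suc n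
      d^ = ≋-trans (≋-^ (suc n) d²) (≋-trans (≈⇒≋ (^ᴱ-distrib (⊖ 1ᴱ) (ι (norm α)) (suc n)))
        (≋-trans (≋-*ʳ (ι (norm α) ^ᴱ suc n) (⊖1^k≋1 {p} {suc n} pr (inj₂ 1+p≡))) (≈⇒≋ (⊗-identityˡ _))))

    open ℤ/ (+ p)
    open SetoidReasoning ≋-setoid

    -- The functional 2y re − (x + y) im kills α, leaving the Fibonacci number of odd index.
    isolate : ∀ {z} → z ≋ ι g ⊗ α ⊕ ι f ⊗ d [𝔼/ + p ] → + 2 * y * re z - (x + y) * im z ≋ + 2 * x * (+ 2 * y * f)
    isolate {z} h = begin
      + 2 * y * re z - (x + y) * im z  ≈⟨ ≋-+ (≋-*ˡ (+ 2 * y) (re-≋ h)) (≋-neg (≋-*ˡ (x + y) (im-≋ h))) ⟩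
      + 2 * y * re (ι g ⊗ α ⊕ ι f ⊗ d) - (x + y) * im (ι g ⊗ α ⊕ ι f ⊗ d)
        ≡⟨ solve 4 (λ f g x y → # 2 :* y :* :re (:ι g :⊗ :α x y :⊕ :ι f :⊗ :d x) :- (x :+ y) :* :im (:ι g :⊗ :α x y :⊕ :ι f :⊗ :d x)
             := # 2 :* x :* (# 2 :* y :* f)) refl f g x y ⟩
      + 2 * x * (+ 2 * y * f)  ∎

  fib-trivial : + 3 ∣ y → fib (suc (2 ℕ.* n)) ≋ + 1
  fib-trivial 3∣y = ModPrime.cancelˡ pr p∤2y (ModPrime.cancelˡ pr p∤2x (begin
    + 2 * x * (+ 2 * y * f)
      ≈⟨ isolate (fib-relation₂ pr α p∤norm {n} {𝟙} {d} 1+p≡ (Symbol.Trivial.cubic₂ 3∣y {suc n} 1+p≡) quadratic d^) ⟨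
    + 2 * y * re (1ᴱ ⊗ d) - (x + y) * im (1ᴱ ⊗ d)  ≡⟨ cong (λ z → + 2 * y * re z - (x + y) * im z) (⊗-identityˡ d) ⟩
    + 2 * y * (+ 2 * x) - (x + y) * + 0
      ≡⟨ solve 2 (λ x y → # 2 :* y :* (# 2 :* x) :- (x :+ y) :* # 0 := # 2 :* x :* (# 2 :* y :* # 1)) refl x y ⟩
    + 2 * x * (+ 2 * y * + 1)  ∎))

  fib-nontrivial : + 3 ∣ y - x → + 2 * y * fib (suc (2 ℕ.* n)) ≋ - (x + y)
  fib-nontrivial 3∣y-x = ModPrime.cancelˡ pr p∤2x (begin
    + 2 * x * (+ 2 * y * f)
      ≈⟨ isolate (fib-relation₂ pr α p∤norm {n} {𝕨²} {d} 1+p≡ (Symbol.Nontrivial.cubic₂ 3∣y-x 2 p-mod-9 {suc n}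
          refl 1+p≡) quadratic d^) ⟨
    + 2 * y * re (ωᴱ ⊗ d) - (x + y) * im (ωᴱ ⊗ d)
      ≡⟨ solve 2 (λ x y → # 2 :* y :* :re ((# 0 , # 1) :⊗ :d x) :- (x :+ y) :* :im ((# 0 , # 1) :⊗ :d x)
           := # 2 :* x :* (:- (x :+ y))) refl x y ⟩
    + 2 * x * (- (x + y))  ∎)
    where
    -- With y = x + 3z, 3y² ≡ 3x² modulo 9, so p ≡ 8x² = 4e x² for e = 2, and Ψ(2) = ω.
    p-mod-9 : + p ≋ + 8 * (x * x) [ℤ/ + 9 ]
    p-mod-9 = ℤ/.by (+ 2 * (x * z) + + 3 * (z * z)) (trans p≡ (trans
        (cong (λ y → + 5 * (x * x) + + 3 * (y * y)) (proj₂ (3∣-split {x} {y} 3∣y-x)))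
      (solve 2 (λ x z → # 5 :* (x :* x) :+ # 3 :* ((x :+ # 3 :* z) :* (x :+ # 3 :* z))
        := # 8 :* (x :* x) :+ # 9 :* (# 2 :* (x :* z) :+ # 3 :* (z :* z))) refl x z)))
      where z = proj₁ (3∣-split {x} {y} 3∣y-x)

-- Binomial sums

Σ⁰ : ℕ → (ℕ → ℤ) → ℤ
Σ⁰ zero    f = + 0
Σ⁰ (suc m) f = f 0 + Σ⁰ m (f ∘ suc)

Σ⁰-cong : ∀ m {f g} → (∀ k → f k ≡ g k) → Σ⁰ m f ≡ Σ⁰ m g
Σ⁰-cong zero    h = refl
Σ⁰-cong (suc m) h = cong₂ _+_ (h 0) (Σ⁰-cong m (h ∘ suc))

Σ⁰-snoc : ∀ m f → Σ⁰ (suc m) f ≡ Σ⁰ m f + f m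
Σ⁰-snoc zero    f = ℤ.+-comm (f 0) (+ 0)
Σ⁰-snoc (suc m) f = trans (cong (_+_ (f 0)) (Σ⁰-snoc m (f ∘ suc))) (sym (ℤ.+-assoc (f 0) (Σ⁰ m (f ∘ suc)) (f (suc m))))

Σ⁰-+ : ∀ m f g → Σ⁰ m (λ k → f k + g k) ≡ Σ⁰ m f + Σ⁰ m g
Σ⁰-+ zero    f g = refl
Σ⁰-+ (suc m) f g = trans (cong (_+_ (f 0 + g 0)) (Σ⁰-+ m (f ∘ suc) (g ∘ suc)))
  (solve 4 (λ a b c d → a :+ b :+ (c :+ d) := a :+ c :+ (b :+ d)) refl (f 0) (g 0) (Σ⁰ m (f ∘ suc)) (Σ⁰ m (g ∘ suc)))

Σ⁰-* : ∀ m c f → Σ⁰ m (λ k → c * f k) ≡ c * Σ⁰ m f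
Σ⁰-* zero    c f = sym (ℤ.*-zeroʳ c)
Σ⁰-* (suc m) c f = trans (cong (_+_ (c * f 0)) (Σ⁰-* m c (f ∘ suc))) (sym (ℤ.*-distribˡ-+ c (f 0) (Σ⁰ m (f ∘ suc))))

-- Summation may run past the last nonzero term; pairing even and odd indices below needs an even
-- number of terms.
Σ⁰-stable : ∀ {n} f → (∀ {k} → n ℕ.< k → f k ≡ + 0) → ∀ {M} → n ℕ.< M → Σ⁰ M f ≡ Σ⁰ (suc n) f
Σ⁰-stable {n} f h {suc M} (s≤s n≤M) = go n≤M
  where
  go : ∀ {M} → n ℕ.≤ M → Σ⁰ (suc M) f ≡ Σ⁰ (suc n) f
  go n≤M with ℕ.≤⇒≤′ n≤M
  ... | ℕ.≤′-refl = refl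
  ... | ℕ.≤′-step {M} n≤′M = trans (Σ⁰-snoc (suc M) f) (trans
      (cong₂ _+_ (go (ℕ.≤′⇒≤ n≤′M)) (h (s≤s (ℕ.≤′⇒≤ n≤′M)))) (ℤ.+-identityʳ _))

module Chebyshev (t : ℤ) where
  aTerm bTerm : ℕ → ℕ → ℤ
  aTerm n k = t ^ᶻ k * + ((n ℕ.+ k) C (2 ℕ.* k))
  bTerm n k = t ^ᶻ suc k * + ((suc n ℕ.+ k) C suc (2 ℕ.* k))

  -- Values of the Morgan-Voyce polynomials: `a n` is Σ C(n+k, 2k) tᵏ, and `b n` is t times the
  -- companion Σ C(n+1+k, 2k+1) tᵏ. Pascal's rule couples the two families.
  a b : ℕ → ℤ
  a zero    = + 1
  a (suc n) = a n + b n
  b zero    = t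
  b (suc n) = b n + t * a (suc n)

  private
    pascal : ∀ n k → + (suc n C suc k) ≡ + (n C k) + + (n C suc k)
    pascal n k = trans (cong +_ (sym (nCk+nC[k+1]≡[n+1]C[k+1] n k))) (ℤ.pos-+ (n C k) (n C suc k))

    a-step : ∀ n k → aTerm (suc n) (suc k) ≡ aTerm n (suc k) + bTerm n k
    a-step n k = begin
      T * + ((suc n ℕ.+ suc k) C (2 ℕ.* suc k))
        ≡⟨ cong (λ j → T * + ((suc n ℕ.+ suc k) C j)) (ℕ.*-suc 2 k) ⟩
      T * + ((suc n ℕ.+ suc k) C suc (suc (2 ℕ.* k)))
        ≡⟨ cong (T *_) (pascal (n ℕ.+ suc k) (suc (2 ℕ.* k))) ⟩
      T * (+ ((n ℕ.+ suc k) C suc (2 ℕ.* k)) + + ((n ℕ.+ suc k) C suc (suc (2 ℕ.* k))))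
        ≡⟨ solve 3 (λ T x y → T :* (x :+ y) := T :* y :+ T :* x) refl T _ _ ⟩
      T * + ((n ℕ.+ suc k) C suc (suc (2 ℕ.* k))) + T * + ((n ℕ.+ suc k) C suc (2 ℕ.* k))
        ≡⟨ cong₂ (λ i j → T * + ((n ℕ.+ suc k) C i) + T * + (j C suc (2 ℕ.* k))) (sym (ℕ.*-suc 2 k)) (ℕ.+-suc n k) ⟩
      aTerm n (suc k) + bTerm n k ∎
      where
      open ≡.≡-Reasoning
      T = t ^ᶻ suc k

    b-step : ∀ n k → bTerm (suc n) k ≡ bTerm n k + t * aTerm (suc n) k
    b-step n k = begin
      t * T * + ((suc (suc n) ℕ.+ k) C suc (2 ℕ.* k))
        ≡⟨ cong (t * T *_) (pascal (suc n ℕ.+ k) (2 ℕ.* k)) ⟩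
      t * T * (+ ((suc n ℕ.+ k) C (2 ℕ.* k)) + + ((suc n ℕ.+ k) C suc (2 ℕ.* k)))
        ≡⟨ solve 4 (λ t T x y → t :* T :* (x :+ y) := t :* T :* y :+ t :* (T :* x)) refl t T _ _ ⟩
      bTerm n k + t * aTerm (suc n) k ∎
      where
      open ≡.≡-Reasoning
      T = t ^ᶻ k

    a-vanish : ∀ n {k} → n ℕ.< k → aTerm n k ≡ + 0
    a-vanish n {k} n<k = trans (cong (λ c → t ^ᶻ k * + c) (k>n⇒nCk≡0 (subst (n ℕ.+ k ℕ.<_) (cong (k ℕ.+_)
        (sym (ℕ.+-identityʳ k))) (ℕ.+-monoˡ-< k n<k)))) (ℤ.*-zeroʳ (t ^ᶻ k))

    b-vanish : ∀ n {k} → n ℕ.< k → bTerm n k ≡ + 0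
    b-vanish n {k} n<k = trans (cong (λ c → t ^ᶻ suc k * + c) (k>n⇒nCk≡0 (s≤s (subst (n ℕ.+ k ℕ.<_) (cong (k ℕ.+_)
        (sym (ℕ.+-identityʳ k))) (ℕ.+-monoˡ-< k n<k))))) (ℤ.*-zeroʳ (t ^ᶻ suc k))

  sum-a : ∀ n {M} → n ℕ.< M → Σ⁰ M (aTerm n) ≡ a n
  sum-b : ∀ n {M} → n ℕ.< M → Σ⁰ M (bTerm n) ≡ b n
  sum-a zero    n<M = Σ⁰-stable (aTerm 0) (a-vanish 0) n<M
  sum-a (suc n) {suc M} (s≤s n<M) = begin
    aTerm n 0 + Σ⁰ M (aTerm (suc n) ∘ suc)
      ≡⟨ cong (_+_ (aTerm n 0)) (trans (Σ⁰-cong M (a-step n)) (Σ⁰-+ M (aTerm n ∘ suc) (bTerm n))) ⟩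
    aTerm n 0 + (Σ⁰ M (aTerm n ∘ suc) + Σ⁰ M (bTerm n))
      ≡⟨ ℤ.+-assoc (aTerm n 0) (Σ⁰ M (aTerm n ∘ suc)) (Σ⁰ M (bTerm n)) ⟨
    Σ⁰ (suc M) (aTerm n) + Σ⁰ M (bTerm n)
      ≡⟨ cong₂ _+_ (sum-a n (ℕ.<-trans n<M (ℕ.n<1+n M))) (sum-b n n<M) ⟩
    a n + b n ∎
    where open ≡.≡-Reasoning
  sum-b zero    n<M = trans (Σ⁰-stable (bTerm 0) (b-vanish 0) n<M) (solve 1 (λ t → t :* # 1 :* # 1 :+ # 0 := t) refl t)
  sum-b (suc n) {M} n<M = begin
    Σ⁰ M (bTerm (suc n))  ≡⟨ Σ⁰-cong M (b-step n) ⟩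
    Σ⁰ M (λ k → bTerm n k + t * aTerm (suc n) k)  ≡⟨ Σ⁰-+ M (bTerm n) (λ k → t * aTerm (suc n) k) ⟩
    Σ⁰ M (bTerm n) + Σ⁰ M (λ k → t * aTerm (suc n) k)
      ≡⟨ cong₂ _+_ (sum-b n (ℕ.<-trans (ℕ.n<1+n n) n<M)) (trans (Σ⁰-* M t (aTerm (suc n)))
          (cong (t *_) (sum-a (suc n) n<M))) ⟩
    b n + t * a (suc n)  ∎
    where open ≡.≡-Reasoning

module Fibonacci where
  open Chebyshev (+ 1)

  a≡fib : ∀ n → a n ≡ fib (suc (2 ℕ.* n))
  b≡fib : ∀ n → b n ≡ fib (suc (suc (2 ℕ.* n)))
  a≡fib zero    = refl
  a≡fib (suc n) = trans (cong₂ _+_ (a≡fib n) (b≡fib n)) (trans (ℤ.+-comm (fib (suc (2 ℕ.* n))) _) (cong (fib ∘ suc)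
      (sym (ℕ.*-suc 2 n))))
  b≡fib zero    = refl
  b≡fib (suc n) = trans (cong₂ _+_ (b≡fib n) (trans (ℤ.*-identityˡ (a (suc n))) (a≡fib (suc n))))
    (trans (ℤ.+-comm (fib (suc (suc (2 ℕ.* n)))) _) (trans
      (cong (λ j → fib (suc j) + fib (suc (suc (2 ℕ.* n)))) (ℕ.*-suc 2 n)) (cong (fib ∘ suc ∘ suc) (sym (ℕ.*-suc 2 n)))))

module Period where
  open Chebyshev -[1+ 0 ]

  -- At t = -1 the recursion is (a, b) ↦ (a + b, -a), with characteristic polynomial X² - X + 1,
  -- hence of order 6.
  a-period : ∀ n → a (6 ℕ.+ n) ≡ a n
  a-period n = solve 2 (λ a b →
    let a₁ = a :+ b ; b₁ = b :+ m :* a₁ ; a₂ = a₁ :+ b₁ ; b₂ = b₁ :+ m :* a₂ ; a₃ = a₂ :+ b₂ ; b₃ = b₂ :+ m :* a₃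
        a₄ = a₃ :+ b₃ ; b₄ = b₃ :+ m :* a₄ ; a₅ = a₄ :+ b₄ ; b₅ = b₄ :+ m :* a₅
    in a₅ :+ b₅ := a) refl (a n) (b n)
    where
    m : Polynomial 2
    m = con -[1+ 0 ]

  a-period* : ∀ s q → a (s ℕ.+ q ℕ.* 6) ≡ a s
  a-period* s zero    = cong a (ℕ.+-identityʳ s)
  a-period* s (suc q) = trans (cong a (trans (sym (ℕ.+-assoc s 6 (q ℕ.* 6))) (trans
      (cong (ℕ._+ q ℕ.* 6) (ℕ.+-comm s 6)) (ℕ.+-assoc 6 s (q ℕ.* 6)))))
    (trans (a-period (s ℕ.+ q ℕ.* 6)) (a-period* s q))

-- Adding the sums for t = 1 and t = -1 cancels the odd indices and doubles the even ones, which are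
-- the terms of the first sum of the theorem.
even-terms : ∀ m (f : ℕ → ℤ) → Σ⁰ (2 ℕ.* m) (λ k → (+ 1) ^ᶻ k * f k) + Σ⁰ (2 ℕ.* m) (λ k → -[1+ 0 ] ^ᶻ k * f k) ≡ + 2 * Σ⁰ m (λ k → f (2 ℕ.* k))
even-terms zero    f = refl
even-terms (suc m) f = begin
  Σ⁰ (2 ℕ.* suc m) (λ k → (+ 1) ^ᶻ k * f k) + Σ⁰ (2 ℕ.* suc m) (λ k → -[1+ 0 ] ^ᶻ k * f k)
    ≡⟨ cong (λ j → Σ⁰ j (λ k → (+ 1) ^ᶻ k * f k) + Σ⁰ j (λ k → -[1+ 0 ] ^ᶻ k * f k)) (ℕ.*-suc 2 m) ⟩
  (+ 1 * f 0 + ((+ 1 * + 1) * f 1 + Σ⁰ (2 ℕ.* m) (λ k → (+ 1 * (+ 1 * (+ 1) ^ᶻ k)) * f (2 ℕ.+ k))))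
    + (+ 1 * f 0 + ((-[1+ 0 ] * + 1) * f 1 + Σ⁰ (2 ℕ.* m) (λ k → (-[1+ 0 ] * (-[1+ 0 ] * -[1+ 0 ] ^ᶻ k)) * f (2 ℕ.+ k))))
    ≡⟨ cong₂ (λ x y → (+ 1 * f 0 + ((+ 1 * + 1) * f 1 + x)) + (+ 1 * f 0 + ((-[1+ 0 ] * + 1) * f 1 + y)))
         (Σ⁰-cong (2 ℕ.* m) (λ k → solve 2 (λ T z → # 1 :* (# 1 :* T) :* z := T :* z) refl ((+ 1) ^ᶻ k) (f (2 ℕ.+ k))))
         (Σ⁰-cong (2 ℕ.* m) (λ k → solve 2 (λ T z → con -[1+ 0 ] :* (con -[1+ 0 ] :* T) :* z := T :* z)
           refl (-[1+ 0 ] ^ᶻ k) (f (2 ℕ.+ k)))) ⟩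
  (+ 1 * f 0 + ((+ 1 * + 1) * f 1 + P)) + (+ 1 * f 0 + ((-[1+ 0 ] * + 1) * f 1 + Q))
    ≡⟨ solve 4 (λ x y P Q → (# 1 :* x :+ ((# 1 :* # 1) :* y :+ P)) :+ (# 1 :* x :+ ((con -[1+ 0 ] :* # 1) :* y :+ Q))
        := # 2 :* x :+ (P :+ Q)) refl (f 0) (f 1) P Q ⟩
  + 2 * f 0 + (P + Q)
    ≡⟨ cong (_+_ (+ 2 * f 0)) (even-terms m (λ k → f (2 ℕ.+ k))) ⟩
  + 2 * f 0 + + 2 * Σ⁰ m (λ k → f (2 ℕ.+ 2 ℕ.* k))
    ≡⟨ ℤ.*-distribˡ-+ (+ 2) (f 0) _ ⟨
  + 2 * (f 0 + Σ⁰ m (λ k → f (2 ℕ.+ 2 ℕ.* k)))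
    ≡⟨ cong (λ z → + 2 * (f 0 + z)) (Σ⁰-cong m (λ k → cong f (sym (ℕ.*-suc 2 k)))) ⟩
  + 2 * Σ⁰ (suc m) (λ k → f (2 ℕ.* k)) ∎
  where
  open ≡.≡-Reasoning
  P = Σ⁰ (2 ℕ.* m) (λ k → (+ 1) ^ᶻ k * f (2 ℕ.+ k))
  Q = Σ⁰ (2 ℕ.* m) (λ k → -[1+ 0 ] ^ᶻ k * f (2 ℕ.+ k))

module BinomialCongruence {p n : ℕ} (pr : Prime p) (p≡ : p ≡ suc (3 ℕ.* n) ⊎ p ≡ suc (suc (3 ℕ.* n))) where
  open ℤ/ (+ p)
  open SetoidReasoning ≋-setoid

  private
    infix 9 _!ᶻ
    _!ᶻ : ℕ → ℤ
    k !ᶻ = + (k ℕ.!)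

    suc-!ᶻ : ∀ k → suc k !ᶻ ≡ + suc k * k !ᶻ
    suc-!ᶻ k = ℤ.pos-* (suc k) (k ℕ.!)

    -- 9(n + k + 1)(n − k) ≡ −(3k + 1)(3k + 2) modulo p, whichever residue p has modulo 3.
    step : ∀ k m → + n ≡ + 1 + + k + + m →
           -[1+ 26 ] * ((+ 1 + (+ n + + k)) * ((+ 1 + + k) * (+ 1 + + m))) ≋ (+ 3 + + 3 * + k) * ((+ 2 + + 3 * + k) * (+ 1 + + 3 * + k))
    step k m n≡ = [ (λ e → residue (+ 1) refl (trans (cong +_ e) (trans (ℤ.pos-+ 1 (3 ℕ.* n)) (cong (_+_ (+ 1)) 3n))))
                  , (λ e → residue (+ 2) refl (trans (cong +_ e) (trans (ℤ.pos-+ 2 (3 ℕ.* n)) (cong (_+_ (+ 2)) 3n)))) ]′ p≡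
      where
      target : ℤ
      target = (+ 3 + + 3 * + k) * ((+ 2 + + 3 * + k) * (+ 1 + + 3 * + k))
      source : ℤ → ℤ
      source n = -[1+ 26 ] * ((+ 1 + (n + + k)) * ((+ 1 + + k) * (+ 1 + + m)))
      quotient : ℤ → ℤ → ℤ
      quotient r n = - ((+ 3 + + 3 * + k) * (+ 3 * n + + 3 - r))
      3n : + (3 ℕ.* n) ≡ + 3 * + n
      3n = ℤ.pos-* 3 n
      -- The equation (r - 1)(r - 2) = 0 encodes both residues of p modulo 3, so one polynomial
      -- identity covers them.
      residue : ∀ r → (r - + 1) * (r - + 2) ≡ + 0 → + p ≡ r + + 3 * + n → source (+ n) ≋ target
      residue r r≡1∨2 p≡r+3n = begin
        source (+ n)
          ≡⟨ cong source n≡ ⟩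
        source n′
          ≡⟨ solve 3 (λ k m r → let n = # 1 :+ k :+ m in
               con -[1+ 26 ] :* ((# 1 :+ (n :+ k)) :* ((# 1 :+ k) :* (# 1 :+ m)))
               := (# 3 :+ # 3 :* k) :* ((# 2 :+ # 3 :* k) :* (# 1 :+ # 3 :* k))
                  :+ (r :+ # 3 :* n) :* (:- ((# 3 :+ # 3 :* k) :* (# 3 :* n :+ # 3 :- r)))
                  :- (# 3 :+ # 3 :* k) :* ((r :- # 1) :* (r :- # 2))) refl (+ k) (+ m) r ⟩
        target + (r + + 3 * n′) * quotient r n′ - (+ 3 + + 3 * + k) * ((r - + 1) * (r - + 2))
          ≡⟨ cong (λ z → target + (r + + 3 * n′) * quotient r n′ - (+ 3 + + 3 * + k) * z) r≡1∨2 ⟩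
        target + (r + + 3 * n′) * quotient r n′ - (+ 3 + + 3 * + k) * + 0
          ≡⟨ solve 2 (λ x y → x :- y :* # 0 := x) refl (target + (r + + 3 * n′) * quotient r n′) (+ 3 + + 3 * + k) ⟩
        target + (r + + 3 * n′) * quotient r n′
          ≡⟨ cong (λ n → target + (r + + 3 * n) * quotient r n) (sym n≡) ⟩
        target + (r + + 3 * + n) * quotient r (+ n)
          ≡⟨ cong (λ z → target + z * quotient r (+ n)) (sym p≡r+3n) ⟩
        target + + p * quotient r (+ n)
          ≈⟨ by (quotient r (+ n)) refl ⟩
        target ∎
        where
        n′ : ℤ
        n′ = + 1 + + k + + m

    -- The binomial congruence without divisions. Passing from k to k + 1 brings in the ratio of the
    -- two sides, which `step` evaluates; writing n = k + m avoids subtraction.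
    factorials : ∀ k m → n ≡ k ℕ.+ m → -[1+ 26 ] ^ᶻ k * ((n ℕ.+ k) !ᶻ * k !ᶻ) ≋ (3 ℕ.* k) !ᶻ * m !ᶻ
    factorials zero m n≡ = ≈⇒≋ (trans (ℤ.*-identityˡ _) (trans (ℤ.*-identityʳ _) (trans (cong _!ᶻ
        (trans (ℕ.+-identityʳ n) n≡)) (sym (ℤ.*-identityˡ _)))))
    factorials (suc k) m n≡ = begin
      -[1+ 26 ] * T * ((n ℕ.+ suc k) !ᶻ * suc k !ᶻ)
        ≡⟨ cong₂ (λ u v → -[1+ 26 ] * T * (u * v)) (trans (cong _!ᶻ (ℕ.+-suc n k)) (trans (suc-!ᶻ (n ℕ.+ k))
            (cong (_* (n ℕ.+ k) !ᶻ) (trans (ℤ.pos-+ 1 (n ℕ.+ k)) (cong (_+_ (+ 1)) (ℤ.pos-+ n k))))))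
             (trans (suc-!ᶻ k) (cong (_* k !ᶻ) (ℤ.pos-+ 1 k))) ⟩
      -[1+ 26 ] * T * (((+ 1 + (+ n + + k)) * (n ℕ.+ k) !ᶻ) * ((+ 1 + + k) * k !ᶻ))
        ≡⟨ solve 5 (λ T u v w z → con -[1+ 26 ] :* T :* ((u :* w) :* (v :* z))
            := con -[1+ 26 ] :* (u :* v) :* (T :* (w :* z))) refl T (+ 1 + (+ n + + k)) (+ 1 + + k) ((n ℕ.+ k) !ᶻ) (k !ᶻ) ⟩
      -[1+ 26 ] * ((+ 1 + (+ n + + k)) * (+ 1 + + k)) * (T * ((n ℕ.+ k) !ᶻ * k !ᶻ))
        ≈⟨ ≋-*ˡ (-[1+ 26 ] * ((+ 1 + (+ n + + k)) * (+ 1 + + k))) (factorials k (suc m) (trans n≡ (sym (ℕ.+-suc k m)))) ⟩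
      -[1+ 26 ] * ((+ 1 + (+ n + + k)) * (+ 1 + + k)) * ((3 ℕ.* k) !ᶻ * suc m !ᶻ)
        ≡⟨ cong (λ z → -[1+ 26 ] * ((+ 1 + (+ n + + k)) * (+ 1 + + k)) * ((3 ℕ.* k) !ᶻ * z)) (trans (suc-!ᶻ m)
            (cong (_* m !ᶻ) (ℤ.pos-+ 1 m))) ⟩
      -[1+ 26 ] * ((+ 1 + (+ n + + k)) * (+ 1 + + k)) * ((3 ℕ.* k) !ᶻ * ((+ 1 + + m) * m !ᶻ))
        ≡⟨ solve 5 (λ u v w F M → con -[1+ 26 ] :* (u :* v) :* (F :* (w :* M))
            := con -[1+ 26 ] :* (u :* (v :* w)) :* (F :* M))
                refl (+ 1 + (+ n + + k)) (+ 1 + + k) (+ 1 + + m) ((3 ℕ.* k) !ᶻ) (m !ᶻ) ⟩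
      -[1+ 26 ] * ((+ 1 + (+ n + + k)) * ((+ 1 + + k) * (+ 1 + + m))) * ((3 ℕ.* k) !ᶻ * m !ᶻ)
        ≈⟨ ≋-*ʳ ((3 ℕ.* k) !ᶻ * m !ᶻ) (step k m (trans (cong +_ n≡) (trans (ℤ.pos-+ (suc k) m)
            (cong (_+ + m) (ℤ.pos-+ 1 k))))) ⟩
      (+ 3 + + 3 * + k) * ((+ 2 + + 3 * + k) * (+ 1 + + 3 * + k)) * ((3 ℕ.* k) !ᶻ * m !ᶻ)
        ≡⟨ solve 5 (λ a b c F M → a :* (b :* c) :* (F :* M) := a :* (b :* (c :* F)) :* M)
            refl (+ 3 + + 3 * + k) (+ 2 + + 3 * + k) (+ 1 + + 3 * + k) ((3 ℕ.* k) !ᶻ) (m !ᶻ) ⟩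
      (+ 3 + + 3 * + k) * ((+ 2 + + 3 * + k) * ((+ 1 + + 3 * + k) * (3 ℕ.* k) !ᶻ)) * m !ᶻ
        ≡⟨ cong (_* m !ᶻ) 3k+3! ⟨
      (3 ℕ.* suc k) !ᶻ * m !ᶻ ∎
      where
      T = -[1+ 26 ] ^ᶻ k
      pos : ∀ j → + (j ℕ.+ 3 ℕ.* k) ≡ + j + + 3 * + k
      pos j = trans (ℤ.pos-+ j (3 ℕ.* k)) (cong (_+_ (+ j)) (ℤ.pos-* 3 k))
      3k+3! : (3 ℕ.* suc k) !ᶻ ≡ (+ 3 + + 3 * + k) * ((+ 2 + + 3 * + k) * ((+ 1 + + 3 * + k) * (3 ℕ.* k) !ᶻ))
      3k+3! = trans (cong _!ᶻ (ℕ.*-suc 3 k)) (trans (suc-!ᶻ (2 ℕ.+ 3 ℕ.* k)) (cong₂ _*_ (pos 3)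
        (trans (suc-!ᶻ (1 ℕ.+ 3 ℕ.* k)) (cong₂ _*_ (pos 2) (trans (suc-!ᶻ (3 ℕ.* k)) (cong (_* (3 ℕ.* k) !ᶻ) (pos 1)))))))

    2n<p : 2 ℕ.* n ℕ.< p
    2n<p = [ (λ e → subst (2 ℕ.* n ℕ.<_) (sym e) (s≤s (ℕ.*-monoˡ-≤ n {2} {3} (s≤s (s≤s z≤n)))))
           , (λ e → subst (2 ℕ.* n ℕ.<_) (sym e) (s≤s (ℕ.m≤n⇒m≤1+n (ℕ.*-monoˡ-≤ n {2} {3} (s≤s (s≤s z≤n)))))) ]′ p≡

  -- Multiplication by k! (2k)! (n - k)! reduces this to `factorials`. The factor is prime to p
  -- because every argument is at most 2n < p.
  C-congruence : ∀ {k} → k ℕ.≤ n → + ((3 ℕ.* k) C k) ≋ + ((n ℕ.+ k) C (2 ℕ.* k)) * -[1+ 26 ] ^ᶻ k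
  C-congruence {k} k≤n = ≋-sym (ModPrime.cancelˡ pr {k !ᶻ * ((2 ℕ.* k) !ᶻ * m !ᶻ)} p∤! (begin
    k !ᶻ * ((2 ℕ.* k) !ᶻ * m !ᶻ) * (+ V * T)
      ≡⟨ solve 5 (λ K D M V T → K :* (D :* M) :* (V :* T) := T :* ((V :* (D :* M)) :* K))
          refl (k !ᶻ) ((2 ℕ.* k) !ᶻ) (m !ᶻ) (+ V) T ⟩
    T * ((+ V * ((2 ℕ.* k) !ᶻ * m !ᶻ)) * k !ᶻ)
      ≡⟨ cong (λ z → T * (z * k !ᶻ)) n+k! ⟩
    T * ((n ℕ.+ k) !ᶻ * k !ᶻ)
      ≈⟨ factorials k m n≡ ⟩
    (3 ℕ.* k) !ᶻ * m !ᶻ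
      ≡⟨ cong (_* m !ᶻ) 3k! ⟨
    + U * (k !ᶻ * (2 ℕ.* k) !ᶻ) * m !ᶻ
      ≡⟨ solve 4 (λ K D M U → U :* (K :* D) :* M := K :* (D :* M) :* U) refl (k !ᶻ) ((2 ℕ.* k) !ᶻ) (m !ᶻ) (+ U) ⟩
    k !ᶻ * ((2 ℕ.* k) !ᶻ * m !ᶻ) * + U ∎))
    where
    m = n ℕ.∸ k
    U = (3 ℕ.* k) C k
    V = (n ℕ.+ k) C (2 ℕ.* k)
    T = -[1+ 26 ] ^ᶻ k
    n≡ : n ≡ k ℕ.+ m
    n≡ = sym (ℕ.m+[n∸m]≡n k≤n)
    n+k≡ : n ℕ.+ k ≡ m ℕ.+ 2 ℕ.* k
    n+k≡ = trans (cong (ℕ._+ k) n≡) (regroup k m)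
      where
      regroup : ∀ k m → k ℕ.+ m ℕ.+ k ≡ m ℕ.+ 2 ℕ.* k
      regroup = solveℕ-∀
    n+k! : + V * ((2 ℕ.* k) !ᶻ * m !ᶻ) ≡ (n ℕ.+ k) !ᶻ
    n+k! = trans (cong (+ V *_) (sym (ℤ.pos-* ((2 ℕ.* k) ℕ.!) (m ℕ.!)))) (trans (sym (ℤ.pos-* V _)) (cong +_ (trans
      (cong (λ j → V ℕ.* (((2 ℕ.* k) ℕ.!) ℕ.* (j ℕ.!))) (sym (trans (cong (ℕ._∸ 2 ℕ.* k) n+k≡) (ℕ.m+n∸n≡m m (2 ℕ.* k)))))
      (nCk*k![n∸k]!≡n! (subst (2 ℕ.* k ℕ.≤_) (sym n+k≡) (ℕ.m≤n+m (2 ℕ.* k) m))))))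
    3k! : + U * (k !ᶻ * (2 ℕ.* k) !ᶻ) ≡ (3 ℕ.* k) !ᶻ
    3k! = trans (cong (+ U *_) (sym (ℤ.pos-* (k ℕ.!) ((2 ℕ.* k) ℕ.!)))) (trans (sym (ℤ.pos-* U _)) (cong +_ (trans
      (cong (λ j → U ℕ.* ((k ℕ.!) ℕ.* (j ℕ.!))) (sym (ℕ.m+n∸m≡n k (2 ℕ.* k))))
      (nCk*k![n∸k]!≡n! (ℕ.m≤m+n k (2 ℕ.* k))))))
    n≤2n : n ℕ.≤ 2 ℕ.* n
    n≤2n = ℕ.m≤m+n n (n ℕ.+ 0)
    p∤small : ∀ {j} → j ℕ.≤ 2 ℕ.* n → ¬ (+ p ∣ j !ᶻ)
    p∤small {j} j≤ d = prime∤! pr j (ℕ.≤-<-trans j≤ 2n<p) (∣⇒∣ᵤ d)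
    p∤! : ¬ (+ p ∣ k !ᶻ * ((2 ℕ.* k) !ᶻ * m !ᶻ))
    p∤! d = [ p∤small (ℕ.≤-trans k≤n n≤2n)
        , (λ d → [ p∤small (ℕ.*-monoʳ-≤ 2 k≤n) , p∤small (ℕ.≤-trans (ℕ.m∸n≤m n k) n≤2n)
            ]′ (euclidℤ pr ((2 ℕ.* k) !ᶻ) (m !ᶻ) d)) ]′
      (euclidℤ pr (k !ᶻ) ((2 ℕ.* k) !ᶻ * m !ᶻ) d)

-- Rationals modulo p

module Rational/ {p : ℕ} (pr : Prime p) where
  open ℤ/ (+ p)

  infix 4 _∼_
  -- It says that r is p-integral with residue a. The witnessing fraction n / d need not be reduced,
  -- so sums and products are handled without tracking how ℚ normalises.
  record _∼_ (r : ℚ) (a : ℤ) : Set where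
    constructor fraction
    field
      d n   : ℤ
      p∤d   : ¬ (+ p ∣ d)
      value : ↥ r * d ≡ n * ↧ r
      n≋ad  : n ≋ a * d

  ∼-/ : ∀ i k {a d} → + suc k ≡ d → ¬ (+ p ∣ d) → i ≋ a * d → (i ℚ./ suc k) ∼ a
  ∼-/ i k refl p∤d h = fraction (+ suc k) i p∤d (cross i k) h
    where
    cross : ∀ i k → ↥ (i ℚ./ suc k) * + suc k ≡ i * ↧ (i ℚ./ suc k)
    cross i k with ℚ.toℚᵘ-fromℚᵘ (mkℚᵘ i k)
    ... | *≡* e = trans (cong (_* + suc k) (sym (ℚ.↥ᵘ-toℚᵘ (i ℚ./ suc k)))) (trans e (cong (i *_) (ℚ.↧ᵘ-toℚᵘ (i ℚ./ suc k))))

  ∼-int : ∀ i → (i ℚ./ 1) ∼ i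
  ∼-int i = ∼-/ i 0 {i} refl (ModPrime.p∤1 pr) (≈⇒≋ (sym (ℤ.*-identityʳ i)))

  ∼-divℤ : ∀ i {j a} → ¬ (+ p ∣ j) → i ≋ a * j → divℤ i j ∼ a
  ∼-divℤ i {+ zero}    p∤j h = ⊥-elim (p∤j (divides (+ 0) refl))
  ∼-divℤ i {+ suc k} {a} p∤j h = ∼-/ i k {a} refl p∤j h
  ∼-divℤ i { -[1+ k ]} {a} p∤j h = ∼-/ (- i) k {a} refl
    (λ d → p∤j (∣.∣m⇒∣-m d))
    (≋-trans (≋-neg h) (≈⇒≋ (ℤ.neg-distribʳ-* a -[1+ k ])))

  private
    nonzero : ∀ r → ℤ.NonZero (↧ r)
    nonzero r = _

    ×-nonzero : ∀ r s → ℤ.NonZero (↧ r * ↧ s)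
    ×-nonzero r s = ℤ.i*j≢0 (↧ r) (↧ s) {{nonzero r}} {{nonzero s}}

  ∼-+ : ∀ {r s a b} → r ∼ a → s ∼ b → (r ℚ.+ s) ∼ (a + b)
  ∼-+ {r} {s} {a} {b} (fraction d n p∤d v e) (fraction d′ n′ p∤d′ v′ e′) =
    fraction (d * d′) (n * d′ + n′ * d) (prime∤* pr p∤d p∤d′)
      (ℤ.*-cancelˡ-≡ (↧ r * ↧ s) _ _ {{×-nonzero r s}} (begin
        (↧ r * ↧ s) * (↥ (r ℚ.+ s) * (d * d′))
          ≡⟨ solve 4 (λ u t d d′ → u :* (t :* (d :* d′)) := (t :* u) :* (d :* d′)) refl (↧ r * ↧ s) (↥ (r ℚ.+ s)) d d′ ⟩
        (↥ (r ℚ.+ s) * (↧ r * ↧ s)) * (d * d′)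
          ≡⟨ cong (_* (d * d′)) (cross r s) ⟩
        ((↥ r * ↧ s + ↥ s * ↧ r) * ↧ (r ℚ.+ s)) * (d * d′)
          ≡⟨ solve 7 (λ x y x′ y′ d d′ z → ((x :* y′ :+ x′ :* y) :* z) :* (d :* d′)
              := ((x :* d) :* (y′ :* d′) :+ (x′ :* d′) :* (y :* d)) :* z) refl (↥ r) (↧ r) (↥ s) (↧ s) d d′ (↧ (r ℚ.+ s)) ⟩
        ((↥ r * d) * (↧ s * d′) + (↥ s * d′) * (↧ r * d)) * ↧ (r ℚ.+ s)
          ≡⟨ cong₂ (λ u w → (u * (↧ s * d′) + w * (↧ r * d)) * ↧ (r ℚ.+ s)) v v′ ⟩
        ((n * ↧ r) * (↧ s * d′) + (n′ * ↧ s) * (↧ r * d)) * ↧ (r ℚ.+ s)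
          ≡⟨ solve 7 (λ n n′ y y′ d d′ z → ((n :* y) :* (y′ :* d′) :+ (n′ :* y′) :* (y :* d)) :* z
              := (y :* y′) :* ((n :* d′ :+ n′ :* d) :* z)) refl n n′ (↧ r) (↧ s) d d′ (↧ (r ℚ.+ s)) ⟩
        (↧ r * ↧ s) * ((n * d′ + n′ * d) * ↧ (r ℚ.+ s)) ∎))
      (≋-trans (≋-+ (≋-*ʳ d′ e) (≋-*ʳ d e′)) (≈⇒≋ (solve 4 (λ a b d d′ → a :* d :* d′ :+ b :* d′ :* d
        := (a :+ b) :* (d :* d′)) refl a b d d′)))
    where
    open ≡.≡-Reasoning
    cross : ∀ r s → ↥ (r ℚ.+ s) * (↧ r * ↧ s) ≡ (↥ r * ↧ s + ↥ s * ↧ r) * ↧ (r ℚ.+ s)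
    cross r@(ℚ.mkℚ _ _ _) s@(ℚ.mkℚ _ _ _) with ℚ.toℚᵘ-homo-+ r s
    ... | *≡* e = trans (cong (_* (↧ r * ↧ s)) (sym (ℚ.↥ᵘ-toℚᵘ (r ℚ.+ s)))) (trans e
        (cong ((↥ r * ↧ s + ↥ s * ↧ r) *_) (ℚ.↧ᵘ-toℚᵘ (r ℚ.+ s))))

  ∼-* : ∀ {r s a b} → r ∼ a → s ∼ b → (r ℚ.* s) ∼ (a * b)
  ∼-* {r} {s} {a} {b} (fraction d n p∤d v e) (fraction d′ n′ p∤d′ v′ e′) =
    fraction (d * d′) (n * n′) (prime∤* pr p∤d p∤d′)
      (ℤ.*-cancelˡ-≡ (↧ r * ↧ s) _ _ {{×-nonzero r s}} (begin
        (↧ r * ↧ s) * (↥ (r ℚ.* s) * (d * d′))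
          ≡⟨ solve 4 (λ u t d d′ → u :* (t :* (d :* d′)) := (t :* u) :* (d :* d′)) refl (↧ r * ↧ s) (↥ (r ℚ.* s)) d d′ ⟩
        (↥ (r ℚ.* s) * (↧ r * ↧ s)) * (d * d′)
          ≡⟨ cong (_* (d * d′)) (cross r s) ⟩
        ((↥ r * ↥ s) * ↧ (r ℚ.* s)) * (d * d′)
          ≡⟨ solve 5 (λ x x′ d d′ z → ((x :* x′) :* z) :* (d :* d′) := ((x :* d) :* (x′ :* d′)) :* z)
              refl (↥ r) (↥ s) d d′ (↧ (r ℚ.* s)) ⟩
        ((↥ r * d) * (↥ s * d′)) * ↧ (r ℚ.* s)
          ≡⟨ cong₂ (λ u w → (u * w) * ↧ (r ℚ.* s)) v v′ ⟩
        ((n * ↧ r) * (n′ * ↧ s)) * ↧ (r ℚ.* s)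
          ≡⟨ solve 5 (λ n n′ y y′ z → ((n :* y) :* (n′ :* y′)) :* z := (y :* y′) :* ((n :* n′) :* z))
              refl n n′ (↧ r) (↧ s) (↧ (r ℚ.* s)) ⟩
        (↧ r * ↧ s) * ((n * n′) * ↧ (r ℚ.* s)) ∎))
      (≋-trans (≋-* e e′) (≈⇒≋ (solve 4 (λ a b d d′ → (a :* d) :* (b :* d′) := (a :* b) :* (d :* d′)) refl a b d d′)))
    where
    open ≡.≡-Reasoning
    cross : ∀ r s → ↥ (r ℚ.* s) * (↧ r * ↧ s) ≡ (↥ r * ↥ s) * ↧ (r ℚ.* s)
    cross r@(ℚ.mkℚ _ _ _) s@(ℚ.mkℚ _ _ _) with ℚ.toℚᵘ-homo-* r s
    ... | *≡* e = trans (cong (_* (↧ r * ↧ s)) (sym (ℚ.↥ᵘ-toℚᵘ (r ℚ.* s)))) (trans e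
        (cong ((↥ r * ↥ s) *_) (ℚ.↧ᵘ-toℚᵘ (r ℚ.* s))))

  ∼-neg : ∀ {r a} → r ∼ a → (ℚ.- r) ∼ (- a)
  ∼-neg {r} {a} (fraction d n p∤d v e) = fraction d (- n) p∤d
    (trans (cong (_* d) (ℚ.↥-neg r)) (trans (sym (ℤ.neg-distribˡ-* (↥ r) d)) (trans (cong -_ v)
      (trans (ℤ.neg-distribˡ-* n (↧ r)) (cong (- n *_) (sym (ℚ.↧-neg r)))))))
    (≋-trans (≋-neg e) (≈⇒≋ (ℤ.neg-distribˡ-* a d)))

  ∼-sumTo : ∀ N {f g} → (∀ {k} → k ℕ.≤ N → f k ∼ g k) → sumTo N f ∼ Σ⁰ (suc N) g
  ∼-sumTo N {f} {g} h = subst (_∼ Σ⁰ (suc N) g) (cong (foldr ℚ._+_ 0ℚ)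
      (sym (List.map-upTo f (suc N)))) (go (suc N) f g (λ { (s≤s k≤N) → h k≤N }))
    where
    go : ∀ M f g → (∀ {k} → k ℕ.< M → f k ∼ g k) → foldr ℚ._+_ 0ℚ (applyUpTo f M) ∼ Σ⁰ M g
    go zero    f g h = ∼-int (+ 0)
    go (suc M) f g h = ∼-+ {f 0} (h (s≤s z≤n)) (go M (f ∘ suc) (g ∘ suc) (h ∘ s≤s))

  ∼⇒≡mod : ∀ {r s a b} → r ∼ a → s ∼ b → a ≋ b → r ≡ s [modℚ p ]
  ∼⇒≡mod {r} {s} {a} {b} h k a≋b = ∣⇒∣ᵤ (numerator (∼-+ {r} {ℚ.- s} h (∼-neg {s} k)))
    where
    numerator : ∀ {z} → z ∼ (a - b) → + p ∣ ↥ z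
    numerator {z} (fraction d n p∤d v e) = [ (λ x → x) , ⊥-elim ∘ p∤d ]′ (euclidℤ pr (↥ z) d (subst (+ p ∣_)
        (sym v) (∣.∣m⇒∣m*n (↧ z) p∣n)))
      where
      p∣n : + p ∣ n
      p∣n = ≋0⇒∣ (≋-trans e (≋-trans (≋-*ʳ d (∣⇒≋0 (≋⇒∣ a≋b))) (≈⇒≋ (ℤ.*-zeroˡ d))))

-- p = 18 q + s, and both sides depend only on s.
ε-value : ∀ {p} → Prime p → 5 ℕ.< p → ε p ≡ Chebyshev.a -[1+ 0 ] (p ℕ./ 3) ℚ./ 1
ε-value {p} pr 5<p = trans (ε-of p) (trans (cong table p%9) (trans (values (p % 18) (m%n<n p 18) p%18-2 p%18-3)
    (cong (ℚ._/ 1) (sym a-value))))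
  where
  open Chebyshev -[1+ 0 ] using (a)
  s q : ℕ
  s = p % 18
  q = p ℕ./ 18
  p≡ : p ≡ s ℕ.+ q ℕ.* 18
  p≡ = m≡m%n+[m/n]*n p 18
  table : ℕ → ℚ
  table 1 = 1ℚ
  table 8 = 1ℚ
  table 2 = ℚ.- 1ℚ
  table 7 = ℚ.- 1ℚ
  table _ = 0ℚ
  ε-of : ∀ p → ε p ≡ table (p % 9)
  ε-of p with p % 9
  ... | 0 = refl
  ... | 1 = refl
  ... | 2 = refl
  ... | 3 = refl
  ... | 4 = refl
  ... | 5 = refl
  ... | 6 = refl
  ... | 7 = refl
  ... | 8 = refl
  ... | suc (suc (suc (suc (suc (suc (suc (suc (suc _)))))))) = refl
  p%9 : p % 9 ≡ s % 9
  p%9 = sym (m∣n⇒o%n%m≡o%m 9 18 p (ℕ.divides 2 refl))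
  a-value : a (p ℕ./ 3) ≡ a (s ℕ./ 3)
  a-value = trans (cong a (trans (cong (ℕ._/ 3) p≡) (trans (+-distrib-/-∣ʳ s (ℕ.divides (q ℕ.* 6) q*18))
      (cong (s ℕ./ 3 ℕ.+_) (trans (cong (ℕ._/ 3) q*18) (m*n/n≡m (q ℕ.* 6) 3))))))
    (Period.a-period* (s ℕ./ 3) q)
    where
    q*18 : q ℕ.* 18 ≡ q ℕ.* 6 ℕ.* 3
    q*18 = sym (ℕ.*-assoc q 6 3)
  small-divisor : ∀ {r} → Prime r → r ℕ.≤ 5 → ¬ (r ℕ.∣ p)
  small-divisor {r} r-prime r≤5 d = ℕ.<⇒≢ (ℕ.≤-<-trans r≤5 5<p) (prime∣prime r-prime pr d)
  lift-divisor : ∀ {r} → r ℕ.∣ 18 → r ℕ.∣ s → r ℕ.∣ p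
  lift-divisor {r} r∣18 r∣s = subst (r ℕ.∣_) (sym p≡) (ℕ.∣m∣n⇒∣m+n r∣s (ℕ.∣n⇒∣m*n q r∣18))
  p%18-2 : ¬ (2 ℕ.∣ s)
  p%18-2 d = small-divisor prime[2] (s≤s (s≤s z≤n)) (lift-divisor (ℕ.divides 9 refl) d)
  p%18-3 : ¬ (3 ℕ.∣ s)
  p%18-3 d = small-divisor prime[3] (s≤s (s≤s (s≤s z≤n))) (lift-divisor (ℕ.divides 6 refl) d)
  values : ∀ s → s ℕ.< 18 → ¬ (2 ℕ.∣ s) → ¬ (3 ℕ.∣ s) → table (s % 9) ≡ a (s ℕ./ 3) ℚ./ 1
  values 0 _ h _ = ⊥-elim (h (ℕ.divides 0 refl))
  values 1 _ _ _ = refl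
  values 2 _ h _ = ⊥-elim (h (ℕ.divides 1 refl))
  values 3 _ _ h = ⊥-elim (h (ℕ.divides 1 refl))
  values 4 _ h _ = ⊥-elim (h (ℕ.divides 2 refl))
  values 5 _ _ _ = refl
  values 6 _ h _ = ⊥-elim (h (ℕ.divides 3 refl))
  values 7 _ _ _ = refl
  values 8 _ h _ = ⊥-elim (h (ℕ.divides 4 refl))
  values 9 _ _ h = ⊥-elim (h (ℕ.divides 3 refl))
  values 10 _ h _ = ⊥-elim (h (ℕ.divides 5 refl))
  values 11 _ _ _ = refl
  values 12 _ h _ = ⊥-elim (h (ℕ.divides 6 refl))
  values 13 _ _ _ = refl
  values 14 _ h _ = ⊥-elim (h (ℕ.divides 7 refl))
  values 15 _ _ h = ⊥-elim (h (ℕ.divides 5 refl))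
  values 16 _ h _ = ⊥-elim (h (ℕ.divides 8 refl))
  values 17 _ _ _ = refl
  values (suc (suc (suc (suc (suc (suc (suc (suc (suc (suc (suc (suc (suc (suc (suc (suc (suc (suc s)))))))))))))))))) h _ _ =
    ⊥-elim (ℕ.<⇒≱ h (ℕ.m≤m+n 18 s))

-- Evaluation of the two sums

^≡^ᶻ : ∀ i k → i ℤ.^ k ≡ i ^ᶻ k
^≡^ᶻ i zero    = refl
^≡^ᶻ i (suc k) = cong (i *_) (^≡^ᶻ i k)

pos-^ᶻ : ∀ m k → + (m ℕ.^ k) ≡ (+ m) ^ᶻ k
pos-^ᶻ m zero    = refl
pos-^ᶻ m (suc k) = trans (ℤ.pos-* m (m ℕ.^ k)) (cong (+ m *_) (pos-^ᶻ m k))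

module Sums {p : ℕ} (pr : Prime p) (5<p : 5 ℕ.< p)
  (p≡ : p ≡ suc (3 ℕ.* (p ℕ./ 3)) ⊎ p ≡ suc (suc (3 ℕ.* (p ℕ./ 3)))) where
  open ℤ/ (+ p)
  open Rational/ pr
  open BinomialCongruence {p} {p ℕ./ 3} pr p≡

  private
    n h : ℕ
    n = p ℕ./ 3
    h = p ℕ./ 6

    F : ℤ
    F = fib (suc (2 ℕ.* n))

    c : ℕ → ℤ
    c k = + ((n ℕ.+ k) C (2 ℕ.* k))

    h≡ : h ≡ n ℕ./ 2
    h≡ = sym (m/n/o≡m/[n*o] p 3 2)

    p∤27^ : ∀ k → ¬ (+ p ∣ -[1+ 26 ] ^ᶻ k)
    p∤27^ zero    = ModPrime.p∤1 pr
    p∤27^ (suc k) = prime∤* pr (λ d → p∤27 (∣.∣m⇒∣-m d)) (p∤27^ k)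
      where
      p∤3 : ¬ (+ p ∣ + 3)
      p∤3 = large∤ (ℕ.≤-trans (s≤s (s≤s (s≤s (s≤s z≤n)))) 5<p)
      p∤27 : ¬ (+ p ∣ + 27)
      p∤27 = prime∤* pr {+ 3} {+ 9} p∤3 (prime∤* pr {+ 3} {+ 3} p∤3 p∤3)

    sum-c : ∀ t {M} → n ℕ.< M → Σ⁰ M (λ k → t ^ᶻ k * c k) ≡ Chebyshev.a t n
    sum-c t = Chebyshev.sum-a t n

  S₂∼fib : S₂ p ∼ fib (suc (2 ℕ.* (p ℕ./ 3)))
  S₂∼fib = subst (S₂ p ∼_)
    (trans (Σ⁰-cong (suc n) (λ k → sym (trans (cong (_* c k) (1^ᶻ k)) (ℤ.*-identityˡ (c k)))))
      (trans (sum-c (+ 1) (ℕ.n<1+n n)) (Fibonacci.a≡fib n)))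
    (∼-sumTo n {g = c} (λ {k} k≤n → ∼-divℤ (+ ((3 ℕ.* k) C k))
      (subst (λ z → ¬ (+ p ∣ z)) (sym (^≡^ᶻ -[1+ 26 ] k)) (p∤27^ k))
      (≋-trans (C-congruence k≤n) (≈⇒≋ (cong (c k *_) (sym (^≡^ᶻ -[1+ 26 ] k)))))))

  private
    -- With j = 2k, C(6k, 2k) is C(3j, j), and (-27)^j = 27^j because j is even; so these are the
    -- even-indexed terms of the second sum.
    S₁∼ : S₁ p ∼ Σ⁰ (suc h) (λ k → c (2 ℕ.* k))
    S₁∼ = ∼-sumTo h {g = λ k → c (2 ℕ.* k)} (λ {k} k≤h → ∼-divℤ (+ ((6 ℕ.* k) C (2 ℕ.* k)))
      (subst (λ z → ¬ (+ p ∣ z)) (sym (27^2k k)) (p∤27^ (2 ℕ.* k)))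
      (≋-trans (≈⇒≋ (cong (λ j → + (j C (2 ℕ.* k))) (ℕ.*-assoc 3 2 k)))
        (≋-trans (C-congruence (2k≤n k≤h)) (≈⇒≋ (cong (c (2 ℕ.* k) *_) (sym (27^2k k)))))))
      where
      27^2k : ∀ k → + (27 ℕ.^ (2 ℕ.* k)) ≡ -[1+ 26 ] ^ᶻ (2 ℕ.* k)
      27^2k k = trans (pos-^ᶻ 27 (2 ℕ.* k)) (trans (sym (^ᶻ-* (+ 27) 2 k)) (^ᶻ-* -[1+ 26 ] 2 k))
      2k≤n : ∀ {k} → k ℕ.≤ h → 2 ℕ.* k ℕ.≤ n
      2k≤n {k} k≤h = ℕ.≤-trans (ℕ.*-monoʳ-≤ 2 (ℕ.≤-trans k≤h (ℕ.≤-reflexive h≡)))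
        (ℕ.≤-trans (ℕ.≤-reflexive (ℕ.*-comm 2 (n ℕ./ 2))) (m/n*n≤m n 2))

    -- The indices up to 2h + 1 used in pairing terms reach n, so the full sums over C(n+k, 2k) are
    -- obtained.
    n<2[1+h] : n ℕ.< 2 ℕ.* suc h
    n<2[1+h] = subst (n ℕ.<_) (sym (trans (ℕ.*-suc 2 h) (cong (2 ℕ.+_) (trans (ℕ.*-comm 2 h) (cong (ℕ._* 2) h≡)))))
      (subst (ℕ._< 2 ℕ.+ n ℕ./ 2 ℕ.* 2) (sym (m≡m%n+[m/n]*n n 2)) (ℕ.+-monoˡ-< (n ℕ./ 2 ℕ.* 2) (m%n<n n 2)))

    2S₁ : + 2 * Σ⁰ (suc h) (λ k → c (2 ℕ.* k)) ≡ F + Chebyshev.a -[1+ 0 ] n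
    2S₁ = trans (sym (even-terms (suc h) c)) (cong₂ _+_
        (trans (sum-c (+ 1) n<2[1+h]) (Fibonacci.a≡fib n)) (sum-c -[1+ 0 ] n<2[1+h]))

  A∼fib : A p ∼ fib (suc (2 ℕ.* (p ℕ./ 3)))
  A∼fib = subst (A p ∼_) (trans (cong (_- e) 2S₁) (solve 2 (λ F e → F :+ e :- e := F) refl F e))
    (∼-+ {(+ 2 ℚ./ 1) ℚ.* S₁ p} {ℚ.- ε p} (∼-* {+ 2 ℚ./ 1} {S₁ p} (∼-int (+ 2)) S₁∼)
      (∼-neg {ε p} (subst (_∼ e) (sym (ε-value pr 5<p)) (∼-int e))))
    where e = Chebyshev.a -[1+ 0 ] n

quotient-by-3 : ∀ p {r} → p % 3 ≡ r → p ≡ r ℕ.+ 3 ℕ.* (p ℕ./ 3)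
quotient-by-3 p h = trans (m≡m%n+[m/n]*n p 3) (cong₂ ℕ._+_ h (ℕ.*-comm (p ℕ./ 3) 3))

15⇒3 : ∀ p {r} → p % 15 ≡ r → p % 3 ≡ r % 3
15⇒3 p h = trans (sym (m∣n⇒o%n%m≡o%m 3 15 p (ℕ.divides 5 refl))) (cong (_% 3) h)

theorem3p4 : (p : ℕ) → Prime p → 5 < p →
    ((x y : ℤ) → (p % 15 ≡ 1 ⊎ p % 15 ≡ 4) → + p ≡ x * x + + 15 * (y * y) →
    (A p ≡ S₂ p [modℚ p ])
    × (+ 3 ∣ℤ y → S₂ p ≡ 1ℚ [modℚ p ])
    × (+ 3 ∣ℤ (y - x) → S₂ p ≡ divℤ (x - + 5 * y) (+ 10 * y) [modℚ p ]))
    × ((x y : ℤ) → (p % 15 ≡ 2 ⊎ p % 15 ≡ 8) → + p ≡ + 5 * (x * x) + + 3 * (y * y) →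
    (A p ≡ S₂ p [modℚ p ])
    × (+ 3 ∣ℤ y → S₂ p ≡ 1ℚ [modℚ p ])
    × (+ 3 ∣ℤ (y - x) → S₂ p ≡ divℤ (ℤ.- (x + y)) (+ 2 * y) [modℚ p ]))
theorem3p4 p pr 5<p = part-i , part-ii
  where
  open ℤ/ (+ p)
  open Rational/ pr

  F : ℤ
  F = fib (suc (2 ℕ.* (p ℕ./ 3)))

  part-i : (x y : ℤ) → (p % 15 ≡ 1 ⊎ p % 15 ≡ 4) → + p ≡ x * x + + 15 * (y * y) →
    (A p ≡ S₂ p [modℚ p ])
    × (+ 3 ∣ℤ y → S₂ p ≡ 1ℚ [modℚ p ])
    × (+ 3 ∣ℤ (y - x) → S₂ p ≡ divℤ (x - + 5 * y) (+ 10 * y) [modℚ p ])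
  part-i x y h form =
      ∼⇒≡mod {A p} {S₂ p} A∼fib S₂∼fib ≋-refl
    , (λ 3∣y → ∼⇒≡mod {S₂ p} {1ℚ} S₂∼fib (∼-int (+ 1)) (fib-trivial (∣ᵤ⇒∣ 3∣y)))
    , (λ 3∣y-x → ∼⇒≡mod {S₂ p} {divℤ (x - + 5 * y) (+ 10 * y)} S₂∼fib
        (∼-divℤ (x - + 5 * y) p∤10y (≋-trans (≋-sym (fib-nontrivial (∣ᵤ⇒∣ 3∣y-x))) (≈⇒≋ (ℤ.*-comm (+ 10 * y) F)))) ≋-refl)
    where
    p≡ : p ≡ suc (3 ℕ.* (p ℕ./ 3))
    p≡ = quotient-by-3 p ([ 15⇒3 p , 15⇒3 p ]′ h)
    open Sums pr 5<p (inj₁ p≡)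
    open FormX²+15Y² pr 5<p x y form {p ℕ./ 3} p≡

  part-ii : (x y : ℤ) → (p % 15 ≡ 2 ⊎ p % 15 ≡ 8) → + p ≡ + 5 * (x * x) + + 3 * (y * y) →
    (A p ≡ S₂ p [modℚ p ])
    × (+ 3 ∣ℤ y → S₂ p ≡ 1ℚ [modℚ p ])
    × (+ 3 ∣ℤ (y - x) → S₂ p ≡ divℤ (ℤ.- (x + y)) (+ 2 * y) [modℚ p ])
  part-ii x y h form =
      ∼⇒≡mod {A p} {S₂ p} A∼fib S₂∼fib ≋-refl
    , (λ 3∣y → ∼⇒≡mod {S₂ p} {1ℚ} S₂∼fib (∼-int (+ 1)) (fib-trivial (∣ᵤ⇒∣ 3∣y)))
    , (λ 3∣y-x → ∼⇒≡mod {S₂ p} {divℤ (- (x + y)) (+ 2 * y)} S₂∼fib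
        (∼-divℤ (- (x + y)) p∤2y (≋-trans (≋-sym (fib-nontrivial (∣ᵤ⇒∣ 3∣y-x))) (≈⇒≋ (ℤ.*-comm (+ 2 * y) F)))) ≋-refl)
    where
    p≡ : p ≡ suc (suc (3 ℕ.* (p ℕ./ 3)))
    p≡ = quotient-by-3 p ([ 15⇒3 p , 15⇒3 p ]′ h)
    open Sums pr 5<p (inj₂ p≡)
    open Form5X²+3Y² pr 5<p x y form {p ℕ./ 3} (trans (cong suc p≡) (sym (ℕ.*-suc 3 (p ℕ./ 3))))
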